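{- Let $N$ be a ground set with $n=|N|$ (with $\sqrt n$ an integer) and let $1\le k\le n$. Let $\mathcal D^{sub}$ be the distribution on $2^N$ which, with probability $1/3$ each, draws a uniformly random subset of $N$ of size $k$, of size $\sqrt n$, or of size $\sqrt n+1$. Consider the following algorithm, given polynomially many (sufficiently many) samples $(S_i,f(S_i))$ with $S_i$ drawn i.i.d. from $\mathcal D^{sub}$. With probability $1/2$ it returns the sample of size $k$ with largest value. With probability $1/2$ it computes, for each $e_i\in N$, $\hat v_i=\frac{1}{|\mathcal S_{i,\sqrt n+1}|}\sum_{S\in\mathcal S_{i,\sqrt n+1}}f(S)-\frac{1}{|\mathcal S_{ -i,\sqrt n}|}\sum_{S\in\mathcal S_{ -i,\sqrt n}}f(S)$, where $\mathcal S_{i,j}$ (resp. $\mathcal S_{ -i,j}$) is the collection of samples of size $j$ containing (resp. not containing) $e_i$; sets $\hat v_{\max}=\max_i\hat v_i$; forms bins $B_j=\{e_i:\hat v_{\max}/2^{j}<\hat v_i\le \hat v_{\max}/2^{j-1}\}$ for $j\in[3\log n]$; picks $j\in[3\log n]$ uniformly at random; and returns a uniformly random subset of $B_j$ of size $\min\{|B_j|,k\}$. Then this algorithm is an $\tilde\Omega(n^{ -1/4})$-OPS algorithm over $\mathcal D^{sub}$ for monotone submodular functions, i.e., for every monotone submodular $f:2^N\to\mathbb R$, with probability at least $1-\delta$ over the samples (for a constant $\delta\in[0,1)$), the returned set $S$ satisfies $|S|\le k$ and $\mathbb E[f(S)]\ge \frac{n^{ -1/4}}{\mathrm{polylog}(n)}\max_{T:|T|\le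 k}f(T)$, the expectation being over the algorithm's randomness.
   Context: A function $f:2^N\to\mathbb R$ is monotone if $f(S\cup\{e\})-f(S)\ge0$ for all $S,e$, and submodular if $f(S\cup\{e\})-f(S)\ge f(T\cup\{e\})-f(T)$ for all $S\subseteq T\subseteq N$, $e\in N$. $\tilde\Omega(n^{ -1/4})$ denotes $\Omega(n^{ -1/4})$ up to polylogarithmic factors in $n$. The number of samples is polynomial in $n$.
   Formalization: The functions f are additionally assumed non-negative; without this the claim is false, since for the constant function f = -1 the optimum and every returned value are -1, which is less than -n^{ -1/4}/polylog(n) for large n. -}

module Defs where

open import Algebra.Bundles using (CommutativeRing; Semiring)
open import Algebra.Structures using (IsCommutativeRing)
open import Data.Bool.Base using (if_then_else_)
open import Data.Fin.Base using (Fin)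
open import Data.Fin.Subset using (Subset; inside; outside; _⊆_; _∪_; ⁅_⁆; ∣_∣; ⊥)
open import Data.Fin.Subset.Properties using (_∈?_; _⊆?_)
open import Data.List.Base using (List; []; _∷_; _++_; map; foldr; length; filter; concatMap; allFin; upTo)
import Data.List.Extrema as Extrema
open import Data.List.Relation.Unary.All using (All; all?)
open import Data.Nat.Base as ℕ using (ℕ; zero; suc)
open import Data.Nat.Logarithm using (⌊log₂_⌋)
import Data.Nat.Properties as ℕ
open import Data.Product.Base using (_×_; _,_; proj₁; proj₂; ∃-syntax)
import Data.Vec.Base as Vec
open import Level using (Level; _⊔_) renaming (suc to lsuc)
open import Relation.Binary.Bundles using (DecTotalOrder)
open import Relation.Binary.Core using (Rel)
open import Relation.Binary.Definitions using (Decidable)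
open import Relation.Binary.PropositionalEquality.Core using (_≡_)
open import Relation.Binary.Structures using (IsDecTotalOrder)
import Relation.Binary.Construct.NonStrictToStrict as NonStrictToStrict
open import Relation.Nullary.Decidable using (Dec; does; _×-dec_; ¬?)
open import Relation.Nullary.Negation using (¬_)
import Relation.Unary as U

private
  variable
    a b p : Level
    A : Set a
    B : Set b
    n : ℕ

-- An ordered field in which every non-negative element has a square root.
-- The real numbers (with classical logic, for decidability of the order) are
-- one; square roots are there so that n^(-1/4) can be written down.  The values
-- of _⁻¹ at zero and of √_ on negative elements are unconstrained.
record EuclideanField c ℓ₁ ℓ₂ : Set (lsuc (c ⊔ ℓ₁ ⊔ ℓ₂)) where
  infix  9 _⁻¹ √_
  infix  8 -_
  infixl 7 _*_
  infixl 6 _+_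
  infix  4 _≈_ _≤_
  field
    Carrier           : Set c
    _≈_               : Rel Carrier ℓ₁
    _≤_               : Rel Carrier ℓ₂
    _+_ _*_           : Carrier → Carrier → Carrier
    -_ _⁻¹ √_         : Carrier → Carrier
    0# 1#             : Carrier
    isCommutativeRing : IsCommutativeRing _≈_ _+_ _*_ -_ 0# 1#
    isDecTotalOrder   : IsDecTotalOrder _≈_ _≤_
    0≉1               : ¬ (0# ≈ 1#)
    ⁻¹-inverseˡ       : ∀ {x} → ¬ (x ≈ 0#) → x ⁻¹ * x ≈ 1#
    +-monoˡ-≤         : ∀ z {x y} → x ≤ y → x + z ≤ y + z
    *-nonNeg          : ∀ {x y} → 0# ≤ x → 0# ≤ y → 0# ≤ x * y
    √-nonNeg          : ∀ {x} → 0# ≤ x → 0# ≤ √ x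
    √-square          : ∀ {x} → 0# ≤ x → √ x * √ x ≈ x

  commutativeRing : CommutativeRing c ℓ₁
  commutativeRing = record { isCommutativeRing = isCommutativeRing }

  decTotalOrder : DecTotalOrder c ℓ₁ ℓ₂
  decTotalOrder = record { isDecTotalOrder = isDecTotalOrder }

  open CommutativeRing commutativeRing public
    using (_-_; semiring)
  open DecTotalOrder decTotalOrder public
    using (_≤?_; totalOrder)
  open IsDecTotalOrder isDecTotalOrder public
    using (_≟_)
  open import Algebra.Definitions.RawSemiring (Semiring.rawSemiring semiring) public
    using (_^_) renaming (_×_ to _⋆_)
  open NonStrictToStrict _≈_ _≤_ public
    using (_<_)

  infix 4 _<?_
  _<?_ : Decidable _<_
  _<?_ = NonStrictToStrict.<-decidable _≈_ _≤_ _≟_ _≤?_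

  fromℕ : ℕ → Carrier
  fromℕ m = m ⋆ 1#

module OPS {c ℓ₁ ℓ₂} (ℝ : EuclideanField c ℓ₁ ℓ₂) where

  open EuclideanField ℝ public

  private
    variable
      ℓ : Level

  sum : List Carrier → Carrier
  sum = foldr _+_ 0#

  -- The average of the empty list is 0.
  average : List Carrier → Carrier
  average xs = sum xs * fromℕ (length xs) ⁻¹

  -- The default 0 is only returned for the empty list.
  maximum : List Carrier → Carrier
  maximum []       = 0#
  maximum (x ∷ xs) = Extrema.max totalOrder x xs

  Dist : Set a → Set (c ⊔ a)
  Dist A = List (Carrier × A)

  return : A → Dist A
  return x = (1# , x) ∷ []

  infixl 1 _>>=_
  _>>=_ : Dist A → (A → Dist B) → Dist B
  d >>= g = concatMap (λ (w , x) → map (λ (v , y) → w * v , y) (g x)) d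

  -- Only a distribution for a non-empty list; repeated entries count with
  -- multiplicity.
  uniform : List A → Dist A
  uniform xs = map (fromℕ (length xs) ⁻¹ ,_) xs

  -- Choose one of the listed distributions uniformly, then draw from it.
  mixture : List (Dist A) → Dist A
  mixture ds = uniform ds >>= λ d → d

  iid : ℕ → Dist A → Dist (List A)
  iid zero    d = return []
  iid (suc m) d = d >>= λ x → iid m d >>= λ xs → return (x ∷ xs)

  𝔼 : Dist A → (A → Carrier) → Carrier
  𝔼 d g = sum (map (λ (w , x) → w * g x) d)

  ℙ : Dist A → {P : U.Pred A p} → U.Decidable P → Carrier
  ℙ d P? = 𝔼 d (λ x → if does (P? x) then 1# else 0#)

  Surely : ∀ {a} {A : Set a} → Dist A → U.Pred A p → Set (c ⊔ a ⊔ p)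
  Surely d P = All (λ (_ , x) → P x) d

  surely? : (d : Dist A) {P : U.Pred A p} → U.Decidable P → Dec (Surely d P)
  surely? d P? = all? (λ (_ , x) → P? x) d

  SetFunction : ℕ → Set c
  SetFunction n = Subset n → Carrier

  marginal : SetFunction n → Subset n → Fin n → Carrier
  marginal f S e = f (S ∪ ⁅ e ⁆) - f S

  NonNegative Monotone Submodular : SetFunction n → Set ℓ₂
  NonNegative f = ∀ S → 0# ≤ f S
  Monotone    f = ∀ S e → 0# ≤ marginal f S e
  Submodular  f = ∀ S T e → S ⊆ T → marginal f T e ≤ marginal f S e

  -- Without non-negativity no multiplicative guarantee is possible: f could be
  -- the constant -1.
  NonNegativeMonotoneSubmodular : SetFunction n → Set ℓ₂
  NonNegativeMonotoneSubmodular f = NonNegative f × Monotone f × Submodular f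

  subsets : ∀ n → List (Subset n)
  subsets zero    = Vec.[] ∷ []
  subsets (suc n) = map (outside Vec.∷_) (subsets n) ++ map (inside Vec.∷_) (subsets n)

  -- max { f(T) : |T| ≤ k }
  opt : ℕ → SetFunction n → Carrier
  opt {n} k f = maximum (map f (filter (λ T → ∣ T ∣ ℕ.≤? k) (subsets n)))

  uniformOfSize : ℕ → Dist (Subset n)
  uniformOfSize {n} j = uniform (filter (λ S → ∣ S ∣ ℕ.≟ j) (subsets n))

  uniformSubsetOf : Subset n → ℕ → Dist (Subset n)
  uniformSubsetOf {n} X j =
    uniform (filter (λ S → (S ⊆? X) ×-dec (∣ S ∣ ℕ.≟ j)) (subsets n))

  -- In what follows n is a square and s = √n.

  Sample : ℕ → Set c
  Sample n = Subset n × Carrier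

  Algorithm : Set c
  Algorithm = ∀ {n} (s k : ℕ) → List (Sample n) → Dist (Subset n)

  Distribution : Set c
  Distribution = ∀ {n} (s k : ℕ) → Dist (Subset n)

  -- For the output distribution `out` of an algorithm.
  Approximates : Carrier → ℕ → SetFunction n → Dist (Subset n) → Set (c ⊔ ℓ₂)
  Approximates r k f out =
    Surely out (λ S → ∣ S ∣ ℕ.≤ k) × r * opt k f ≤ 𝔼 out f

  approximates? : ∀ r k (f : SetFunction n) → U.Decidable (Approximates r k f)
  approximates? r k f out =
    surely? out (λ S → ∣ S ∣ ℕ.≤? k) ×-dec (r * opt k f ≤? 𝔼 out f)

  -- α-OPS over 𝒟 for the class 𝓕: with probability at least 1 - δ over the
  -- samples, the output is an α(n)-approximation in expectation over the
  -- algorithm's own randomness.  Any number of samples beyond some polynomial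
  -- bound, without loss of the form n ^ q, must do; δ and q depend on neither n,
  -- k nor f.  The condition 2 ≤ s ensures that subsets of size √n + 1 exist.
  IsOPS : (ℕ → Carrier) → Algorithm → Distribution →
          (∀ {n} → SetFunction n → Set ℓ) → Set (c ⊔ ℓ₁ ⊔ ℓ₂ ⊔ ℓ)
  IsOPS α 𝒜 𝒟 𝓕 =
    ∃[ δ ] 0# ≤ δ × δ < 1# ×
    (∃[ q ] ∀ n s k → n ≡ s ℕ.* s → 2 ℕ.≤ s → 1 ℕ.≤ k → k ℕ.≤ n →
      (f : SetFunction n) → 𝓕 f →
      ∀ m → n ℕ.^ q ℕ.≤ m →
      1# - δ ≤ ℙ (iid m (𝒟 s k))
                 (λ Ss → approximates? (α n) k f (𝒜 s k (map (λ S → S , f S) Ss))))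

  -- α(n) = Ω(g(n)) up to polylogarithmic factors.
  Ω̃ : (ℕ → Carrier) → (ℕ → Carrier) → Set (c ⊔ ℓ₁ ⊔ ℓ₂)
  Ω̃ g α =
    ∃[ C ] 0# < C ×
    (∃[ d ] ∃[ n₀ ] ∀ n → n₀ ℕ.≤ n → C * g n ≤ α n * fromℕ ⌊log₂ n ⌋ ^ d)

  n^-¼ : ℕ → Carrier
  n^-¼ n = (√ (√ (fromℕ n))) ⁻¹

  𝒟ˢᵘᵇ : Distribution
  𝒟ˢᵘᵇ s k = mixture (uniformOfSize k ∷ uniformOfSize s ∷ uniformOfSize (suc s) ∷ [])

  -- The largest-valued sample of size k; the empty set if there is none.
  bestSample : ℕ → List (Sample n) → Subset n
  bestSample k 𝒮 = pick (filter (λ (S , _) → ∣ S ∣ ℕ.≟ k) 𝒮)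
    where
    pick : List (Sample _) → Subset _
    pick []       = ⊥
    pick (x ∷ xs) = proj₁ (Extrema.argmax totalOrder proj₂ x xs)

  samplesWith samplesWithout : Fin n → ℕ → List (Sample n) → List (Sample n)
  samplesWith    i j = filter (λ (S , _) → (i ∈? S) ×-dec (∣ S ∣ ℕ.≟ j))
  samplesWithout i j = filter (λ (S , _) → ¬? (i ∈? S) ×-dec (∣ S ∣ ℕ.≟ j))

  v̂ : ℕ → List (Sample n) → Fin n → Carrier
  v̂ s 𝒮 i = average (map proj₂ (samplesWith i (suc s) 𝒮))
          - average (map proj₂ (samplesWithout i s 𝒮))

  v̂max : ℕ → List (Sample n) → Carrier
  v̂max {n} s 𝒮 = maximum (map (v̂ s 𝒮) (allFin n))

  -- Here j stands for the bin of index j + 1.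
  bin : ℕ → List (Sample n) → ℕ → Subset n
  bin s 𝒮 j = Vec.tabulate λ i → does
    ((v̂max s 𝒮 * fromℕ (2 ℕ.^ suc j) ⁻¹ <? v̂ s 𝒮 i) ×-dec
     (v̂ s 𝒮 i ≤? v̂max s 𝒮 * fromℕ (2 ℕ.^ j) ⁻¹))

  -- ⌊ 3 log₂ n ⌋
  numBins : ℕ → ℕ
  numBins n = ⌊log₂ (n ℕ.^ 3) ⌋

  binAlgorithm : Algorithm
  binAlgorithm {n} s k 𝒮 =
    uniform (upTo (numBins n)) >>= λ j →
    uniformSubsetOf (bin s 𝒮 j) (∣ bin s 𝒮 j ∣ ℕ.⊓ k)

  algorithm : Algorithm
  algorithm s k 𝒮 = mixture (return (bestSample k 𝒮) ∷ binAlgorithm s k 𝒮 ∷ [])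

{-# OPTIONS --safe #-}

-- Let O be the optimum, s = √n, h = n^(-1/4), and R a uniformly random s-set.
--
-- If E f(R) ≥ O/2, then by submodularity the average of f over k-sets is at least min(1, k/s) O/2,
-- while some singleton, hence every set containing it, is worth about O/k.  As h² = 1/s, one of the
-- two is of order hO, so a k-set of value hO/4 is drawn with probability at least 1/(12n) and the
-- best sample of size k has this value.
--
-- Otherwise, the expected gain from adding the optimal set to R exceeds O/2.  By Chebyshev's
-- inequality v̂ estimates the expected marginals with respect to R up to O/poly(n).  The expected
-- gain is subadditive, and the elements outside the L bins hardly contribute, so in some bin B the
-- optimal elements gain at least W = O/(8L).  Hence all elements of B have a marginal of order W/k,
-- and R meets B in a uniformly random subset of size about |B|/s.  So a random k-subset of B is
-- worth both (k/|B|) W and about (|B|/(ks)) W, and the larger of the two is of order hW.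

module Submission where

open import Defs
open import Algebra.Bundles using (CommutativeRing)
import Algebra.Properties.Ring
import Algebra.Properties.Semiring.Mult
import Algebra.Solver.Ring
open import Algebra.Solver.Ring.AlmostCommutativeRing using (fromCommutativeRing; Induced-equivalence; _-Raw-AlmostCommutative⟶_)
open import Data.Bool.Base using (Bool; true; false; if_then_else_; _∨_)
open import Data.Fin.Base using (Fin; zero; suc; fromℕ<)
open import Data.Fin.Properties using () renaming (_≟_ to _≟ᶠ_)
open import Data.Fin.Subset using (Subset; inside; outside; _∈_; _∉_; _⊆_; _∪_; _∩_; ∁; ⁅_⁆; ∣_∣; ⊥; ⊤) renaming (_-_ to _∖_)
open import Data.Fin.Subset.Properties
open import Data.Integer.Base as ℤ using (ℤ; -[1+_]; _⊖_; _◃_)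
import Data.Integer.Properties as ℤ
open import Data.List.Base using (List; []; _∷_; _++_; map; length; filter; allFin; upTo; cartesianProduct)
import Data.List.Extrema as Extrema
import Data.List.Membership.Propositional as List using (_∈_)
import Data.List.Membership.Propositional.Properties as List
import Data.List.Properties as List
open import Data.List.Relation.Unary.All as All using (All; []; _∷_)
import Data.List.Relation.Unary.All.Properties as All
open import Data.List.Relation.Unary.Any using (here; there)
open import Data.Maybe.Base using (just; nothing)
open import Data.Nat.Base as ℕ using (ℕ; zero; suc)
open import Data.Nat.Logarithm using (⌊log₂_⌋; ⌊log₂⌋-mono-≤; ⌊log₂[2^n]⌋≡n)
import Data.Nat.Properties as ℕ
open import Data.Nat.Solver using (module +-*-Solver)
open import Data.Product using (∃-syntax; _×_; _,_; proj₁; proj₂)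
open import Data.Sign.Base as Sign using (Sign)
open import Data.Sum.Base using (_⊎_; inj₁; inj₂)
open import Data.Unit.Base using (tt) renaming (⊤ to Unit)
open import Data.Vec.Base using ([]; _∷_; here; there; insertAt; tabulate)
open import Data.Vec.Properties using (lookup∘tabulate; []=⇒lookup; lookup⇒[]=)
open import Function.Base using (_∘_; id)
import Level
open import Relation.Binary.Bundles using (DecTotalOrder)
import Relation.Binary.Construct.NonStrictToStrict as NonStrictToStrict
open import Relation.Binary.Definitions using (WeaklyDecidable)
open import Relation.Binary.PropositionalEquality as ≡ using (_≡_; _≢_)
import Relation.Binary.Reasoning.PartialOrder
open import Relation.Nullary using (¬_; Dec; yes; no; does; contradiction; _×-dec_; ¬?)
import Relation.Unary as U

-- Two obstacles shape the proof. The size of R ∩ B is random, whereas the algorithm draws sets of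
-- the fixed size min(|B|, k). They are compared by k avg(l) ≤ (k + l) avg(k), where avg(j) is the
-- mean of f over the j-subsets of B: the bound is affine in l, so the expectation of |R ∩ B|
-- suffices. And each half of an estimate v̂ is a quotient with a random denominator. Its accuracy
-- is therefore expressed by the positivity of two sums over the samples, with i.i.d. terms of
-- positive mean; Chebyshev's inequality and a union bound over 4n such sums give success with
-- probability at least 1/2. All values of f are at most 2nO, an accuracy of O/n^8 is enough for the
-- bins, and the exponent 26 of the sample size follows from these two. Binomial coefficients never
-- appear in closed form: the counts come from double counting pairs of a set and an element.

private
  variable
    n : ℕ

-- Combinatorics of finite subsets

subset-induction : ∀ {n p} (P : Subset n → Set p) → P ⊥ →
  (∀ Z e → e ∉ Z → P Z → P (Z ∪ ⁅ e ⁆)) → ∀ Z → P Z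
subset-induction P base step [] = base
subset-induction P base step (b ∷ Z) = add b
  where
  out-Z : P (outside ∷ Z)
  out-Z = subset-induction (P ∘ (outside ∷_)) base
    (λ Z e e∉Z → step (outside ∷ Z) (suc e) (e∉Z ∘ drop-there)) Z
  add : ∀ b → P (b ∷ Z)
  add false = out-Z
  add true = ≡.subst (λ X → P (inside ∷ X)) (∪-identityʳ Z) (step (outside ∷ Z) zero (λ ()) out-Z)

∣S∪⁅e⁆∣ : ∀ {S : Subset n} {e} → e ∉ S → ∣ S ∪ ⁅ e ⁆ ∣ ≡ suc ∣ S ∣
∣S∪⁅e⁆∣ {S = true ∷ S} {zero} e∉S = contradiction here e∉S
∣S∪⁅e⁆∣ {S = false ∷ S} {zero} e∉S = ≡.cong (suc ∘ ∣_∣) (∪-identityʳ S)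
∣S∪⁅e⁆∣ {S = true ∷ S} {suc e} e∉S = ≡.cong suc (∣S∪⁅e⁆∣ (e∉S ∘ there))
∣S∪⁅e⁆∣ {S = false ∷ S} {suc e} e∉S = ∣S∪⁅e⁆∣ (e∉S ∘ there)

e∈S∪⁅e⁆ : ∀ (S : Subset n) e → e ∈ S ∪ ⁅ e ⁆
e∈S∪⁅e⁆ S e = q⊆p∪q S ⁅ e ⁆ (x∈⁅x⁆ e)

∪-⊆ : ∀ {S T X : Subset n} → S ⊆ X → T ⊆ X → S ∪ T ⊆ X
∪-⊆ {S = S} {T} p q x∈ with x∈p∪q⁻ S T x∈
... | inj₁ x∈S = p x∈S
... | inj₂ x∈T = q x∈T

⁅⁆-⊆ : ∀ {S : Subset n} {e} → e ∈ S → ⁅ e ⁆ ⊆ S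
⁅⁆-⊆ {S = S} {e} e∈S x∈ = ≡.subst (_∈ S) (≡.sym (x∈⁅y⁆⇒x≡y e x∈)) e∈S

e∉S∖e : ∀ (S : Subset n) e → e ∉ S ∖ e
e∉S∖e (b ∷ S) (suc e) (there e∈) = e∉S∖e S e e∈

S∖e∪⁅e⁆ : ∀ {S : Subset n} {e} → e ∈ S → (S ∖ e) ∪ ⁅ e ⁆ ≡ S
S∖e∪⁅e⁆ {S = S} {e} e∈S = ⊆-antisym (∪-⊆ (p─q⊆p S ⁅ e ⁆) (⁅⁆-⊆ e∈S)) back
  where
  back : S ⊆ (S ∖ e) ∪ ⁅ e ⁆
  back {x} x∈S with x ≟ᶠ e
  ... | yes ≡.refl = e∈S∪⁅e⁆ (S ∖ e) e
  ... | no  x≢e    = p⊆p∪q ⁅ e ⁆ (x∈p∧x≢y⇒x∈p-y x∈S x≢e)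

S∪⁅e⁆∖e : ∀ {S : Subset n} {e} → e ∉ S → (S ∪ ⁅ e ⁆) ∖ e ≡ S
S∪⁅e⁆∖e {S = S} {e} e∉S = ⊆-antisym forth back
  where
  forth : (S ∪ ⁅ e ⁆) ∖ e ⊆ S
  forth {x} x∈ with x∈p∪q⁻ S ⁅ e ⁆ (p─q⊆p (S ∪ ⁅ e ⁆) ⁅ e ⁆ x∈)
  ... | inj₁ x∈S = x∈S
  ... | inj₂ x∈e = contradiction (≡.subst (_∈ (S ∪ ⁅ e ⁆) ∖ e) (x∈⁅y⁆⇒x≡y e x∈e) x∈) (e∉S∖e (S ∪ ⁅ e ⁆) e)
  back : S ⊆ (S ∪ ⁅ e ⁆) ∖ e
  back x∈S = x∈p∧x≢y⇒x∈p-y (p⊆p∪q ⁅ e ⁆ x∈S) (λ { ≡.refl → e∉S x∈S })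

S∪⁅e⁆≡S : ∀ {S : Subset n} {e} → e ∈ S → S ∪ ⁅ e ⁆ ≡ S
S∪⁅e⁆≡S {e = e} e∈S = ⊆-antisym (∪-⊆ id (⁅⁆-⊆ e∈S)) (p⊆p∪q ⁅ e ⁆)

∣insertAt∣ : ∀ (S : Subset n) e → ∣ insertAt S e outside ∣ ≡ ∣ S ∣
∣insertAt∣ S zero = ≡.refl
∣insertAt∣ (true ∷ S) (suc e) = ≡.cong suc (∣insertAt∣ S e)
∣insertAt∣ (false ∷ S) (suc e) = ∣insertAt∣ S e

∣∪∣-disjoint : ∀ {X Z : Subset n} → (∀ {e} → e ∈ X → e ∉ Z) → ∣ X ∪ Z ∣ ≡ ∣ X ∣ ℕ.+ ∣ Z ∣
∣∪∣-disjoint {X = []} {[]} p = ≡.refl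
∣∪∣-disjoint {X = true ∷ X} {true ∷ Z} p = contradiction here (p here)
∣∪∣-disjoint {X = true ∷ X} {false ∷ Z} p = ≡.cong suc (∣∪∣-disjoint {X = X} {Z} (λ a b → p (there a) (there b)))
∣∪∣-disjoint {X = false ∷ X} {true ∷ Z} p = ≡.trans (≡.cong suc (∣∪∣-disjoint {X = X} {Z} (λ a b → p (there a) (there b)))) (≡.sym (ℕ.+-suc _ _))
∣∪∣-disjoint {X = false ∷ X} {false ∷ Z} p = ∣∪∣-disjoint {X = X} {Z} (λ a b → p (there a) (there b))

-- For R = X ∪ Z split along B as in `∑ₛ-split`, this lets `fibrewise` read R ∩ B as the inner
-- summation variable.
∪∩-recover : ∀ {X Z B : Subset n} → X ⊆ ∁ B → Z ⊆ B → (X ∪ Z) ∩ B ≡ Z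
∪∩-recover {X = X} {Z} {B} X⊆ Z⊆ = ⊆-antisym forth (λ z → x∈p∩q⁺ (q⊆p∪q X Z z , Z⊆ z))
  where
  forth : (X ∪ Z) ∩ B ⊆ Z
  forth x∈ with x∈p∩q⁻ (X ∪ Z) B x∈
  ... | x∈X∪Z , x∈B with x∈p∪q⁻ X Z x∈X∪Z
  ...   | inj₁ x∈X = contradiction x∈B (x∈∁p⇒x∉p (X⊆ x∈X))
  ...   | inj₂ x∈Z = x∈Z

module _ {p} {n} {P : U.Pred (Fin n) p} (P? : U.Decidable P) where

  ∈-tabulate⁻ : ∀ {i} → i ∈ tabulate (does ∘ P?) → P i
  ∈-tabulate⁻ {i} i∈ with P? i | ≡.trans (≡.sym (lookup∘tabulate (does ∘ P?) i)) ([]=⇒lookup i∈)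
  ... | yes p | _ = p

  ∈-tabulate⁺ : ∀ {i} → P i → i ∈ tabulate (does ∘ P?)
  ∈-tabulate⁺ {i} p = lookup⇒[]= i _ (≡.trans (lookup∘tabulate (does ∘ P?) i) (holds (P? i)))
    where
    holds : (d : Dec (P i)) → does d ≡ true
    holds (yes _) = ≡.refl
    holds (no ¬p) = contradiction p ¬p

-- Makes B the only subset of B of size |B|, so that the average over such subsets is the value of B
-- itself.
⊆-∣∣-≡ : ∀ {n} {S T : Subset n} → S ⊆ T → ∣ S ∣ ≡ ∣ T ∣ → T ⊆ S
⊆-∣∣-≡ {S = S} {T} S⊆T eq {x} x∈T with x ∈? S
... | yes x∈S = x∈S
... | no  x∉S = contradiction eq (ℕ.<⇒≢ (p⊂q⇒∣p∣<∣q∣ (S⊆T , x , x∈T , x∉S)))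

-- Logarithms and numerical bounds

n<2^[1+log₂n] : ∀ n → n ℕ.< 2 ℕ.^ suc ⌊log₂ n ⌋
n<2^[1+log₂n] n = ℕ.≰⇒> λ p → ℕ.<-irrefl ≡.refl
  (ℕ.≤-trans (ℕ.≤-reflexive (≡.sym (⌊log₂[2^n]⌋≡n (suc ⌊log₂ n ⌋)))) (⌊log₂⌋-mono-≤ p))

log₂-≤ : ∀ {n m} → n ℕ.≤ 2 ℕ.^ m → ⌊log₂ n ⌋ ℕ.≤ m
log₂-≤ {n} {m} p = ℕ.≤-trans (⌊log₂⌋-mono-≤ p) (ℕ.≤-reflexive (⌊log₂[2^n]⌋≡n m))

≤-log₂ : ∀ {n m} → 2 ℕ.^ m ℕ.≤ n → m ℕ.≤ ⌊log₂ n ⌋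
≤-log₂ {n} {m} p = ℕ.≤-trans (ℕ.≤-reflexive (≡.sym (⌊log₂[2^n]⌋≡n m))) (⌊log₂⌋-mono-≤ p)

n≤2^n : ∀ n → n ℕ.≤ 2 ℕ.^ n
n≤2^n zero = ℕ.z≤n
n≤2^n (suc n) = ℕ.≤-trans (ℕ.+-mono-≤ (ℕ.m^n>0 2 n) (n≤2^n n))
  (ℕ.≤-reflexive (≡.cong (2 ℕ.^ n ℕ.+_) (≡.sym (ℕ.+-identityʳ _))))

rearrange : ∀ a b n p → (a ℕ.* n) ℕ.* (b ℕ.* p ℕ.* (b ℕ.* p)) ≡ a ℕ.* (b ℕ.* b) ℕ.* (n ℕ.* (p ℕ.* p))
rearrange = +-*-Solver.solve 4 (λ a b n p → (a :* n) :* (b :* p :* (b :* p)) := a :* (b :* b) :* (n :* (p :* p))) ≡.refl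
  where open +-*-Solver using (_:*_; _:=_)

-- A test with mean at least y/E and values up to Dy fails with probability at most x²/m, where x =
-- ED, and 8n x² ≤ m brings this down to 1/(8n). For x = 9 n^10 this asks for 648 n^21 samples, and
-- 648 ≤ 4^5 ≤ n^5 turns the constant into a power.
sample-bound : ∀ {n m x} → 4 ℕ.≤ n → x ℕ.≤ 9 ℕ.* n ℕ.^ 10 → n ℕ.^ 26 ℕ.≤ m → (8 ℕ.* n) ℕ.* (x ℕ.* x) ℕ.≤ m
sample-bound {n} {m} {x} 4≤n x≤ n²⁶≤m = begin
  (8 ℕ.* n) ℕ.* (x ℕ.* x)  ≤⟨ ℕ.*-monoʳ-≤ (8 ℕ.* n) (ℕ.*-mono-≤ x≤ x≤) ⟩
  (8 ℕ.* n) ℕ.* (9 ℕ.* p ℕ.* (9 ℕ.* p)) ≡⟨ rearrange 8 9 n p ⟩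
  8 ℕ.* (9 ℕ.* 9) ℕ.* (n ℕ.* (p ℕ.* p))
    ≤⟨ ℕ.*-monoˡ-≤ (n ℕ.* (p ℕ.* p)) (ℕ.≤-trans (ℕ.m≤m+n 648 376) (ℕ.^-monoˡ-≤ 5 4≤n)) ⟩
  n ℕ.^ 5 ℕ.* (n ℕ.* (p ℕ.* p))        ≡⟨ ≡.cong (λ z → n ℕ.^ 5 ℕ.* (n ℕ.* z)) (ℕ.^-distribˡ-+-* n 10 10) ⟨
  n ℕ.^ 5 ℕ.* n ℕ.^ 21  ≡⟨ ℕ.^-distribˡ-+-* n 5 21 ⟨
  n ℕ.^ 26  ≤⟨ n²⁶≤m ⟩
  m ∎
  where
  open ℕ.≤-Reasoning
  p = n ℕ.^ 10

-- The constant 96 is 8 * 6 * 2: W is O/(8L), the bin argument wants 6k times the error of v̂ to be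
-- at most W, and this error is twice η = O/n^8.
accuracy-bound : ∀ {n k L} → 4 ℕ.≤ n → k ℕ.≤ n → L ℕ.≤ n ℕ.^ 3 → 96 ℕ.* (k ℕ.* L) ℕ.≤ n ℕ.^ 8
accuracy-bound {n} {k} {L} 4≤n k≤n L≤ = begin
  96 ℕ.* (k ℕ.* L)  ≤⟨ ℕ.*-monoʳ-≤ 96 (ℕ.*-mono-≤ k≤n L≤) ⟩
  96 ℕ.* n ℕ.^ 4  ≤⟨ ℕ.*-monoˡ-≤ (n ℕ.^ 4) (ℕ.≤-trans (ℕ.m≤m+n 96 160) (ℕ.^-monoˡ-≤ 4 4≤n)) ⟩
  n ℕ.^ 4 ℕ.* n ℕ.^ 4  ≡⟨ ℕ.^-distribˡ-+-* n 4 4 ⟨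
  n ℕ.^ 8 ∎
  where open ℕ.≤-Reasoning

module Analysis {c ℓ₁ ℓ₂} (ℝ : EuclideanField c ℓ₁ ℓ₂) where
  open OPS ℝ

  -- Ordered fields

  module F = CommutativeRing commutativeRing
  module O = DecTotalOrder decTotalOrder
  open F using (+-cong; +-congˡ; +-congʳ; *-cong; *-congˡ; *-congʳ; -‿cong)
  open F using () renaming (refl to ≈-refl; sym to ≈-sym; trans to ≈-trans; reflexive to ≈-reflexive)
  open O using () renaming (refl to ≤-refl; trans to ≤-trans; reflexive to ≤-reflexive; antisym to ≤-antisym; total to ≤-total)
  open Relation.Binary.Reasoning.PartialOrder O.poset
  open Algebra.Properties.Semiring.Mult semiring using (×-homo-+; ×1-homo-*)
  open Algebra.Properties.Ring F.ring using (-‿involutive; -‿+-comm; -0#≈0#; -‿distribˡ-*; -‿distribʳ-*)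

  -- The solver's coefficients are integers because their equality test computes, whereas that of an
  -- abstract field does not.
  ⟦_⟧ℤ : ℤ → Carrier
  ⟦ ℤ.+ n ⟧ℤ = fromℕ n
  ⟦ -[1+ n ] ⟧ℤ = - fromℕ (suc n)

  ⊖-homo : ∀ m n → ⟦ m ⊖ n ⟧ℤ ≈ fromℕ m - fromℕ n
  ⊖-homo m zero = ≈-sym (≈-trans (+-congˡ -0#≈0#) (F.+-identityʳ _))
  ⊖-homo zero (suc n) = ≈-sym (F.+-identityˡ _)
  ⊖-homo (suc m) (suc n) = begin-equality
    ⟦ suc m ⊖ suc n ⟧ℤ  ≡⟨ ≡.cong ⟦_⟧ℤ (ℤ.[1+m]⊖[1+n]≡m⊖n m n) ⟩
    ⟦ m ⊖ n ⟧ℤ  ≈⟨ ⊖-homo m n ⟩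
    a - b  ≈⟨ +-congʳ (F.+-identityˡ a) ⟨
    0# + a - b  ≈⟨ +-congʳ (+-congʳ (F.-‿inverseʳ 1#)) ⟨
    1# - 1# + a - b  ≈⟨ +-congʳ (F.+-assoc _ _ _) ⟩
    1# + (- 1# + a) - b  ≈⟨ +-congʳ (+-congˡ (F.+-comm _ _)) ⟩
    1# + (a - 1#) - b  ≈⟨ +-congʳ (F.+-assoc _ _ _) ⟨
    1# + a - 1# - b  ≈⟨ F.+-assoc _ _ _ ⟩
    1# + a + (- 1# - b)  ≈⟨ +-congˡ (-‿+-comm _ _) ⟩
    1# + a - (1# + b) ∎
    where a = fromℕ m; b = fromℕ n

  +-homo : ∀ i j → ⟦ i ℤ.+ j ⟧ℤ ≈ ⟦ i ⟧ℤ + ⟦ j ⟧ℤ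
  +-homo (ℤ.+ m) (ℤ.+ n) = ×-homo-+ 1# m n
  +-homo (ℤ.+ m) -[1+ n ] = ⊖-homo m (suc n)
  +-homo -[1+ m ] (ℤ.+ n) = ≈-trans (⊖-homo n (suc m)) (F.+-comm _ _)
  +-homo -[1+ m ] -[1+ n ] = begin-equality
    - fromℕ (suc (suc (m ℕ.+ n)))        ≡⟨ ≡.cong (λ k → - fromℕ (suc k)) (ℕ.+-suc m n) ⟨
    - fromℕ (suc m ℕ.+ suc n)  ≈⟨ -‿cong (×-homo-+ 1# (suc m) (suc n)) ⟩
    - (fromℕ (suc m) + fromℕ (suc n))    ≈⟨ -‿+-comm _ _ ⟨
    - fromℕ (suc m) + - fromℕ (suc n) ∎

  -‿homo : ∀ i → ⟦ ℤ.- i ⟧ℤ ≈ - ⟦ i ⟧ℤ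
  -‿homo (ℤ.+ zero) = ≈-sym -0#≈0#
  -‿homo (ℤ.+ suc n) = ≈-refl
  -‿homo -[1+ n ] = ≈-sym (-‿involutive _)

  -◃-homo : ∀ n → ⟦ Sign.- ◃ n ⟧ℤ ≈ - fromℕ n
  -◃-homo zero = ≈-sym -0#≈0#
  -◃-homo (suc n) = ≈-refl

  +◃-homo : ∀ n → ⟦ Sign.+ ◃ n ⟧ℤ ≈ fromℕ n
  +◃-homo zero = ≈-refl
  +◃-homo (suc n) = ≈-refl

  *-homo : ∀ i j → ⟦ i ℤ.* j ⟧ℤ ≈ ⟦ i ⟧ℤ * ⟦ j ⟧ℤ
  *-homo (ℤ.+ m) (ℤ.+ n) = ≈-trans (+◃-homo (m ℕ.* n)) (×1-homo-* m n)
  *-homo (ℤ.+ m) -[1+ n ] = ≈-trans (-◃-homo (m ℕ.* suc n))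
    (≈-trans (-‿cong (×1-homo-* m (suc n))) (-‿distribʳ-* _ _))
  *-homo -[1+ m ] (ℤ.+ n) = ≈-trans (-◃-homo (suc m ℕ.* n))
    (≈-trans (-‿cong (×1-homo-* (suc m) n)) (-‿distribˡ-* _ _))
  *-homo -[1+ m ] -[1+ n ] = ≈-trans (+◃-homo (suc m ℕ.* suc n))
    (≈-trans (×1-homo-* (suc m) (suc n)) (≈-sym (≈-trans (≈-sym (-‿distribˡ-* _ _))
      (≈-trans (-‿cong (≈-sym (-‿distribʳ-* _ _))) (-‿involutive _)))))

  -- The solver's constant 1 must denote 1# rather than fromℕ 1 = 1# + 0#.
  ⟦_⟧¹ : ℤ → Carrier
  ⟦ ℤ.+ 1 ⟧¹ = 1#
  ⟦ i ⟧¹ = ⟦ i ⟧ℤ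

  ⟦⟧¹≈⟦⟧ℤ : ∀ i → ⟦ i ⟧¹ ≈ ⟦ i ⟧ℤ
  ⟦⟧¹≈⟦⟧ℤ (ℤ.+ 0) = ≈-refl
  ⟦⟧¹≈⟦⟧ℤ (ℤ.+ 1) = ≈-sym (F.+-identityʳ 1#)
  ⟦⟧¹≈⟦⟧ℤ (ℤ.+ suc (suc n)) = ≈-refl
  ⟦⟧¹≈⟦⟧ℤ -[1+ n ] = ≈-refl

  ℤ-coefficients : ℤ.+-*-rawRing -Raw-AlmostCommutative⟶ fromCommutativeRing commutativeRing
  ℤ-coefficients = record
    { ⟦_⟧ = ⟦_⟧¹
    ; +-homo = λ i j → via (i ℤ.+ j) (≈-trans (+-homo i j) (≈-sym (+-cong (⟦⟧¹≈⟦⟧ℤ i) (⟦⟧¹≈⟦⟧ℤ j))))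
    ; *-homo = λ i j → via (i ℤ.* j) (≈-trans (*-homo i j) (≈-sym (*-cong (⟦⟧¹≈⟦⟧ℤ i) (⟦⟧¹≈⟦⟧ℤ j))))
    ; -‿homo = λ i → via (ℤ.- i) (≈-trans (-‿homo i) (≈-sym (-‿cong (⟦⟧¹≈⟦⟧ℤ i))))
    ; 0-homo = ≈-refl ; 1-homo = ≈-refl }
    where
    via : ∀ i {x} → ⟦ i ⟧ℤ ≈ x → ⟦ i ⟧¹ ≈ x
    via i = ≈-trans (⟦⟧¹≈⟦⟧ℤ i)

  _ℤ-≟_ : WeaklyDecidable (Induced-equivalence ℤ-coefficients)
  i ℤ-≟ j with i ℤ.≟ j
  ... | yes i≡j = just (≈-reflexive (≡.cong ⟦_⟧¹ i≡j))
  ... | no  _   = nothing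

  open Algebra.Solver.Ring ℤ.+-*-rawRing (fromCommutativeRing commutativeRing) ℤ-coefficients _ℤ-≟_
    using (solve; _:=_; _:+_; _:*_; _:-_; :-_; con; Polynomial)

  :0 :1 :2 :3 :4 : ∀ {m} → Polynomial m
  :0 = con (ℤ.+ 0)
  :1 = con (ℤ.+ 1)
  :2 = con (ℤ.+ 2)
  :3 = con (ℤ.+ 3)
  :4 = con (ℤ.+ 4)

  1≈ : 1# ≈ fromℕ 1
  1≈ = ≈-sym (F.+-identityʳ 1#)

  0≤⇒≤ : ∀ {a b} → 0# ≤ b - a → a ≤ b
  0≤⇒≤ {a} {b} p = begin
    a  ≈⟨ F.+-identityˡ a ⟨
    0# + a       ≤⟨ +-monoˡ-≤ a p ⟩
    b - a + a    ≈⟨ solve 2 (λ a b → b :- a :+ a := b) ≈-refl a b ⟩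
    b ∎

  ≤⇒0≤ : ∀ {a b} → a ≤ b → 0# ≤ b - a
  ≤⇒0≤ {a} {b} p = begin
    0#       ≈⟨ F.-‿inverseʳ a ⟨
    a - a    ≤⟨ +-monoˡ-≤ (- a) p ⟩
    b - a ∎

  ≤-by : ∀ {a b d} → 0# ≤ d → b - a ≈ d → a ≤ b
  ≤-by p e = 0≤⇒≤ (≤-trans p (≤-reflexive (≈-sym e)))

  +-monoʳ-≤ : ∀ z {x y} → x ≤ y → z + x ≤ z + y
  +-monoʳ-≤ z {x} {y} p = begin
    z + x ≈⟨ F.+-comm z x ⟩
    x + z ≤⟨ +-monoˡ-≤ z p ⟩
    y + z ≈⟨ F.+-comm y z ⟩
    z + y ∎

  +-mono-≤ : ∀ {x y u v} → x ≤ y → u ≤ v → x + u ≤ y + v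
  +-mono-≤ p q = ≤-trans (+-monoˡ-≤ _ p) (+-monoʳ-≤ _ q)

  +-nonNeg : ∀ {x y} → 0# ≤ x → 0# ≤ y → 0# ≤ x + y
  +-nonNeg p q = ≤-trans (≤-reflexive (≈-sym (F.+-identityʳ 0#))) (+-mono-≤ p q)

  *-monoʳ-≤ : ∀ {z x y} → 0# ≤ z → x ≤ y → z * x ≤ z * y
  *-monoʳ-≤ {z} {x} {y} p q = ≤-by (*-nonNeg p (≤⇒0≤ q))
    (solve 3 (λ x y z → z :* y :- z :* x := z :* (y :- x)) ≈-refl x y z)

  *-monoˡ-≤ : ∀ {z x y} → 0# ≤ z → x ≤ y → x * z ≤ y * z
  *-monoˡ-≤ {z} {x} {y} p q = ≤-by (*-nonNeg p (≤⇒0≤ q))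
    (solve 3 (λ x y z → y :* z :- x :* z := z :* (y :- x)) ≈-refl x y z)

  *-mono-≤ : ∀ {x y u v} → 0# ≤ x → 0# ≤ v → x ≤ y → u ≤ v → x * u ≤ y * v
  *-mono-≤ 0≤x 0≤v p q = ≤-trans (*-monoʳ-≤ 0≤x q) (*-monoˡ-≤ 0≤v p)

  neg-mono : ∀ {x y} → x ≤ y → - y ≤ - x
  neg-mono {x} {y} p = ≤-by (≤⇒0≤ p) (solve 2 (λ x y → (:- x) :- (:- y) := y :- x) ≈-refl x y)

  square-nonNeg : ∀ x → 0# ≤ x * x
  square-nonNeg x with ≤-total 0# x
  ... | inj₁ p = *-nonNeg p p
  ... | inj₂ p = ≤-trans (*-nonNeg q q)
      (≤-reflexive (solve 1 (λ x → (:0 :- x) :* (:0 :- x) := x :* x) ≈-refl x))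
    where q = ≤⇒0≤ p

  0≤1 : 0# ≤ 1#
  0≤1 = ≤-trans (square-nonNeg 1#) (≤-reflexive (F.*-identityˡ 1#))

  0<1 : 0# < 1#
  0<1 = 0≤1 , 0≉1

  ≰⇒> : ∀ {x y} → ¬ (x ≤ y) → y < x
  ≰⇒> = NonStrictToStrict.≰⇒> _≈_ _≤_ ≈-sym ≤-reflexive ≤-total

  <⇒≱ : ∀ {x y} → x < y → ¬ (y ≤ x)
  <⇒≱ = NonStrictToStrict.<⇒≱ _≈_ _≤_ ≤-antisym

  <-≤-trans : ∀ {x y z} → x < y → y ≤ z → x < z
  <-≤-trans {x} {y} {z} p q = begin-strict x <⟨ p ⟩ y ≤⟨ q ⟩ z ∎

  ≤-<-trans : ∀ {x y z} → x ≤ y → y < z → x < z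
  ≤-<-trans {x} {y} {z} p q = begin-strict x ≤⟨ p ⟩ y <⟨ q ⟩ z ∎

  pos⇒≉0 : ∀ {x} → 0# < x → ¬ (x ≈ 0#)
  pos⇒≉0 p e = proj₂ p (≈-sym e)

  ⁻¹-inverseʳ : ∀ {x} → 0# < x → x * x ⁻¹ ≈ 1#
  ⁻¹-inverseʳ p = ≈-trans (F.*-comm _ _) (⁻¹-inverseˡ (pos⇒≉0 p))

  *-pos : ∀ {x y} → 0# < x → 0# < y → 0# < x * y
  *-pos {x} {y} p q = *-nonNeg (proj₁ p) (proj₁ q) , λ e → proj₂ q (begin-equality
    0#  ≈⟨ F.zeroʳ _ ⟨
    x ⁻¹ * 0#        ≈⟨ *-congˡ e ⟩
    x ⁻¹ * (x * y)   ≈⟨ F.*-assoc _ _ _ ⟨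
    x ⁻¹ * x * y     ≈⟨ *-congʳ (⁻¹-inverseˡ (pos⇒≉0 p)) ⟩
    1# * y           ≈⟨ F.*-identityˡ y ⟩
    y ∎)

  ⁻¹-nonNeg : ∀ {x} → 0# < x → 0# ≤ x ⁻¹
  ⁻¹-nonNeg {x} p = ≤-trans (*-nonNeg (proj₁ p) (square-nonNeg (x ⁻¹))) (≤-reflexive (begin-equality
    x * (x ⁻¹ * x ⁻¹)   ≈⟨ F.*-assoc _ _ _ ⟨
    x * x ⁻¹ * x ⁻¹     ≈⟨ *-congʳ (⁻¹-inverseʳ p) ⟩
    1# * x ⁻¹           ≈⟨ F.*-identityˡ _ ⟩
    x ⁻¹ ∎))

  ⁻¹-pos : ∀ {x} → 0# < x → 0# < x ⁻¹
  ⁻¹-pos {x} p = ⁻¹-nonNeg p , λ e → 0≉1 (begin-equality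
    0#          ≈⟨ F.zeroˡ x ⟨
    0# * x      ≈⟨ *-congʳ e ⟩
    x ⁻¹ * x    ≈⟨ ⁻¹-inverseˡ (pos⇒≉0 p) ⟩
    1# ∎)

  +-pos : ∀ {x y} → 0# < x → 0# ≤ y → 0# < x + y
  +-pos {x} {y} p q = <-≤-trans p (≤-by q (solve 2 (λ x y → x :+ y :- x := y) ≈-refl x y))

  *-cancelˡ-≈ : ∀ {z x y} → 0# < z → z * x ≈ z * y → x ≈ y
  *-cancelˡ-≈ {z} {x} {y} p q = begin-equality
    x  ≈⟨ unit x ⟨
    z ⁻¹ * (z * x)   ≈⟨ *-congˡ q ⟩
    z ⁻¹ * (z * y)   ≈⟨ unit y ⟩
    y ∎
    where
    unit : ∀ w → z ⁻¹ * (z * w) ≈ w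
    unit w = ≈-trans (≈-sym (F.*-assoc _ _ _))
      (≈-trans (*-congʳ (⁻¹-inverseˡ (pos⇒≉0 p))) (F.*-identityˡ w))

  *-cancelˡ-≤ : ∀ {z x y} → 0# < z → z * x ≤ z * y → x ≤ y
  *-cancelˡ-≤ {z} {x} {y} p q with ≤-total x y
  ... | inj₁ r = r
  ... | inj₂ r = ≤-reflexive (*-cancelˡ-≈ p (≤-antisym q (*-monoʳ-≤ (proj₁ p) r)))

  /-cancel : ∀ {z} x → 0# < z → z * (x * z ⁻¹) ≈ x
  /-cancel {z} x p = begin-equality
    z * (x * z ⁻¹)   ≈⟨ solve 3 (λ x z i → z :* (x :* i) := z :* i :* x) ≈-refl x z (z ⁻¹) ⟩
    z * z ⁻¹ * x     ≈⟨ *-congʳ (⁻¹-inverseʳ p) ⟩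
    1# * x           ≈⟨ F.*-identityˡ x ⟩
    x ∎

  ≤-/ : ∀ {x y z} → 0# < z → z * x ≤ y → x ≤ y * z ⁻¹
  ≤-/ p q = *-cancelˡ-≤ p (≤-trans q (≤-reflexive (≈-sym (/-cancel _ p))))

  /-≤ : ∀ {x y z} → 0# < z → x ≤ z * y → x * z ⁻¹ ≤ y
  /-≤ p q = *-cancelˡ-≤ p (≤-trans (≤-reflexive (/-cancel _ p)) q)

  square-cancel-≤ : ∀ {a b} → 0# ≤ a → 0# ≤ b → a * a ≤ b * b → a ≤ b
  square-cancel-≤ {a} {b} 0≤a 0≤b p with a ≤? b
  ... | yes q = q
  ... | no  q = contradiction (*-cancelˡ-≤ (≤-<-trans 0≤b b<a) (≤-trans p (*-monoˡ-≤ 0≤b (proj₁ b<a)))) q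
    where b<a = ≰⇒> q

  fromℕ-nonNeg : ∀ m → 0# ≤ fromℕ m
  fromℕ-nonNeg zero = ≤-refl
  fromℕ-nonNeg (suc m) = +-nonNeg 0≤1 (fromℕ-nonNeg m)

  fromℕ-pos : ∀ {m} → 1 ℕ.≤ m → 0# < fromℕ m
  fromℕ-pos {suc m} _ = +-pos 0<1 (fromℕ-nonNeg m)

  fromℕ-+ : ∀ m n → fromℕ (m ℕ.+ n) ≈ fromℕ m + fromℕ n
  fromℕ-+ = ×-homo-+ 1#

  fromℕ-* : ∀ m n → fromℕ (m ℕ.* n) ≈ fromℕ m * fromℕ n
  fromℕ-* = ×1-homo-*

  fromℕ-mono : ∀ {m n} → m ℕ.≤ n → fromℕ m ≤ fromℕ n
  fromℕ-mono {n = n} ℕ.z≤n = fromℕ-nonNeg n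
  fromℕ-mono (ℕ.s≤s p) = +-monoʳ-≤ 1# (fromℕ-mono p)

  1≤fromℕ : ∀ {m} → 1 ℕ.≤ m → 1# ≤ fromℕ m
  1≤fromℕ p = ≤-trans (≤-reflexive 1≈) (fromℕ-mono p)

  -- Finite sums and distributions

  ∑ : ∀ {a} {A : Set a} → List A → (A → Carrier) → Carrier
  ∑ xs h = sum (map h xs)

  module _ {a} {A : Set a} where

    ∑-cong : ∀ (xs : List A) {g h} → (∀ x → g x ≈ h x) → ∑ xs g ≈ ∑ xs h
    ∑-cong [] p = ≈-refl
    ∑-cong (x ∷ xs) p = +-cong (p x) (∑-cong xs p)

    ∑-mono : ∀ (xs : List A) {g h} → (∀ x → g x ≤ h x) → ∑ xs g ≤ ∑ xs h
    ∑-mono [] p = ≤-refl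
    ∑-mono (x ∷ xs) p = +-mono-≤ (p x) (∑-mono xs p)

    ∑-nonNeg : ∀ (xs : List A) {g} → (∀ x → 0# ≤ g x) → 0# ≤ ∑ xs g
    ∑-nonNeg [] p = ≤-refl
    ∑-nonNeg (x ∷ xs) p = +-nonNeg (p x) (∑-nonNeg xs p)

    ∑-+ : ∀ (xs : List A) g h → ∑ xs (λ x → g x + h x) ≈ ∑ xs g + ∑ xs h
    ∑-+ [] g h = ≈-sym (F.+-identityʳ 0#)
    ∑-+ (x ∷ xs) g h = ≈-trans (+-congˡ (∑-+ xs g h))
      (solve 4 (λ a b u v → a :+ b :+ (u :+ v) := a :+ u :+ (b :+ v)) ≈-refl (g x) (h x) (∑ xs g) (∑ xs h))

    ∑-* : ∀ (xs : List A) z g → ∑ xs (λ x → z * g x) ≈ z * ∑ xs g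
    ∑-* [] z g = ≈-sym (F.zeroʳ z)
    ∑-* (x ∷ xs) z g = ≈-trans (+-congˡ (∑-* xs z g)) (≈-sym (F.distribˡ z _ _))

    ∑-*ʳ : ∀ (xs : List A) z g → ∑ xs (λ x → g x * z) ≈ ∑ xs g * z
    ∑-*ʳ xs z g = ≈-trans (∑-cong xs (λ x → F.*-comm _ _)) (≈-trans (∑-* xs z g) (F.*-comm _ _))

    ∑-- : ∀ (xs : List A) g h → ∑ xs (λ x → g x - h x) ≈ ∑ xs g - ∑ xs h
    ∑-- [] g h = ≈-sym (F.-‿inverseʳ 0#)
    ∑-- (x ∷ xs) g h = ≈-trans (+-congˡ (∑-- xs g h))
      (solve 4 (λ a b u v → a :- b :+ (u :- v) := a :+ u :- (b :+ v)) ≈-refl (g x) (h x) (∑ xs g) (∑ xs h))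

    ∑-0 : ∀ (xs : List A) → ∑ xs (λ _ → 0#) ≈ 0#
    ∑-0 [] = ≈-refl
    ∑-0 (x ∷ xs) = ≈-trans (F.+-identityˡ _) (∑-0 xs)

    ∑-zero : ∀ (xs : List A) {g} → (∀ x → g x ≈ 0#) → ∑ xs g ≈ 0#
    ∑-zero xs p = ≈-trans (∑-cong xs p) (∑-0 xs)

    ∑-++ : ∀ (xs ys : List A) g → ∑ (xs ++ ys) g ≈ ∑ xs g + ∑ ys g
    ∑-++ [] ys g = ≈-sym (F.+-identityˡ _)
    ∑-++ (x ∷ xs) ys g = ≈-trans (+-congˡ (∑-++ xs ys g)) (≈-sym (F.+-assoc _ _ _))

    ∑-length : ∀ (xs : List A) → fromℕ (length xs) ≈ ∑ xs (λ _ → 1#)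
    ∑-length [] = ≈-refl
    ∑-length (x ∷ xs) = +-congˡ (∑-length xs)

    ∈⇒≤∑ : ∀ {xs : List A} {x} g → (∀ y → 0# ≤ g y) → x List.∈ xs → g x ≤ ∑ xs g
    ∈⇒≤∑ {y ∷ xs} g p (here ≡.refl) = ≤-by (∑-nonNeg xs p)
      (solve 2 (λ a b → a :+ b :- a := b) ≈-refl (g y) (∑ xs g))
    ∈⇒≤∑ {y ∷ xs} {x} g p (there q) = ≤-trans (∈⇒≤∑ g p q) (≤-by (p y)
      (solve 2 (λ a b → a :+ b :- b := a) ≈-refl (g y) (∑ xs g)))

  ∑-swap : ∀ {a b} {A : Set a} {B : Set b} (xs : List A) (ys : List B) (g : A → B → Carrier) →
    ∑ xs (λ x → ∑ ys (g x)) ≈ ∑ ys (λ y → ∑ xs (λ x → g x y))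
  ∑-swap [] ys g = ≈-sym (∑-0 ys)
  ∑-swap (x ∷ xs) ys g = ≈-trans (+-congˡ (∑-swap xs ys g)) (≈-sym (∑-+ ys _ _))

  ∑-map : ∀ {a b} {A : Set a} {B : Set b} (φ : A → B) xs g → ∑ (map φ xs) g ≡ ∑ xs (g ∘ φ)
  ∑-map φ [] g = ≡.refl
  ∑-map φ (x ∷ xs) g = ≡.cong (g (φ x) +_) (∑-map φ xs g)

  ind : ∀ {p} {P : Set p} → Dec P → Carrier
  ind P? = if does P? then 1# else 0#

  module _ {p} {P : Set p} where

    ind-yes : (P? : Dec P) → P → ind P? ≈ 1#
    ind-yes (yes _) _ = ≈-refl
    ind-yes (no ¬p) p = contradiction p ¬p

    ind-no : (P? : Dec P) → ¬ P → ind P? ≈ 0#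
    ind-no (yes p) ¬p = contradiction p ¬p
    ind-no (no _) _ = ≈-refl

    ind-nonNeg : (P? : Dec P) → 0# ≤ ind P?
    ind-nonNeg (yes _) = 0≤1
    ind-nonNeg (no _) = ≤-refl

    ind≤1 : (P? : Dec P) → ind P? ≤ 1#
    ind≤1 (yes _) = ≤-refl
    ind≤1 (no _) = 0≤1

    ind-*-cong : (P? : Dec P) {x y : Carrier} → (P → x ≈ y) → ind P? * x ≈ ind P? * y
    ind-*-cong (yes p) e = *-congˡ (e p)
    ind-*-cong (no _) e = ≈-trans (F.zeroˡ _) (≈-sym (F.zeroˡ _))

    ind-*-mono : (P? : Dec P) {x y : Carrier} → (P → x ≤ y) → ind P? * x ≤ ind P? * y
    ind-*-mono (yes p) e = *-monoʳ-≤ 0≤1 (e p)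
    ind-*-mono (no _) e = ≤-reflexive (≈-trans (F.zeroˡ _) (≈-sym (F.zeroˡ _)))

    ind-*-nonNeg : (P? : Dec P) {x : Carrier} → (P → 0# ≤ x) → 0# ≤ ind P? * x
    ind-*-nonNeg P? e = ≤-trans (≤-reflexive (≈-sym (F.zeroʳ _))) (ind-*-mono P? e)

  module _ {p q} {P : Set p} {Q : Set q} where

    ind-cong : (P? : Dec P) (Q? : Dec Q) → (P → Q) → (Q → P) → ind P? ≈ ind Q?
    ind-cong (yes p) Q? f g = ≈-sym (ind-yes Q? (f p))
    ind-cong (no ¬p) Q? f g = ≈-sym (ind-no Q? (¬p ∘ g))

    ind-mono : (P? : Dec P) (Q? : Dec Q) → (P → Q) → ind P? ≤ ind Q?
    ind-mono (yes p) Q? f = ≤-reflexive (≈-sym (ind-yes Q? (f p)))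
    ind-mono (no ¬p) Q? f = ind-nonNeg Q?

    ind-× : (P? : Dec P) (Q? : Dec Q) → ind (P? ×-dec Q?) ≈ ind P? * ind Q?
    ind-× (yes p) (yes q) = ≈-sym (F.*-identityʳ 1#)
    ind-× (yes p) (no _) = ≈-sym (F.zeroʳ 1#)
    ind-× (no _) (yes q) = ≈-sym (F.zeroˡ 1#)
    ind-× (no _) (no _) = ≈-sym (F.zeroˡ 0#)

  module _ {a p} {A : Set a} {P : U.Pred A p} (P? : U.Decidable P) where

    ∑-filter : ∀ xs g → ∑ (filter P? xs) g ≈ ∑ xs (λ x → ind (P? x) * g x)
    ∑-filter [] g = ≈-refl
    ∑-filter (x ∷ xs) g with P? x
    ... | yes _ = +-cong (≈-sym (F.*-identityˡ _)) (∑-filter xs g)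
    ... | no  _ = ≈-trans (∑-filter xs g) (≈-sym (≈-trans (+-congʳ (F.zeroˡ _)) (F.+-identityˡ _)))

    length-filter : ∀ xs → fromℕ (length (filter P? xs)) ≈ ∑ xs (λ x → ind (P? x))
    length-filter xs = ≈-trans (∑-length (filter P? xs))
      (≈-trans (∑-filter xs _) (∑-cong xs (λ x → F.*-identityʳ _)))

  record IsDist {a} {A : Set a} (d : Dist A) : Set (c Level.⊔ a Level.⊔ ℓ₁ Level.⊔ ℓ₂) where
    field
      weights-nonNeg : All (λ (w , _) → 0# ≤ w) d
      total          : 𝔼 d (λ _ → 1#) ≈ 1#

  open IsDist

  module _ {a} {A : Set a} where

    𝔼-cong : ∀ (d : Dist A) {g h} → (∀ x → g x ≈ h x) → 𝔼 d g ≈ 𝔼 d h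
    𝔼-cong d p = ∑-cong d (λ (w , x) → *-congˡ (p x))

    𝔼-mono : ∀ {d : Dist A} {g h} → All (λ (w , _) → 0# ≤ w) d → (∀ x → g x ≤ h x) → 𝔼 d g ≤ 𝔼 d h
    𝔼-mono [] p = ≤-refl
    𝔼-mono (0≤w ∷ ws) p = +-mono-≤ (*-monoʳ-≤ 0≤w (p _)) (𝔼-mono ws p)

    𝔼-* : ∀ (d : Dist A) z g → 𝔼 d (λ x → z * g x) ≈ z * 𝔼 d g
    𝔼-* d z g = ≈-trans
      (∑-cong d (λ (w , x) → solve 3 (λ w z g → w :* (z :* g) := z :* (w :* g)) ≈-refl w z (g x)))
      (∑-* d z _)

    𝔼-+ : ∀ (d : Dist A) g h → 𝔼 d (λ x → g x + h x) ≈ 𝔼 d g + 𝔼 d h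
    𝔼-+ d g h = ≈-trans (∑-cong d (λ (w , x) → F.distribˡ w _ _)) (∑-+ d _ _)

    𝔼-0 : ∀ (d : Dist A) → 𝔼 d (λ _ → 0#) ≈ 0#
    𝔼-0 d = ∑-zero d (λ _ → F.zeroʳ _)

    𝔼-nonNeg : ∀ {d : Dist A} {g} → All (λ (w , _) → 0# ≤ w) d → (∀ x → 0# ≤ g x) → 0# ≤ 𝔼 d g
    𝔼-nonNeg {d} ws p = ≤-trans (≤-reflexive (≈-sym (𝔼-0 d))) (𝔼-mono ws p)

    𝔼-const : ∀ {d : Dist A} → IsDist d → ∀ z → 𝔼 d (λ _ → z) ≈ z
    𝔼-const {d} dist z = begin-equality
      𝔼 d (λ _ → z)         ≈⟨ 𝔼-cong d (λ _ → ≈-sym (F.*-identityʳ z)) ⟩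
      𝔼 d (λ _ → z * 1#)    ≈⟨ 𝔼-* d z _ ⟩
      z * 𝔼 d (λ _ → 1#)    ≈⟨ *-congˡ (total dist) ⟩
      z * 1#  ≈⟨ F.*-identityʳ z ⟩
      z ∎

    𝔼-return : ∀ (x : A) g → 𝔼 (return x) g ≈ g x
    𝔼-return x g = ≈-trans (F.+-identityʳ _) (F.*-identityˡ _)

    return-isDist : ∀ (x : A) → IsDist (return x)
    return-isDist x = record { weights-nonNeg = 0≤1 ∷ [] ; total = 𝔼-return x _ }

    𝔼-uniform : ∀ (xs : List A) g → 𝔼 (uniform xs) g ≈ fromℕ (length xs) ⁻¹ * ∑ xs g
    𝔼-uniform xs g = ≈-trans (≈-reflexive (∑-map _ xs _)) (∑-* xs _ g)

    *-𝔼-uniform : ∀ (xs : List A) g → 0# < fromℕ (length xs) → fromℕ (length xs) * 𝔼 (uniform xs) g ≈ ∑ xs g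
    *-𝔼-uniform xs g p = begin-equality
      l * 𝔼 (uniform xs) g      ≈⟨ *-congˡ (≈-trans (𝔼-uniform xs g) (F.*-comm _ _)) ⟩
      l * (∑ xs g * l ⁻¹)       ≈⟨ /-cancel _ p ⟩
      ∑ xs g ∎
      where l = fromℕ (length xs)

    uniform-nonNeg : ∀ (xs : List A) → All (λ (w , _) → 0# ≤ w) (uniform xs)
    uniform-nonNeg [] = []
    uniform-nonNeg (x ∷ xs) = All.map⁺ (All.universal (λ _ → ⁻¹-nonNeg (fromℕ-pos {suc (length xs)} (ℕ.s≤s ℕ.z≤n))) (x ∷ xs))

    uniform-isDist : ∀ (xs : List A) → 0# < fromℕ (length xs) → IsDist (uniform xs)
    uniform-isDist xs p = record
      { weights-nonNeg = uniform-nonNeg xs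
      ; total = *-cancelˡ-≈ p (≈-trans (*-𝔼-uniform xs _ p)
          (≈-trans (≈-sym (∑-length xs)) (≈-sym (F.*-identityʳ _)))) }

  module _ {a b} {A : Set a} {B : Set b} where

    𝔼-map : ∀ (d : Dist B) w g → 𝔼 (map (λ (v , y) → w * v , y) d) g ≈ w * 𝔼 d g
    𝔼-map d w g = ≈-trans (≈-reflexive (∑-map _ d _))
      (≈-trans (∑-cong d (λ _ → F.*-assoc _ _ _)) (∑-* d w _))

    𝔼->>= : ∀ (d : Dist A) (k : A → Dist B) g → 𝔼 (d >>= k) g ≈ 𝔼 d (λ x → 𝔼 (k x) g)
    𝔼->>= [] k g = ≈-refl
    𝔼->>= ((w , x) ∷ d) k g = ≈-trans (∑-++ (map _ (k x)) _ _) (+-cong (𝔼-map (k x) w g) (𝔼->>= d k g))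

    >>=-nonNeg : ∀ {d : Dist A} {k : A → Dist B} → All (λ (w , _) → 0# ≤ w) d →
      (∀ x → All (λ (w , _) → 0# ≤ w) (k x)) → All (λ (w , _) → 0# ≤ w) (d >>= k)
    >>=-nonNeg [] q = []
    >>=-nonNeg (0≤w ∷ p) q = All.++⁺ (All.map⁺ (All.map (*-nonNeg 0≤w) (q _))) (>>=-nonNeg p q)

    >>=-isDist : ∀ {d : Dist A} {k : A → Dist B} → IsDist d → (∀ x → IsDist (k x)) → IsDist (d >>= k)
    >>=-isDist {d} {k} p q = record
      { weights-nonNeg = >>=-nonNeg (weights-nonNeg p) (λ x → weights-nonNeg (q x))
      ; total = ≈-trans (𝔼->>= d k _) (≈-trans (𝔼-cong d (λ x → total (q x))) (total p)) }

    Surely->>= : ∀ {p q} {d : Dist A} {k : A → Dist B} {P : U.Pred A p} {Q : U.Pred B q} →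
      Surely d P → (∀ x → P x → Surely (k x) Q) → Surely (d >>= k) Q
    Surely->>= [] q = []
    Surely->>= (px ∷ p) q = All.++⁺ (All.map⁺ (q _ px)) (Surely->>= p q)

  iid-isDist : ∀ {a} {A : Set a} {d : Dist A} → IsDist d → ∀ m → IsDist (iid m d)
  iid-isDist p zero = return-isDist []
  iid-isDist p (suc m) = >>=-isDist p (λ x → >>=-isDist (iid-isDist p m) (λ xs → return-isDist (x ∷ xs)))

  module _ {a} {A : Set a} {d : Dist A} (dist : IsDist d) (g : A → Carrier) where

    -- Stated for an arbitrary centre so that the induction goes through: the
    -- first sample only shifts the centre.
    second-moment : ∀ {b} → (∀ x → g x * g x ≤ b) → ∀ m z →
      𝔼 (iid m d) (λ xs → (∑ xs g - z) * (∑ xs g - z)) ≤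
      fromℕ m * b + (fromℕ m * 𝔼 d g - z) * (fromℕ m * 𝔼 d g - z)
    second-moment {b} bound zero z = ≤-reflexive (≈-trans (𝔼-return [] (λ xs → (∑ xs g - z) * (∑ xs g - z)))
      (solve 3 (λ b u z → (:0 :- z) :* (:0 :- z) := :0 :* b :+ (:0 :* u :- z) :* (:0 :* u :- z))
        ≈-refl b (𝔼 d g) z))
    second-moment {b} bound (suc m) z = begin
      𝔼 (iid (suc m) d) (λ xs → sq (∑ xs g - z))
        ≈⟨ 𝔼->>= d _ _ ⟩
      𝔼 d (λ x → 𝔼 (iid m d >>= λ xs → return (x ∷ xs)) (λ xs → sq (∑ xs g - z)))
        ≈⟨ 𝔼-cong d (λ x → ≈-trans (𝔼->>= (iid m d) (λ xs → return (x ∷ xs)) _) (𝔼-cong (iid m d) (λ xs →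
             ≈-trans (𝔼-return (x ∷ xs) (λ xs → sq (∑ xs g - z)))
             (solve 3 (λ g s z → (g :+ s :- z) :* (g :+ s :- z) := (s :- (z :- g)) :* (s :- (z :- g)))
               ≈-refl (g x) (∑ xs g) z)))) ⟩
      𝔼 d (λ x → 𝔼 (iid m d) (λ xs → sq (∑ xs g - (z - g x))))
        ≤⟨ 𝔼-mono (weights-nonNeg dist) (λ x → second-moment bound m (z - g x)) ⟩
      𝔼 d (λ x → M * b + sq (M * u - (z - g x)))
        -- Only the term g(x)² is estimated, by b; the rest is affine in g(x) and has an exact
        -- expectation. Completing the square for the mean (1 + M) u then leaves the slack u².
        ≤⟨ 𝔼-mono (weights-nonNeg dist) (λ x → ≤-by (≤⇒0≤ (bound x))
             (solve 5 (λ M b u z g →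
               ((M :* b :+ (M :* u :- z) :* (M :* u :- z) :+ b) :+ (:2 :* (M :* u :- z)) :* g)
               :- (M :* b :+ (M :* u :- (z :- g)) :* (M :* u :- (z :- g))) := b :- g :* g)
             ≈-refl M b u z (g x))) ⟩
      𝔼 d (λ x → (M * b + sq (M * u - z) + b) + (fromℕ 2 * (M * u - z)) * g x)
        ≈⟨ ≈-trans (𝔼-+ d _ _) (+-cong (𝔼-const dist _) (𝔼-* d _ g)) ⟩
      (M * b + sq (M * u - z) + b) + (fromℕ 2 * (M * u - z)) * u
        ≤⟨ ≤-by (square-nonNeg u)
             (solve 4 (λ M b u z →
               ((:1 :+ M) :* b :+ ((:1 :+ M) :* u :- z) :* ((:1 :+ M) :* u :- z))
               :- ((M :* b :+ (M :* u :- z) :* (M :* u :- z) :+ b) :+ (:2 :* (M :* u :- z)) :* u) := u :* u)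
             ≈-refl M b u z) ⟩
      fromℕ (suc m) * b + sq (fromℕ (suc m) * u - z) ∎
      where
      M = fromℕ m
      u = 𝔼 d g
      sq : Carrier → Carrier
      sq x = x * x

    -- A sum that is at most 0 lies at least m μ below its mean m 𝔼 g. So m² μ² times the
    -- probability is at most the second moment about the mean, which is at most m b.
    chebyshev : ∀ {b μ} → (∀ x → g x * g x ≤ b) → 0# ≤ μ → μ ≤ 𝔼 d g → ∀ m → 1 ℕ.≤ m →
      fromℕ m * (μ * μ) * ℙ (iid m d) (λ xs → ∑ xs g ≤? 0#) ≤ b
    chebyshev {b} {μ} bound 0≤μ μ≤u m 1≤m = *-cancelˡ-≤ (fromℕ-pos 1≤m) (begin
      M * (M * (μ * μ) * ℙ (iid m d) (λ xs → ∑ xs g ≤? 0#))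
        ≈⟨ solve 3 (λ M u p → M :* (M :* (u :* u) :* p) := (M :* u) :* (M :* u) :* p) ≈-refl M μ _ ⟩
      (M * μ) * (M * μ) * ℙ (iid m d) (λ xs → ∑ xs g ≤? 0#)
        ≈⟨ 𝔼-* (iid m d) _ _ ⟨
      𝔼 (iid m d) (λ xs → (M * μ) * (M * μ) * ind (∑ xs g ≤? 0#))
        ≤⟨ 𝔼-mono (weights-nonNeg (iid-isDist dist m)) pointwise ⟩
      𝔼 (iid m d) (λ xs → (∑ xs g - M * u) * (∑ xs g - M * u))
        ≤⟨ second-moment bound m (M * u) ⟩
      M * b + (M * u - M * u) * (M * u - M * u)
        ≈⟨ solve 2 (λ a t → a :+ (t :- t) :* (t :- t) := a) ≈-refl (M * b) (M * u) ⟩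
      M * b ∎)
      where
      M = fromℕ m
      u = 𝔼 d g
      pointwise : ∀ xs → (M * μ) * (M * μ) * ind (∑ xs g ≤? 0#) ≤ (∑ xs g - M * u) * (∑ xs g - M * u)
      pointwise xs with ∑ xs g ≤? 0#
      ... | no _ = ≤-trans (≤-reflexive (F.zeroʳ _)) (square-nonNeg _)
      ... | yes T≤0 = begin
        (M * μ) * (M * μ) * 1#   ≈⟨ F.*-identityʳ _ ⟩
        (M * μ) * (M * μ)        ≤⟨ *-mono-≤ 0≤Mμ (≤-trans 0≤Mμ Mμ≤) Mμ≤ Mμ≤ ⟩
        (M * u - T) * (M * u - T)
          ≈⟨ solve 2 (λ a b → (a :- b) :* (a :- b) := (b :- a) :* (b :- a)) ≈-refl (M * u) T ⟩
        (T - M * u) * (T - M * u) ∎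
        where
        T = ∑ xs g
        0≤Mμ = *-nonNeg (fromℕ-nonNeg m) 0≤μ
        Mμ≤ : M * μ ≤ M * u - T
        Mμ≤ = ≤-by (+-nonNeg (≤⇒0≤ (*-monoʳ-≤ (fromℕ-nonNeg m) μ≤u)) (≤⇒0≤ T≤0))
          (solve 3 (λ a b t → (b :- t) :- a := (b :- a) :+ (:0 :- t)) ≈-refl (M * μ) (M * u) T)

  module _ {a i p} {A : Set a} {I : Set i} {d : Dist A} (dist : IsDist d) (T : I → A → Carrier)
           {P : U.Pred A p} (P? : U.Decidable P) where

    all-pos⊎failure : ∀ is x → (∀ {i} → i List.∈ is → 0# < T i x) ⊎ 1# ≤ ∑ is (λ i → ind (T i x ≤? 0#))
    all-pos⊎failure [] x = inj₁ λ ()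
    all-pos⊎failure (i ∷ is) x with T i x ≤? 0# | all-pos⊎failure is x
    ... | yes _ | _ = inj₂ (≤-by (∑-nonNeg is (λ i → ind-nonNeg (T i x ≤? 0#)))
          (solve 2 (λ a b → a :+ b :- a := b) ≈-refl 1# _))
    ... | no _ | inj₂ q = inj₂ (≤-trans q (≤-reflexive (≈-sym (F.+-identityˡ _))))
    ... | no r | inj₁ q = inj₁ λ { (here ≡.refl) → ≰⇒> r ; (there s) → q s }

    -- Pointwise, 1 minus the number of failed tests is at most the indicator of P: it is at most 0
    -- as soon as one test fails, and otherwise P holds. The bound is the expectation of this
    -- inequality.
    union-bound : ∀ is {β} → (∀ i → i List.∈ is → ℙ d (λ x → T i x ≤? 0#) ≤ β) →
      (∀ x → (∀ {i} → i List.∈ is → 0# < T i x) → P x) →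
      1# - fromℕ (length is) * β ≤ ℙ d P?
    union-bound is {β} small good = begin
      1# - fromℕ (length is) * β
        ≤⟨ +-monoʳ-≤ 1# (neg-mono (failures is small)) ⟩
      1# - 𝔼 d (λ x → ∑ is (λ i → ind (T i x ≤? 0#)))
        ≈⟨ +-cong (≈-sym (total dist)) (≈-trans (≈-sym (solve 1 (λ x → (:- :1) :* x := :- x) ≈-refl _)) (≈-sym (𝔼-* d (- 1#) _))) ⟩
      𝔼 d (λ _ → 1#) + 𝔼 d (λ x → - 1# * ∑ is (λ i → ind (T i x ≤? 0#)))
        ≈⟨ 𝔼-+ d _ _ ⟨
      𝔼 d (λ x → 1# + - 1# * ∑ is (λ i → ind (T i x ≤? 0#)))
        ≤⟨ 𝔼-mono (weights-nonNeg dist) pointwise ⟩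
      ℙ d P? ∎
      where
      failures : ∀ is → (∀ i → i List.∈ is → ℙ d (λ x → T i x ≤? 0#) ≤ β) →
        𝔼 d (λ x → ∑ is (λ i → ind (T i x ≤? 0#))) ≤ fromℕ (length is) * β
      failures [] _ = ≤-reflexive (≈-trans (𝔼-0 d) (≈-sym (F.zeroˡ _)))
      failures (i ∷ is) small = ≤-trans (≤-reflexive (𝔼-+ d _ _))
        (≤-trans (+-mono-≤ (small i (here ≡.refl)) (failures is (λ i → small i ∘ there)))
          (≤-reflexive (solve 2 (λ l b → b :+ l :* b := (:1 :+ l) :* b) ≈-refl (fromℕ (length is)) β)))
      pointwise : ∀ x → 1# + - 1# * ∑ is (λ i → ind (T i x ≤? 0#)) ≤ ind (P? x)
      pointwise x with P? x | all-pos⊎failure is x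
      ... | yes _ | _ = ≤-by (∑-nonNeg is (λ i → ind-nonNeg (T i x ≤? 0#)))
            (solve 1 (λ s → :1 :- (:1 :+ (:- :1) :* s) := s) ≈-refl _)
      ... | no _ | inj₂ q = ≤-by (≤⇒0≤ q) (solve 1 (λ s → :0 :- (:1 :+ (:- :1) :* s) := s :- :1) ≈-refl _)
      ... | no ¬p | inj₁ q = contradiction (good x q) ¬p

  -- Sums over subsets, and submodular functions

  ∈-subsets : ∀ (S : Subset n) → S List.∈ subsets n
  ∈-subsets [] = here ≡.refl
  ∈-subsets (false ∷ S) = List.∈-++⁺ˡ (List.∈-map⁺ (outside ∷_) (∈-subsets S))
  ∈-subsets {suc n} (true ∷ S) = List.∈-++⁺ʳ (map (outside ∷_) (subsets n)) (List.∈-map⁺ (inside ∷_) (∈-subsets S))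

  ∑ₛ : (Subset n → Carrier) → Carrier
  ∑ₛ {n} = ∑ (subsets n)

  ∑ₑ : (Fin n → Carrier) → Carrier
  ∑ₑ {n} = ∑ (allFin n)

  ∑ₛ-suc : ∀ (g : Subset (suc n) → Carrier) → ∑ₛ g ≈ ∑ₛ (g ∘ (outside ∷_)) + ∑ₛ (g ∘ (inside ∷_))
  ∑ₛ-suc {n} g = ≈-trans (∑-++ (map (outside ∷_) (subsets n)) _ g)
    (+-cong (≈-reflexive (∑-map _ (subsets n) g)) (≈-reflexive (∑-map _ (subsets n) g)))

  ∑ₑ-suc : ∀ (h : Fin (suc n) → Carrier) → ∑ₑ h ≡ h zero + ∑ₑ (h ∘ suc)
  ∑ₑ-suc {n} h = ≡.cong (h zero +_) (≡.trans (≡.cong (λ l → ∑ l h) (≡.sym (List.map-tabulate id suc)))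
    (∑-map suc (allFin n) h))

  -- Adding e is a bijection from the sets without e onto the sets with e.
  ∑ₛ-add : ∀ e (g : Subset n → Carrier) →
    ∑ₛ (λ S → ind (e ∈? S) * g S) ≈ ∑ₛ (λ S → ind (¬? (e ∈? S)) * g (S ∪ ⁅ e ⁆))
  ∑ₛ-add {suc n} zero g = begin-equality
    ∑ₛ (λ S → ind (zero ∈? S) * g S)
      ≈⟨ ∑ₛ-suc (λ S → ind (zero ∈? S) * g S) ⟩
    ∑ₛ (λ S → 0# * g (outside ∷ S)) + ∑ₛ (λ S → 1# * g (inside ∷ S))
      ≈⟨ +-cong (∑-zero (subsets n) (λ _ → F.zeroˡ _))
           (∑-cong (subsets n) (λ S → *-congˡ (≈-reflexive (≡.cong (g ∘ (inside ∷_)) (≡.sym (∪-identityʳ S)))))) ⟩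
    0# + ∑ₛ (λ S → 1# * g (inside ∷ (S ∪ ⊥)))
      ≈⟨ ≈-trans (F.+-comm _ _) (+-congˡ (≈-sym (∑-zero (subsets n) (λ _ → F.zeroˡ _)))) ⟩
    ∑ₛ (λ S → 1# * g (inside ∷ (S ∪ ⊥))) + ∑ₛ (λ S → 0# * g (inside ∷ (S ∪ ⊥)))
      ≈⟨ ∑ₛ-suc (λ S → ind (¬? (zero ∈? S)) * g (S ∪ ⁅ zero ⁆)) ⟨
    ∑ₛ (λ S → ind (¬? (zero ∈? S)) * g (S ∪ ⁅ zero ⁆)) ∎
  ∑ₛ-add {suc n} (suc e) g = begin-equality
    ∑ₛ (λ S → ind (suc e ∈? S) * g S)
      ≈⟨ ∑ₛ-suc (λ S → ind (suc e ∈? S) * g S) ⟩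
    ∑ₛ (λ S → ind (e ∈? S) * g (outside ∷ S)) + ∑ₛ (λ S → ind (e ∈? S) * g (inside ∷ S))
      ≈⟨ +-cong (∑ₛ-add e (g ∘ (outside ∷_))) (∑ₛ-add e (g ∘ (inside ∷_))) ⟩
    ∑ₛ (λ S → ind (¬? (e ∈? S)) * g (outside ∷ (S ∪ ⁅ e ⁆))) + ∑ₛ (λ S → ind (¬? (e ∈? S)) * g (inside ∷ (S ∪ ⁅ e ⁆)))
      ≈⟨ ∑ₛ-suc (λ S → ind (¬? (suc e ∈? S)) * g (S ∪ ⁅ suc e ⁆)) ⟨
    ∑ₛ (λ S → ind (¬? (suc e ∈? S)) * g (S ∪ ⁅ suc e ⁆)) ∎

  -- The sets avoiding e are the subsets of a ground set with one element less; this makes the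
  -- number of those of a given size independent of e.
  ∑ₛ-avoiding : ∀ e (g : Subset (suc n) → Carrier) →
    ∑ₛ (λ S → ind (¬? (e ∈? S)) * g S) ≈ ∑ₛ (λ S → g (insertAt S e outside))
  ∑ₛ-avoiding {n} zero g = begin-equality
    ∑ₛ (λ S → ind (¬? (zero ∈? S)) * g S)
      ≈⟨ ∑ₛ-suc (λ S → ind (¬? (zero ∈? S)) * g S) ⟩
    ∑ₛ (λ S → 1# * g (outside ∷ S)) + ∑ₛ (λ S → 0# * g (inside ∷ S))
      ≈⟨ +-cong (∑-cong (subsets n) (λ S → F.*-identityˡ _)) (∑-zero (subsets n) (λ S → F.zeroˡ _)) ⟩
    ∑ₛ (λ S → g (outside ∷ S)) + 0#
      ≈⟨ F.+-identityʳ _ ⟩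
    ∑ₛ (λ S → g (outside ∷ S)) ∎
  ∑ₛ-avoiding {suc n} (suc e) g = begin-equality
    ∑ₛ (λ S → ind (¬? (suc e ∈? S)) * g S)
      ≈⟨ ∑ₛ-suc (λ S → ind (¬? (suc e ∈? S)) * g S) ⟩
    ∑ₛ (λ S → ind (¬? (e ∈? S)) * g (outside ∷ S)) + ∑ₛ (λ S → ind (¬? (e ∈? S)) * g (inside ∷ S))
      ≈⟨ +-cong (∑ₛ-avoiding e (g ∘ (outside ∷_))) (∑ₛ-avoiding e (g ∘ (inside ∷_))) ⟩
    ∑ₛ (λ S → g (outside ∷ insertAt S e outside)) + ∑ₛ (λ S → g (inside ∷ insertAt S e outside))
      ≈⟨ ∑ₛ-suc (λ S → g (insertAt S (suc e) outside)) ⟨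
    ∑ₛ (λ S → g (insertAt S (suc e) outside)) ∎

  -- Each set is in a unique way the union of a part outside B and a part inside B. Conditioning on
  -- the outside part is what makes R ∩ B a uniformly random subset of B of a given size.
  ∑ₛ-split : ∀ (B : Subset n) (g : Subset n → Carrier) →
    ∑ₛ g ≈ ∑ₛ (λ X → ind (X ⊆? ∁ B) * ∑ₛ (λ Z → ind (Z ⊆? B) * g (X ∪ Z)))
  ∑ₛ-split [] g = solve 1 (λ x → x :+ :0 := :1 :* (:1 :* x :+ :0) :+ :0) ≈-refl (g [])
  ∑ₛ-split {suc n} (true ∷ B) g = begin-equality
    ∑ₛ g
      ≈⟨ ∑ₛ-suc g ⟩
    ∑ₛ (g ∘ (outside ∷_)) + ∑ₛ (g ∘ (inside ∷_))
      ≈⟨ +-cong (∑ₛ-split B _) (∑ₛ-split B _) ⟩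
    ∑ₛ (λ X → ind (X ⊆? ∁ B) * inner X outside) + ∑ₛ (λ X → ind (X ⊆? ∁ B) * inner X inside)
      ≈⟨ ∑-+ (subsets n) _ _ ⟨
    ∑ₛ (λ X → ind (X ⊆? ∁ B) * inner X outside + ind (X ⊆? ∁ B) * inner X inside)
      ≈⟨ ∑-cong (subsets n) (λ X → ≈-trans (≈-sym (F.distribˡ _ _ _)) (*-congˡ (≈-sym (∑ₛ-suc (λ Z → ind (Z ⊆? (true ∷ B)) * g ((outside ∷ X) ∪ Z)))))) ⟩
    ∑ₛ (λ X → ind (X ⊆? ∁ B) * ∑ₛ (λ Z → ind (Z ⊆? (true ∷ B)) * g ((outside ∷ X) ∪ Z)))
      ≈⟨ ≈-trans (+-congˡ (∑-zero (subsets n) (λ X → F.zeroˡ _))) (F.+-identityʳ _) ⟨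
    ∑ₛ (λ X → ind (X ⊆? ∁ B) * ∑ₛ (λ Z → ind (Z ⊆? (true ∷ B)) * g ((outside ∷ X) ∪ Z)))
      + ∑ₛ (λ X → 0# * ∑ₛ (λ Z → ind (Z ⊆? (true ∷ B)) * g ((inside ∷ X) ∪ Z)))
      ≈⟨ ∑ₛ-suc (λ X → ind (X ⊆? ∁ (true ∷ B)) * ∑ₛ (λ Z → ind (Z ⊆? (true ∷ B)) * g (X ∪ Z))) ⟨
    ∑ₛ (λ X → ind (X ⊆? ∁ (true ∷ B)) * ∑ₛ (λ Z → ind (Z ⊆? (true ∷ B)) * g (X ∪ Z))) ∎
    where
    inner : Subset n → Bool → Carrier
    inner X b = ∑ₛ (λ Z → ind (Z ⊆? B) * g (b ∷ (X ∪ Z)))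
  ∑ₛ-split {suc n} (false ∷ B) g = begin-equality
    ∑ₛ g
      ≈⟨ ∑ₛ-suc g ⟩
    ∑ₛ (g ∘ (outside ∷_)) + ∑ₛ (g ∘ (inside ∷_))
      ≈⟨ +-cong (≈-trans (∑ₛ-split B _) (∑-cong (subsets n) (λ X → *-congˡ (extend outside X))))
                (≈-trans (∑ₛ-split B _) (∑-cong (subsets n) (λ X → *-congˡ (extend inside X)))) ⟩
    ∑ₛ (λ X → ind (X ⊆? ∁ B) * ∑ₛ (λ Z → ind (Z ⊆? (false ∷ B)) * g ((outside ∷ X) ∪ Z)))
      + ∑ₛ (λ X → ind (X ⊆? ∁ B) * ∑ₛ (λ Z → ind (Z ⊆? (false ∷ B)) * g ((inside ∷ X) ∪ Z)))
      ≈⟨ ∑ₛ-suc (λ X → ind (X ⊆? ∁ (false ∷ B)) * ∑ₛ (λ Z → ind (Z ⊆? (false ∷ B)) * g (X ∪ Z))) ⟨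
    ∑ₛ (λ X → ind (X ⊆? ∁ (false ∷ B)) * ∑ₛ (λ Z → ind (Z ⊆? (false ∷ B)) * g (X ∪ Z))) ∎
    where
    ∨-false : ∀ b → b ∨ false ≡ b
    ∨-false false = ≡.refl
    ∨-false true = ≡.refl
    extend : ∀ b X → ∑ₛ (λ Z → ind (Z ⊆? B) * g (b ∷ (X ∪ Z))) ≈ ∑ₛ (λ Z → ind (Z ⊆? (false ∷ B)) * g ((b ∷ X) ∪ Z))
    extend b X = ≈-sym (begin-equality
      ∑ₛ (λ Z → ind (Z ⊆? (false ∷ B)) * g ((b ∷ X) ∪ Z))
        ≈⟨ ∑ₛ-suc (λ Z → ind (Z ⊆? (false ∷ B)) * g ((b ∷ X) ∪ Z)) ⟩
      ∑ₛ (λ Z → ind (Z ⊆? B) * g ((b ∨ false) ∷ (X ∪ Z))) + ∑ₛ (λ Z → 0# * g ((b ∷ X) ∪ (inside ∷ Z)))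
        ≈⟨ +-cong (∑-cong (subsets n) (λ Z → *-congˡ (≈-reflexive (≡.cong (λ b → g (b ∷ (X ∪ Z))) (∨-false b)))))
             (∑-zero (subsets n) (λ Z → F.zeroˡ _)) ⟩
      ∑ₛ (λ Z → ind (Z ⊆? B) * g (b ∷ (X ∪ Z))) + 0#
        ≈⟨ F.+-identityʳ _ ⟩
      ∑ₛ (λ Z → ind (Z ⊆? B) * g (b ∷ (X ∪ Z))) ∎)

  over : Subset n → (Fin n → Carrier) → Carrier
  over Z h = ∑ₑ (λ e → ind (e ∈? Z) * h e)

  over-⊥ : ∀ (h : Fin n → Carrier) → over ⊥ h ≈ 0#
  over-⊥ {n} h = ∑-zero (allFin n) (λ e → ≈-trans (*-congʳ (ind-no (e ∈? ⊥) ∉⊥)) (F.zeroˡ _))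

  over-∪ : ∀ (Z : Subset n) e → e ∉ Z → ∀ h → over (Z ∪ ⁅ e ⁆) h ≈ over Z h + h e
  over-∪ (true ∷ Z) zero e∉Z h = contradiction here e∉Z
  over-∪ {suc n} (false ∷ Z) zero e∉Z h = begin-equality
    over ((false ∷ Z) ∪ ⁅ zero ⁆) h     ≡⟨ ∑ₑ-suc (λ x → ind (x ∈? ((false ∷ Z) ∪ ⁅ zero ⁆)) * h x) ⟩
    1# * h zero + over (Z ∪ ⊥) (h ∘ suc)  ≡⟨ ≡.cong (λ Y → 1# * h zero + over Y (h ∘ suc)) (∪-identityʳ Z) ⟩
    1# * h zero + over Z (h ∘ suc)
      ≈⟨ solve 2 (λ a b → :1 :* a :+ b := :0 :* a :+ b :+ a) ≈-refl (h zero) _ ⟩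
    0# * h zero + over Z (h ∘ suc) + h zero   ≡⟨ ≡.cong (_+ h zero) (∑ₑ-suc (λ e → ind (e ∈? (false ∷ Z)) * h e)) ⟨
    over (false ∷ Z) h + h zero ∎
  over-∪ {suc n} (b ∷ Z) (suc e) e∉Z h = begin-equality
    over ((b ∷ Z) ∪ ⁅ suc e ⁆) h     ≡⟨ ∑ₑ-suc (λ x → ind (x ∈? ((b ∷ Z) ∪ ⁅ suc e ⁆)) * h x) ⟩
    ind (zero ∈? ((b ∨ false) ∷ (Z ∪ ⁅ e ⁆))) * h zero + over (Z ∪ ⁅ e ⁆) (h ∘ suc)
      ≈⟨ +-cong (*-congʳ (head b)) (over-∪ Z e (e∉Z ∘ there) (h ∘ suc)) ⟩
    ind (zero ∈? (b ∷ Z)) * h zero + (over Z (h ∘ suc) + h (suc e))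
      ≈⟨ F.+-assoc _ _ _ ⟨
    ind (zero ∈? (b ∷ Z)) * h zero + over Z (h ∘ suc) + h (suc e)
      ≡⟨ ≡.cong (_+ h (suc e)) (∑ₑ-suc (λ e → ind (e ∈? (b ∷ Z)) * h e)) ⟨
    over (b ∷ Z) h + h (suc e) ∎
    where
    head : ∀ b → ind (zero ∈? ((b ∨ false) ∷ (Z ∪ ⁅ e ⁆))) ≈ ind (zero ∈? (b ∷ Z))
    head false = ≈-refl
    head true = ≈-refl

  over-mono : ∀ (Z : Subset n) {g h} → (∀ {e} → e ∈ Z → g e ≤ h e) → over Z g ≤ over Z h
  over-mono {n} Z p = ∑-mono (allFin n) (λ e → ind-*-mono (e ∈? Z) p)

  over-const : ∀ (Z : Subset n) z → over Z (λ _ → z) ≈ fromℕ ∣ Z ∣ * z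
  over-const {n} = subset-induction _
    (λ z → ≈-trans (over-⊥ {n} (λ _ → z)) (≈-trans (≈-sym (F.zeroˡ z)) (*-congʳ (≈-reflexive (≡.cong fromℕ (≡.sym (∣⊥∣≡0 n)))))))
    (λ Z e e∉Z ih z → begin-equality
      over (Z ∪ ⁅ e ⁆) (λ _ → z)   ≈⟨ over-∪ Z e e∉Z _ ⟩
      over Z (λ _ → z) + z         ≈⟨ +-congʳ (ih z) ⟩
      fromℕ ∣ Z ∣ * z + z          ≈⟨ solve 2 (λ m z → m :* z :+ z := (:1 :+ m) :* z) ≈-refl (fromℕ ∣ Z ∣) z ⟩
      fromℕ (suc ∣ Z ∣) * z        ≡⟨ ≡.cong (λ m → fromℕ m * z) (∣S∪⁅e⁆∣ e∉Z) ⟨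
      fromℕ ∣ Z ∪ ⁅ e ⁆ ∣ * z ∎)

  module Submod {n} {f : SetFunction n} (nonNeg : NonNegative f) (mono : Monotone f) (submod : Submodular f) where

    ≤-marginal : ∀ S e → f (S ∪ ⁅ e ⁆) ≈ f S + marginal f S e
    ≤-marginal S e = solve 2 (λ x y → x := y :+ (x :- y)) ≈-refl _ _

    mono-⊆ : ∀ {S T} → S ⊆ T → f S ≤ f T
    mono-⊆ {S} {T} S⊆T = ≤-trans (subset-induction (λ X → f S ≤ f (S ∪ X))
      (≤-reflexive (≈-reflexive (≡.cong f (≡.sym (∪-identityʳ S)))))
      (λ X e _ ih → ≤-trans ih (≤-trans (0≤⇒≤ (mono (S ∪ X) e)) (≤-reflexive (≈-reflexive (≡.cong f (∪-assoc S X ⁅ e ⁆))))))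
      T) (≤-reflexive (≈-reflexive (≡.cong f (⊆-antisym (∪-⊆ S⊆T id) (q⊆p∪q S T)))))

    -- The elements of X are added one by one, and each gains at most its marginal with respect to R
    -- alone.
    gain-≤-over : ∀ R X → f (R ∪ X) - f R ≤ over X (marginal f R)
    gain-≤-over R = subset-induction _
      (≤-reflexive (≈-trans (+-congʳ (≈-reflexive (≡.cong f (∪-identityʳ R)))) (≈-trans (F.-‿inverseʳ _) (≈-sym (over-⊥ (marginal f R))))))
      (λ X e e∉X ih → begin
        f (R ∪ (X ∪ ⁅ e ⁆)) - f R  ≡⟨ ≡.cong (λ Y → f Y - f R) (∪-assoc R X ⁅ e ⁆) ⟨
        f ((R ∪ X) ∪ ⁅ e ⁆) - f R
          ≈⟨ solve 3 (λ a b c → a :- c := (b :- c) :+ (a :- b)) ≈-refl _ (f (R ∪ X)) _ ⟩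
        (f (R ∪ X) - f R) + marginal f (R ∪ X) e       ≤⟨ +-mono-≤ ih (submod R (R ∪ X) e (p⊆p∪q X)) ⟩
        over X (marginal f R) + marginal f R e         ≈⟨ over-∪ X e e∉X _ ⟨
        over (X ∪ ⁅ e ⁆) (marginal f R) ∎)

    -- The elements of X are added in the same order to both sets, and at each step submodularity
    -- compares the two marginals.
    gain-antitone : ∀ R S X → R ⊆ S → f (S ∪ X) - f S ≤ f (R ∪ X) - f R
    gain-antitone R S X R⊆S = subset-induction (λ X → f (S ∪ X) - f S ≤ f (R ∪ X) - f R)
      (≤-reflexive (≈-trans (≈-trans (+-congʳ (≈-reflexive (≡.cong f (∪-identityʳ S)))) (F.-‿inverseʳ _))
        (≈-sym (≈-trans (+-congʳ (≈-reflexive (≡.cong f (∪-identityʳ R)))) (F.-‿inverseʳ _)))))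
      (λ X e _ ih → begin
        f (S ∪ (X ∪ ⁅ e ⁆)) - f S  ≡⟨ ≡.cong (λ Y → f Y - f S) (∪-assoc S X ⁅ e ⁆) ⟨
        f ((S ∪ X) ∪ ⁅ e ⁆) - f S
          ≈⟨ solve 3 (λ a b c → a :- c := (b :- c) :+ (a :- b)) ≈-refl _ (f (S ∪ X)) _ ⟩
        (f (S ∪ X) - f S) + marginal f (S ∪ X) e
          ≤⟨ +-mono-≤ ih (submod (R ∪ X) (S ∪ X) e (∪-⊆ (p⊆p∪q X ∘ R⊆S) (q⊆p∪q S X))) ⟩
        (f (R ∪ X) - f R) + marginal f (R ∪ X) e
          ≈⟨ solve 3 (λ a b c → a :- c := (b :- c) :+ (a :- b)) ≈-refl _ (f (R ∪ X)) _ ⟨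
        f ((R ∪ X) ∪ ⁅ e ⁆) - f R  ≡⟨ ≡.cong (λ Y → f Y - f R) (∪-assoc R X ⁅ e ⁆) ⟩
        f (R ∪ (X ∪ ⁅ e ⁆)) - f R ∎)
      X

    gain-≤-value : ∀ R X → f (R ∪ X) - f R ≤ f X
    gain-≤-value R X = begin
      f (R ∪ X) - f R   ≤⟨ gain-antitone ⊥ R X ⊥⊆ ⟩
      f (⊥ ∪ X) - f ⊥   ≡⟨ ≡.cong (λ Y → f Y - f ⊥) (∪-identityˡ X) ⟩
      f X - f ⊥         ≤⟨ ≤-by (nonNeg ⊥) (solve 2 (λ a b → a :- (a :- b) := b) ≈-refl _ _) ⟩
      f X ∎

    -- Build Z up element by element. The part built so far lies in R without e, so adding e to it
    -- gains at least what removing e from R loses; the gains telescope to f Z - f ⊥. Both the slope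
    -- of the averages and the lower bound `average-≥` for a bin rest on this.
    losses-≤-value : ∀ R Z → Z ⊆ R → over Z (λ e → f R - f (R ∖ e)) ≤ f Z
    losses-≤-value R = subset-induction _ (λ _ → ≤-trans (≤-reflexive (over-⊥ (λ e → f R - f (R ∖ e)))) (nonNeg ⊥))
      (λ Z e e∉Z ih Z∪e⊆R → begin
        over (Z ∪ ⁅ e ⁆) (λ e → f R - f (R ∖ e))           ≈⟨ over-∪ Z e e∉Z _ ⟩
        over Z (λ e → f R - f (R ∖ e)) + (f R - f (R ∖ e))
          ≤⟨ +-mono-≤ (ih (Z∪e⊆R ∘ p⊆p∪q ⁅ e ⁆)) (loss Z e e∉Z Z∪e⊆R) ⟩
        f Z + marginal f Z e  ≈⟨ ≤-marginal Z e ⟨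
        f (Z ∪ ⁅ e ⁆) ∎)
      where
      loss : ∀ Z e → e ∉ Z → Z ∪ ⁅ e ⁆ ⊆ R → f R - f (R ∖ e) ≤ marginal f Z e
      loss Z e e∉Z Z∪e⊆R = ≤-trans
        (≤-reflexive (+-congʳ (≈-reflexive (≡.cong f (≡.sym (S∖e∪⁅e⁆ (Z∪e⊆R (e∈S∪⁅e⁆ Z e))))))))
        (submod Z (R ∖ e) e (λ x∈Z → x∈p∧x≢y⇒x∈p-y (Z∪e⊆R (p⊆p∪q ⁅ e ⁆ x∈Z)) (λ { ≡.refl → e∉Z x∈Z })))

  -- Averages over the subsets of a given size

  *-pos⁻ : ∀ {x y} → 0# ≤ x → 0# < x * y → 0# < y
  *-pos⁻ 0≤x p = ≰⇒> λ y≤0 → <⇒≱ p (≤-trans (*-monoʳ-≤ 0≤x y≤0) (≤-reflexive (F.zeroʳ _)))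

  fromℕ-∸ : ∀ {m n} → m ℕ.≤ n → fromℕ (n ℕ.∸ m) ≈ fromℕ n - fromℕ m
  fromℕ-∸ {m} {n} m≤n = begin-equality
    fromℕ (n ℕ.∸ m)  ≈⟨ solve 2 (λ a b → a := a :+ b :- b) ≈-refl _ (fromℕ m) ⟩
    fromℕ (n ℕ.∸ m) + fromℕ m - fromℕ m     ≈⟨ +-congʳ (fromℕ-+ (n ℕ.∸ m) m) ⟨
    fromℕ (n ℕ.∸ m ℕ.+ m) - fromℕ m         ≡⟨ ≡.cong (λ k → fromℕ k - fromℕ m) (ℕ.m∸n+n≡m m≤n) ⟩
    fromℕ n - fromℕ m ∎

  layerSum : Subset n → ℕ → (Subset n → Carrier) → Carrier
  layerSum B j g = ∑ₛ (λ S → ind ((S ⊆? B) ×-dec (∣ S ∣ ℕ.≟ j)) * g S)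

  sizeSum : ℕ → (Subset n → Carrier) → Carrier
  sizeSum j g = ∑ₛ (λ S → ind (∣ S ∣ ℕ.≟ j) * g S)

  module _ {n : ℕ} (B : Subset n) (j : ℕ) where

    layerSum-cong : ∀ {g h} → (∀ S → S ⊆ B → ∣ S ∣ ≡ j → g S ≈ h S) → layerSum B j g ≈ layerSum B j h
    layerSum-cong p = ∑-cong (subsets n) (λ S → ind-*-cong ((S ⊆? B) ×-dec (∣ S ∣ ℕ.≟ j)) (λ (a , b) → p S a b))

    layerSum-mono : ∀ {g h} → (∀ S → S ⊆ B → ∣ S ∣ ≡ j → g S ≤ h S) → layerSum B j g ≤ layerSum B j h
    layerSum-mono p = ∑-mono (subsets n) (λ S → ind-*-mono ((S ⊆? B) ×-dec (∣ S ∣ ℕ.≟ j)) (λ (a , b) → p S a b))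

    layerSum-* : ∀ z g → layerSum B j (λ S → z * g S) ≈ z * layerSum B j g
    layerSum-* z g = ≈-trans (∑-cong (subsets n) (λ S → solve 3 (λ i z g → i :* (z :* g) := z :* (i :* g)) ≈-refl _ z (g S)))
      (∑-* (subsets n) z _)

    layerSum-nonNeg : ∀ {g} → (∀ S → 0# ≤ g S) → 0# ≤ layerSum B j g
    layerSum-nonNeg p = ∑-nonNeg (subsets n) (λ S → ind-*-nonNeg ((S ⊆? B) ×-dec (∣ S ∣ ℕ.≟ j)) (λ _ → p S))

  sizeSum-layerSum : ∀ j (g : Subset n → Carrier) → sizeSum j g ≈ layerSum ⊤ j g
  sizeSum-layerSum {n} j g = ∑-cong (subsets n) (λ S →
    *-congʳ (ind-cong (∣ S ∣ ℕ.≟ j) ((S ⊆? ⊤) ×-dec (∣ S ∣ ℕ.≟ j)) (λ e → ⊆⊤ , e) proj₂))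

  -- The length n is explicit: it cannot be inferred from a sum over subsets n.
  module SizeSum (n : ℕ) where

    sizeSum-cong : ∀ j {g h : Subset n → Carrier} → (∀ S → ∣ S ∣ ≡ j → g S ≈ h S) → sizeSum j g ≈ sizeSum j h
    sizeSum-cong j p = ∑-cong (subsets n) (λ S → ind-*-cong (∣ S ∣ ℕ.≟ j) (p S))

    sizeSum-mono : ∀ j {g h : Subset n → Carrier} → (∀ S → ∣ S ∣ ≡ j → g S ≤ h S) → sizeSum j g ≤ sizeSum j h
    sizeSum-mono j p = ∑-mono (subsets n) (λ S → ind-*-mono (∣ S ∣ ℕ.≟ j) (p S))

    sizeSum-* : ∀ j z (g : Subset n → Carrier) → sizeSum j (λ S → z * g S) ≈ z * sizeSum j g
    sizeSum-* j z g = ≈-trans (∑-cong (subsets n) (λ S → solve 3 (λ i z g → i :* (z :* g) := z :* (i :* g)) ≈-refl _ z (g S)))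
      (∑-* (subsets n) z _)

    sizeSum-+ : ∀ j (g h : Subset n → Carrier) → sizeSum j (λ S → g S + h S) ≈ sizeSum j g + sizeSum j h
    sizeSum-+ j g h = ≈-trans (∑-cong (subsets n) (λ S → F.distribˡ _ _ _)) (∑-+ (subsets n) _ _)

    sizeSum-- : ∀ j (g h : Subset n → Carrier) → sizeSum j (λ S → g S - h S) ≈ sizeSum j g - sizeSum j h
    sizeSum-- j g h = ≈-trans (∑-cong (subsets n) (λ S → solve 3 (λ i a b → i :* (a :- b) := i :* a :- i :* b) ≈-refl _ (g S) (h S)))
      (∑-- (subsets n) _ _)

    sizeSum-nonNeg : ∀ j {g : Subset n → Carrier} → (∀ S → 0# ≤ g S) → 0# ≤ sizeSum j g
    sizeSum-nonNeg j p = ∑-nonNeg (subsets n) (λ S → ind-*-nonNeg (∣ S ∣ ℕ.≟ j) (λ _ → p S))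

    sizeSum-over : ∀ j (B : Subset n) (g : Subset n → Fin n → Carrier) →
      sizeSum j (λ S → over B (g S)) ≈ over B (λ e → sizeSum j (λ S → g S e))
    sizeSum-over j B g = begin-equality
      ∑ₛ (λ S → ind (∣ S ∣ ℕ.≟ j) * ∑ₑ (λ e → ind (e ∈? B) * g S e))
        ≈⟨ ∑-cong (subsets n) (λ S → ∑-* (allFin n) _ _) ⟨
      ∑ₛ (λ S → ∑ₑ (λ e → ind (∣ S ∣ ℕ.≟ j) * (ind (e ∈? B) * g S e)))
        ≈⟨ ∑-swap (subsets n) (allFin n) _ ⟩
      ∑ₑ (λ e → ∑ₛ (λ S → ind (∣ S ∣ ℕ.≟ j) * (ind (e ∈? B) * g S e)))
        ≈⟨ ∑-cong (allFin n) (λ e → sizeSum-* j (ind (e ∈? B)) (λ S → g S e)) ⟩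
      over B (λ e → sizeSum j (λ S → g S e)) ∎

  -- Double counting: deleting e turns a pair of a (j + 1)-subset of B and an element e of it into a
  -- pair of a j-subset and an element of B outside it.
  layerSum-shift : ∀ (B : Subset n) j (g : Subset n → Fin n → Carrier) →
    layerSum B (suc j) (λ S → over S (g S)) ≈
    layerSum B j (λ S → ∑ₑ (λ e → ind (e ∈? B) * (ind (¬? (e ∈? S)) * g (S ∪ ⁅ e ⁆) e)))
  layerSum-shift {n} B j g = begin-equality
    ∑ₛ (λ S → lay (suc j) S * ∑ₑ (λ e → ind (e ∈? S) * g S e))
      ≈⟨ ∑-cong (subsets n) (λ S → ≈-trans (≈-sym (∑-* (allFin n) _ _)) (∑-cong (allFin n) (λ e →
           solve 3 (λ a b c → a :* (b :* c) := b :* (a :* c)) ≈-refl (lay (suc j) S) _ (g S e)))) ⟩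
    ∑ₛ (λ S → ∑ₑ (λ e → ind (e ∈? S) * (lay (suc j) S * g S e)))
      ≈⟨ ∑-swap (subsets n) (allFin n) _ ⟩
    ∑ₑ (λ e → ∑ₛ (λ S → ind (e ∈? S) * (lay (suc j) S * g S e)))
      ≈⟨ ∑-cong (allFin n) (λ e → ∑ₛ-add e (λ S → lay (suc j) S * g S e)) ⟩
    ∑ₑ (λ e → ∑ₛ (λ S → ind (¬? (e ∈? S)) * (lay (suc j) (S ∪ ⁅ e ⁆) * g (S ∪ ⁅ e ⁆) e)))
      ≈⟨ ∑-cong (allFin n) (λ e → ∑-cong (subsets n) (λ S → pointwise S e)) ⟩
    ∑ₑ (λ e → ∑ₛ (λ S → lay j S * (ind (e ∈? B) * (ind (¬? (e ∈? S)) * g (S ∪ ⁅ e ⁆) e))))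
      ≈⟨ ∑-swap (subsets n) (allFin n) _ ⟨
    ∑ₛ (λ S → ∑ₑ (λ e → lay j S * (ind (e ∈? B) * (ind (¬? (e ∈? S)) * g (S ∪ ⁅ e ⁆) e))))
      ≈⟨ ∑-cong (subsets n) (λ S → ∑-* (allFin n) _ _) ⟩
    layerSum B j (λ S → ∑ₑ (λ e → ind (e ∈? B) * (ind (¬? (e ∈? S)) * g (S ∪ ⁅ e ⁆) e))) ∎
    where
    lay : ℕ → Subset n → Carrier
    lay j S = ind ((S ⊆? B) ×-dec (∣ S ∣ ℕ.≟ j))
    pointwise : ∀ S e → ind (¬? (e ∈? S)) * (lay (suc j) (S ∪ ⁅ e ⁆) * g (S ∪ ⁅ e ⁆) e) ≈
      lay j S * (ind (e ∈? B) * (ind (¬? (e ∈? S)) * g (S ∪ ⁅ e ⁆) e))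
    pointwise S e = ≈-trans (ind-*-cong (¬? (e ∈? S)) (λ e∉S → *-congʳ (begin-equality
      lay (suc j) (S ∪ ⁅ e ⁆)
        ≈⟨ ind-cong ((S ∪ ⁅ e ⁆ ⊆? B) ×-dec (∣ S ∪ ⁅ e ⁆ ∣ ℕ.≟ suc j)) (((S ⊆? B) ×-dec (∣ S ∣ ℕ.≟ j)) ×-dec (e ∈? B))
             (λ (a , b) → (a ∘ p⊆p∪q ⁅ e ⁆ , ℕ.suc-injective (≡.trans (≡.sym (∣S∪⁅e⁆∣ e∉S)) b)) , a (e∈S∪⁅e⁆ S e))
             (λ ((a , b) , c) → ∪-⊆ a (⁅⁆-⊆ c) , ≡.trans (∣S∪⁅e⁆∣ e∉S) (≡.cong suc b)) ⟩
      ind (((S ⊆? B) ×-dec (∣ S ∣ ℕ.≟ j)) ×-dec (e ∈? B))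
        ≈⟨ ind-× ((S ⊆? B) ×-dec (∣ S ∣ ℕ.≟ j)) (e ∈? B) ⟩
      lay j S * ind (e ∈? B) ∎)))
      (solve 4 (λ a b c d → a :* (b :* c :* d) := b :* (c :* (a :* d))) ≈-refl _ (lay j S) _ _)

  ∑ₑ-difference : ∀ {S B : Subset n} → S ⊆ B →
    ∀ z → ∑ₑ (λ e → ind (e ∈? B) * (ind (¬? (e ∈? S)) * z)) ≈ ((fromℕ ∣ B ∣) - (fromℕ ∣ S ∣)) * z
  ∑ₑ-difference {n} {S} {B} S⊆B z = begin-equality
    ∑ₑ (λ e → ind (e ∈? B) * (ind (¬? (e ∈? S)) * z))
      ≈⟨ ∑-cong (allFin n) pointwise ⟩
    ∑ₑ (λ e → ind (e ∈? B) * z - ind (e ∈? S) * z)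
      ≈⟨ ∑-- (allFin n) _ _ ⟩
    over B (λ _ → z) - over S (λ _ → z)
      ≈⟨ +-cong (over-const B z) (-‿cong (over-const S z)) ⟩
    (fromℕ ∣ B ∣) * z - (fromℕ ∣ S ∣) * z
      ≈⟨ solve 3 (λ a b z → a :* z :- b :* z := (a :- b) :* z) ≈-refl _ _ z ⟩
    ((fromℕ ∣ B ∣) - (fromℕ ∣ S ∣)) * z ∎
    where
    pointwise : ∀ e → ind (e ∈? B) * (ind (¬? (e ∈? S)) * z) ≈ ind (e ∈? B) * z - ind (e ∈? S) * z
    pointwise e with e ∈? S | e ∈? B
    ... | yes e∈S | yes _ = solve 1 (λ z → :1 :* (:0 :* z) := :1 :* z :- :1 :* z) ≈-refl z
    ... | yes e∈S | no e∉B = contradiction (S⊆B e∈S) e∉B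
    ... | no _ | yes _ = solve 1 (λ z → :1 :* (:1 :* z) := :1 :* z :- :0 :* z) ≈-refl z
    ... | no _ | no _ = solve 1 (λ z → :0 :* (:1 :* z) := :0 :* z :- :0 :* z) ≈-refl z

  -- Each j-subset of B is what remains after a removal in |B| - j ways, one for each element of B
  -- outside it.
  layerSum-remove : ∀ (B : Subset n) j (g : Subset n → Carrier) →
    layerSum B (suc j) (λ S → over S (λ e → g (S ∖ e))) ≈ ((fromℕ ∣ B ∣) - fromℕ j) * layerSum B j g
  layerSum-remove {n} B j g = begin-equality
    layerSum B (suc j) (λ S → over S (λ e → g (S ∖ e)))
      ≈⟨ layerSum-shift B j (λ S e → g (S ∖ e)) ⟩
    layerSum B j (λ S → ∑ₑ (λ e → ind (e ∈? B) * (ind (¬? (e ∈? S)) * g ((S ∪ ⁅ e ⁆) ∖ e))))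
      ≈⟨ layerSum-cong B j (λ S S⊆B ∣S∣≡j → begin-equality
           ∑ₑ (λ e → ind (e ∈? B) * (ind (¬? (e ∈? S)) * g ((S ∪ ⁅ e ⁆) ∖ e)))
             ≈⟨ ∑-cong (allFin n) (λ e → *-congˡ (ind-*-cong (¬? (e ∈? S)) (λ e∉S → ≈-reflexive (≡.cong g (S∪⁅e⁆∖e e∉S))))) ⟩
           ∑ₑ (λ e → ind (e ∈? B) * (ind (¬? (e ∈? S)) * g S))
             ≈⟨ ∑ₑ-difference S⊆B (g S) ⟩
           ((fromℕ ∣ B ∣) - (fromℕ ∣ S ∣)) * g S
             ≡⟨ ≡.cong (λ i → ((fromℕ ∣ B ∣) - fromℕ i) * g S) ∣S∣≡j ⟩
           ((fromℕ ∣ B ∣) - fromℕ j) * g S ∎) ⟩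
    layerSum B j (λ S → ((fromℕ ∣ B ∣) - fromℕ j) * g S)
      ≈⟨ layerSum-* B j _ g ⟩
    ((fromℕ ∣ B ∣) - fromℕ j) * layerSum B j g ∎

  layerCount : Subset n → ℕ → Carrier
  layerCount B j = layerSum B j (λ _ → 1#)

  -- The recurrence of the binomial coefficients, as the case g = 1 of the removal identity. It
  -- stands in for a closed form, both for the positivity of the counts and for passing from sums to
  -- averages.
  layerCount-suc : ∀ (B : Subset n) j →
    fromℕ (suc j) * layerCount B (suc j) ≈ ((fromℕ ∣ B ∣) - fromℕ j) * layerCount B j
  layerCount-suc B j = ≈-trans (≈-trans (≈-sym (layerSum-* B (suc j) _ _))
    (layerSum-cong B (suc j) (λ S _ e → ≈-sym (≈-trans (over-const S 1#) (*-congʳ (≈-reflexive (≡.cong fromℕ e)))))))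
    (layerSum-remove B j (λ _ → 1#))

  fromℕ-gap : ∀ {m n} → m ℕ.< n → 0# < fromℕ n - fromℕ m
  fromℕ-gap {m} {n} m<n = <-≤-trans (fromℕ-pos (ℕ.m<n⇒0<n∸m m<n)) (≤-reflexive (fromℕ-∸ (ℕ.<⇒≤ m<n)))

  layerCount-pos : ∀ (B : Subset n) j → j ℕ.≤ ∣ B ∣ → 0# < layerCount B j
  layerCount-pos {n} B zero _ = <-≤-trans 0<1 (≤-trans
    (≤-reflexive (≈-sym (≈-trans (F.*-identityʳ _) (ind-yes ((⊥ ⊆? B) ×-dec (∣ ⊥ {n} ∣ ℕ.≟ 0)) (⊥⊆ , ∣⊥∣≡0 n)))))
    (∈⇒≤∑ (λ S → ind ((S ⊆? B) ×-dec (∣ S ∣ ℕ.≟ 0)) * 1#)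
      (λ S → ind-*-nonNeg ((S ⊆? B) ×-dec (∣ S ∣ ℕ.≟ 0)) (λ _ → 0≤1)) (∈-subsets ⊥)))
  layerCount-pos B (suc j) j<β = *-pos⁻ (fromℕ-nonNeg (suc j))
    (<-≤-trans (*-pos (fromℕ-gap j<β) (layerCount-pos B j (ℕ.<⇒≤ j<β))) (≤-reflexive (≈-sym (layerCount-suc B j))))

  layerAverage : Subset n → ℕ → (Subset n → Carrier) → Carrier
  layerAverage B j g = layerSum B j g * layerCount B j ⁻¹

  layerSum-average : ∀ (B : Subset n) j g → j ℕ.≤ ∣ B ∣ → layerCount B j * layerAverage B j g ≈ layerSum B j g
  layerSum-average B j g j≤β = /-cancel _ (layerCount-pos B j j≤β)

  module Averages {n} {f : SetFunction n} (nonNeg : NonNegative f) (mono : Monotone f) (submod : Submodular f)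
                  (B : Subset n) where
    open Submod nonNeg mono submod

    β : Carrier
    β = (fromℕ ∣ B ∣)

    avg : ℕ → Carrier
    avg j = layerAverage B j f

    avg-nonNeg : ∀ {j} → j ℕ.≤ ∣ B ∣ → 0# ≤ avg j
    avg-nonNeg {j} p = *-nonNeg (layerSum-nonNeg B j nonNeg) (⁻¹-nonNeg (layerCount-pos B j p))

    layerSum-rise : ∀ j → (β - fromℕ j) * layerSum B j f ≤ fromℕ (suc j) * layerSum B (suc j) f
    layerSum-rise j = begin
      (β - fromℕ j) * layerSum B j f  ≈⟨ layerSum-remove B j f ⟨
      layerSum B (suc j) (λ S → over S (λ e → f (S ∖ e)))
        ≤⟨ layerSum-mono B (suc j) (λ S _ ∣S∣≡ → ≤-trans (over-mono S (λ {e} _ → mono-⊆ (p─q⊆p S ⁅ e ⁆)))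
             (≤-reflexive (≈-trans (over-const S (f S)) (*-congʳ (≈-reflexive (≡.cong fromℕ ∣S∣≡)))))) ⟩
      layerSum B (suc j) (λ S → fromℕ (suc j) * f S)  ≈⟨ layerSum-* B (suc j) _ f ⟩
      fromℕ (suc j) * layerSum B (suc j) f ∎

    -- By `losses-≤-value` with R = Z = S, the j + 1 values of S with one element removed add up to
    -- at least j times f S.
    layerSum-slope : ∀ j → fromℕ j * layerSum B (suc j) f ≤ (β - fromℕ j) * layerSum B j f
    layerSum-slope j = begin
      fromℕ j * layerSum B (suc j) f  ≈⟨ layerSum-* B (suc j) _ f ⟨
      layerSum B (suc j) (λ S → fromℕ j * f S)  ≤⟨ layerSum-mono B (suc j) (λ S _ → pointwise S) ⟩
      layerSum B (suc j) (λ S → over S (λ e → f (S ∖ e)))       ≈⟨ layerSum-remove B j f ⟩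
      (β - fromℕ j) * layerSum B j f ∎
      where
      pointwise : ∀ S → ∣ S ∣ ≡ suc j → fromℕ j * f S ≤ over S (λ e → f (S ∖ e))
      pointwise S ∣S∣≡ = ≤-by (≤⇒0≤ (losses-≤-value S S id)) (begin-equality
        over S (λ e → f (S ∖ e)) - fromℕ j * f S
          ≈⟨ solve 3 (λ a j x → a :- j :* x := x :- ((:1 :+ j) :* x :- a)) ≈-refl _ (fromℕ j) (f S) ⟩
        f S - (fromℕ (suc j) * f S - over S (λ e → f (S ∖ e)))
          ≡⟨ ≡.cong (λ i → f S - (fromℕ i * f S - over S (λ e → f (S ∖ e)))) ∣S∣≡ ⟨
        f S - ((fromℕ ∣ S ∣) * f S - over S (λ e → f (S ∖ e)))
          ≈⟨ +-congˡ (-‿cong (+-congʳ (over-const S (f S)))) ⟨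
        f S - (over S (λ _ → f S) - over S (λ e → f (S ∖ e)))
          ≈⟨ +-congˡ (-‿cong (≈-trans (∑-cong (allFin n) (λ e → solve 3 (λ i a b → i :* (a :- b) := i :* a :- i :* b) ≈-refl _ _ _))
               (∑-- (allFin n) (λ e → ind (e ∈? S) * f S) (λ e → ind (e ∈? S) * f (S ∖ e))))) ⟨
        f S - over S (λ e → f S - f (S ∖ e)) ∎)

    avg-rise : ∀ {j} → j ℕ.< ∣ B ∣ → avg j ≤ avg (suc j)
    avg-rise {j} j<β = *-cancelˡ-≤ (*-pos (fromℕ-gap j<β) (layerCount-pos B j (ℕ.<⇒≤ j<β))) (begin
      (β - fromℕ j) * layerCount B j * avg j  ≈⟨ F.*-assoc _ _ _ ⟩
      (β - fromℕ j) * (layerCount B j * avg j)  ≈⟨ *-congˡ (layerSum-average B j f (ℕ.<⇒≤ j<β)) ⟩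
      (β - fromℕ j) * layerSum B j f  ≤⟨ layerSum-rise j ⟩
      fromℕ (suc j) * layerSum B (suc j) f  ≈⟨ *-congˡ (layerSum-average B (suc j) f j<β) ⟨
      fromℕ (suc j) * (layerCount B (suc j) * avg (suc j)) ≈⟨ F.*-assoc _ _ _ ⟨
      fromℕ (suc j) * layerCount B (suc j) * avg (suc j)   ≈⟨ *-congʳ (layerCount-suc B j) ⟩
      (β - fromℕ j) * layerCount B j * avg (suc j) ∎)

    avg-slope : ∀ {j} → j ℕ.< ∣ B ∣ → fromℕ j * avg (suc j) ≤ fromℕ (suc j) * avg j
    avg-slope {j} j<β = *-cancelˡ-≤ (layerCount-pos B (suc j) j<β) (begin
      C′ * (fromℕ j * avg (suc j))       ≈⟨ solve 3 (λ a b c → a :* (b :* c) := b :* (a :* c)) ≈-refl C′ _ _ ⟩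
      fromℕ j * (C′ * avg (suc j))       ≈⟨ *-congˡ (layerSum-average B (suc j) f j<β) ⟩
      fromℕ j * layerSum B (suc j) f     ≤⟨ layerSum-slope j ⟩
      (β - fromℕ j) * layerSum B j f     ≈⟨ *-congˡ (layerSum-average B j f (ℕ.<⇒≤ j<β)) ⟨
      (β - fromℕ j) * (layerCount B j * avg j)   ≈⟨ F.*-assoc _ _ _ ⟨
      (β - fromℕ j) * layerCount B j * avg j     ≈⟨ *-congʳ (layerCount-suc B j) ⟨
      fromℕ (suc j) * C′ * avg j         ≈⟨ solve 3 (λ a b c → a :* b :* c := b :* (a :* c)) ≈-refl _ C′ _ ⟩
      C′ * (fromℕ (suc j) * avg j) ∎)
      where C′ = layerCount B (suc j)

    avg-mono : ∀ {j l} → j ℕ.≤′ l → l ℕ.≤ ∣ B ∣ → avg j ≤ avg l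
    avg-mono ℕ.≤′-refl _ = ≤-refl
    avg-mono (ℕ.≤′-step p) l<β = ≤-trans (avg-mono p (ℕ.<⇒≤ l<β)) (avg-rise l<β)

    avg-concave : ∀ {j l} → j ℕ.≤′ l → l ℕ.≤ ∣ B ∣ → fromℕ j * avg l ≤ fromℕ l * avg j
    avg-concave ℕ.≤′-refl _ = ≤-refl
    -- For j = 0 the factor l that the next clause cancels might be 0, so non-negativity settles
    -- this case.
    avg-concave {zero} {suc l} (ℕ.≤′-step p) l<β = ≤-trans (≤-reflexive (F.zeroˡ _))
      (*-nonNeg (fromℕ-nonNeg (suc l)) (avg-nonNeg ℕ.z≤n))
    avg-concave {suc j} {suc l} (ℕ.≤′-step p) l<β = *-cancelˡ-≤ (fromℕ-pos (ℕ.≤-trans (ℕ.s≤s ℕ.z≤n) (ℕ.≤′⇒≤ p))) (begin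
      fromℕ l * (fromℕ (suc j) * avg (suc l))
        ≈⟨ solve 3 (λ a b c → a :* (b :* c) := b :* (a :* c)) ≈-refl (fromℕ l) _ _ ⟩
      fromℕ (suc j) * (fromℕ l * avg (suc l))   ≤⟨ *-monoʳ-≤ (fromℕ-nonNeg (suc j)) (avg-slope l<β) ⟩
      fromℕ (suc j) * (fromℕ (suc l) * avg l)
        ≈⟨ solve 3 (λ a b c → a :* (b :* c) := b :* (a :* c)) ≈-refl _ (fromℕ (suc l)) _ ⟩
      fromℕ (suc l) * (fromℕ (suc j) * avg l)   ≤⟨ *-monoʳ-≤ (fromℕ-nonNeg (suc l)) (avg-concave p (ℕ.<⇒≤ l<β)) ⟩
      fromℕ (suc l) * (fromℕ l * avg (suc j))
        ≈⟨ solve 3 (λ a b c → a :* (b :* c) := b :* (a :* c)) ≈-refl (fromℕ (suc l)) _ _ ⟩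
      fromℕ l * (fromℕ (suc l) * avg (suc j)) ∎)

    -- The average over l-sets is at most max(1, l/k) times that over k-sets, by monotonicity if l ≤
    -- k and by the slope if l ≥ k. The maximum is weakened to 1 + l/k since an affine function of l
    -- can be averaged over a random l of which only the mean is known.
    avg-compare : ∀ {k l} → k ℕ.≤ ∣ B ∣ → l ℕ.≤ ∣ B ∣ → fromℕ k * avg l ≤ (fromℕ k + fromℕ l) * avg k
    avg-compare {k} {l} k≤β l≤β with ℕ.≤-total k l
    ... | inj₁ k≤l = ≤-trans (avg-concave (ℕ.≤⇒≤′ k≤l) l≤β) (≤-by (*-nonNeg (fromℕ-nonNeg k) (avg-nonNeg k≤β))
          (solve 3 (λ k l a → (k :+ l) :* a :- l :* a := k :* a) ≈-refl (fromℕ k) (fromℕ l) (avg k)))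
    ... | inj₂ l≤k = ≤-trans (*-monoʳ-≤ (fromℕ-nonNeg k) (avg-mono (ℕ.≤⇒≤′ l≤k) k≤β)) (≤-by (*-nonNeg (fromℕ-nonNeg l) (avg-nonNeg k≤β))
          (solve 3 (λ k l a → (k :+ l) :* a :- k :* a := l :* a) ≈-refl (fromℕ k) (fromℕ l) (avg k)))

    -- On the right, l is written as |S|: both sides then sum a function of S that does not mention
    -- l, which is the form required by `fibrewise`. If l > |B|, there are no l-subsets of B.
    layerSum-compare : ∀ {k} → k ℕ.≤ ∣ B ∣ → ∀ l →
      layerSum B l (λ S → fromℕ k * f S) ≤ layerSum B l (λ S → (fromℕ k + (fromℕ ∣ S ∣)) * avg k)
    layerSum-compare {k} k≤β l with l ℕ.≤? ∣ B ∣
    ... | yes l≤β = begin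
      layerSum B l (λ S → fromℕ k * f S)  ≈⟨ layerSum-* B l _ f ⟩
      fromℕ k * layerSum B l f  ≈⟨ *-congˡ (layerSum-average B l f l≤β) ⟨
      fromℕ k * (layerCount B l * avg l)
        ≈⟨ solve 3 (λ a b c → a :* (b :* c) := b :* (a :* c)) ≈-refl (fromℕ k) _ _ ⟩
      layerCount B l * (fromℕ k * avg l)
        ≤⟨ *-monoʳ-≤ (proj₁ (layerCount-pos B l l≤β)) (avg-compare k≤β l≤β) ⟩
      layerCount B l * ((fromℕ k + fromℕ l) * avg k)  ≈⟨ F.*-comm _ _ ⟩
      (fromℕ k + fromℕ l) * avg k * layerCount B l    ≈⟨ layerSum-* B l _ _ ⟨
      layerSum B l (λ S → (fromℕ k + fromℕ l) * avg k * 1#)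
        ≈⟨ layerSum-cong B l (λ S _ e → ≈-trans (F.*-identityʳ _) (*-congʳ (+-congˡ (≈-reflexive (≡.cong fromℕ (≡.sym e)))))) ⟩
      layerSum B l (λ S → (fromℕ k + (fromℕ ∣ S ∣)) * avg k) ∎
    ... | no l≰β = layerSum-mono B l (λ S S⊆B ∣S∣≡l →
      contradiction (≡.subst (ℕ._≤ ∣ B ∣) ∣S∣≡l (p⊆q⇒∣p∣≤∣q∣ S⊆B)) l≰β)

  -- Fix the part X of R outside B. Then R ∩ B runs through all subsets of B of size r - |X|, each
  -- once, so an inequality between the sums over each layer of B passes to the sum over R.
  fibrewise : ∀ (B : Subset n) {g h : Subset n → Carrier} → (∀ l → layerSum B l g ≤ layerSum B l h) →
    ∀ r → sizeSum r (λ R → g (R ∩ B)) ≤ sizeSum r (λ R → h (R ∩ B))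
  fibrewise {n} B {g} {h} p r = begin
    sizeSum r (λ R → g (R ∩ B))  ≈⟨ ∑ₛ-split B _ ⟩
    ∑ₛ (λ X → ind (X ⊆? ∁ B) * inner g X)  ≤⟨ ∑-mono (subsets n) (λ X → ind-*-mono (X ⊆? ∁ B) (fibre X)) ⟩
    ∑ₛ (λ X → ind (X ⊆? ∁ B) * inner h X)  ≈⟨ ∑ₛ-split B _ ⟨
    sizeSum r (λ R → h (R ∩ B)) ∎
    where
    inner : (Subset n → Carrier) → Subset n → Carrier
    inner g X = ∑ₛ (λ Z → ind (Z ⊆? B) * (ind (∣ X ∪ Z ∣ ℕ.≟ r) * g ((X ∪ Z) ∩ B)))
    size : ∀ {X Z} → X ⊆ ∁ B → Z ⊆ B → ∣ X ∪ Z ∣ ≡ ∣ X ∣ ℕ.+ ∣ Z ∣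
    size X⊆ Z⊆ = ∣∪∣-disjoint (λ e∈X e∈Z → x∈∁p⇒x∉p (X⊆ e∈X) (Z⊆ e∈Z))
    fibre : ∀ X → X ⊆ ∁ B → inner g X ≤ inner h X
    fibre X X⊆ with ∣ X ∣ ℕ.≤? r
    ... | yes ∣X∣≤r = ≤-trans (≤-reflexive (as-layer g)) (≤-trans (p (r ℕ.∸ ∣ X ∣)) (≤-reflexive (≈-sym (as-layer h))))
      where
      as-layer : ∀ g → inner g X ≈ layerSum B (r ℕ.∸ ∣ X ∣) g
      as-layer g = ∑-cong (subsets n) (λ Z → ≈-trans
        (ind-*-cong (Z ⊆? B) (λ Z⊆ → *-cong
          (ind-cong (∣ X ∪ Z ∣ ℕ.≟ r) (∣ Z ∣ ℕ.≟ r ℕ.∸ ∣ X ∣)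
            (λ e → ≡.trans (≡.sym (ℕ.m+n∸m≡n ∣ X ∣ ∣ Z ∣)) (≡.cong (ℕ._∸ ∣ X ∣) (≡.trans (≡.sym (size X⊆ Z⊆)) e)))
            (λ e → ≡.trans (size X⊆ Z⊆) (≡.trans (≡.cong (∣ X ∣ ℕ.+_) e) (ℕ.m+[n∸m]≡n ∣X∣≤r))))
          (≈-reflexive (≡.cong g (∪∩-recover X⊆ Z⊆)))))
        (≈-trans (≈-sym (F.*-assoc _ _ _)) (*-congʳ (≈-sym (ind-× (Z ⊆? B) (∣ Z ∣ ℕ.≟ r ℕ.∸ ∣ X ∣))))))
    ... | no ∣X∣≰r = ∑-mono (subsets n) (λ Z → ind-*-mono (Z ⊆? B) (λ Z⊆ → ind-*-mono (∣ X ∪ Z ∣ ℕ.≟ r)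
          (λ e → contradiction (≡.subst (∣ X ∣ ℕ.≤_) (≡.trans (≡.sym (size X⊆ Z⊆)) e) (ℕ.m≤m+n ∣ X ∣ ∣ Z ∣)) ∣X∣≰r)))

  -- Expected marginal contributions

  withSum withoutSum : Fin n → ℕ → (Subset n → Carrier) → Carrier
  withSum e j g = ∑ₛ (λ S → ind ((e ∈? S) ×-dec (∣ S ∣ ℕ.≟ j)) * g S)
  withoutSum e j g = ∑ₛ (λ S → ind (¬? (e ∈? S) ×-dec (∣ S ∣ ℕ.≟ j)) * g S)

  withSum-sizeSum : ∀ (e : Fin n) j g → withSum e j g ≈ sizeSum j (λ S → ind (e ∈? S) * g S)
  withSum-sizeSum {n} e j g = ∑-cong (subsets n) (λ S → ≈-trans (*-congʳ (ind-× (e ∈? S) (∣ S ∣ ℕ.≟ j)))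
    (solve 3 (λ a b c → a :* b :* c := b :* (a :* c)) ≈-refl _ _ (g S)))

  withoutSum-sizeSum : ∀ (e : Fin n) j g → withoutSum e j g ≈ sizeSum j (λ S → ind (¬? (e ∈? S)) * g S)
  withoutSum-sizeSum {n} e j g = ∑-cong (subsets n) (λ S → ≈-trans (*-congʳ (ind-× (¬? (e ∈? S)) (∣ S ∣ ℕ.≟ j)))
    (solve 3 (λ a b c → a :* b :* c := b :* (a :* c)) ≈-refl _ _ (g S)))

  -- The bijection of `∑ₛ-add` raises the size by one. It pairs the sets of the two averages in v̂,
  -- whose difference thereby becomes an average of marginals.
  withSum-shift : ∀ (e : Fin n) j g → withSum e (suc j) g ≈ withoutSum e j (λ S → g (S ∪ ⁅ e ⁆))
  withSum-shift {n} e j g = begin-equality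
    withSum e (suc j) g
      ≈⟨ ∑-cong (subsets n) (λ S → ≈-trans (*-congʳ (ind-× (e ∈? S) (∣ S ∣ ℕ.≟ suc j))) (F.*-assoc _ _ _)) ⟩
    ∑ₛ (λ S → ind (e ∈? S) * (ind (∣ S ∣ ℕ.≟ suc j) * g S))
      ≈⟨ ∑ₛ-add e (λ S → ind (∣ S ∣ ℕ.≟ suc j) * g S) ⟩
    ∑ₛ (λ S → ind (¬? (e ∈? S)) * (ind (∣ S ∪ ⁅ e ⁆ ∣ ℕ.≟ suc j) * g (S ∪ ⁅ e ⁆)))
      ≈⟨ ∑-cong (subsets n) (λ S → ind-*-cong (¬? (e ∈? S)) (λ e∉S → *-congʳ
           (ind-cong (∣ S ∪ ⁅ e ⁆ ∣ ℕ.≟ suc j) (∣ S ∣ ℕ.≟ j)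
             (λ eq → ℕ.suc-injective (≡.trans (≡.sym (∣S∪⁅e⁆∣ e∉S)) eq))
             (λ eq → ≡.trans (∣S∪⁅e⁆∣ e∉S) (≡.cong suc eq))))) ⟩
    ∑ₛ (λ S → ind (¬? (e ∈? S)) * (ind (∣ S ∣ ℕ.≟ j) * g (S ∪ ⁅ e ⁆)))
      ≈⟨ ∑-cong (subsets n) (λ S → ≈-trans (*-congʳ (ind-× (¬? (e ∈? S)) (∣ S ∣ ℕ.≟ j))) (F.*-assoc _ _ _)) ⟨
    withoutSum e j (λ S → g (S ∪ ⁅ e ⁆)) ∎

  sizeCount : ∀ n → ℕ → Carrier
  sizeCount n j = sizeSum {n} j (λ _ → 1#)

  sizeCount-layerCount : ∀ n j → sizeCount n j ≈ layerCount (⊤ {n}) j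
  sizeCount-layerCount n j = sizeSum-layerSum {n} j (λ _ → 1#)

  sizeCount-suc : ∀ n j → fromℕ (suc j) * sizeCount n (suc j) ≈ (fromℕ n - fromℕ j) * sizeCount n j
  sizeCount-suc n j = begin-equality
    fromℕ (suc j) * sizeCount n (suc j)  ≈⟨ *-congˡ (sizeCount-layerCount n (suc j)) ⟩
    fromℕ (suc j) * layerCount (⊤ {n}) (suc j)      ≈⟨ layerCount-suc {n} ⊤ j ⟩
    (fromℕ (∣ ⊤ {n} ∣) - fromℕ j) * layerCount (⊤ {n}) j
      ≈⟨ *-cong (+-congʳ (≈-reflexive (≡.cong fromℕ (∣⊤∣≡n n)))) (≈-sym (sizeCount-layerCount n j)) ⟩
    (fromℕ n - fromℕ j) * sizeCount n j ∎

  sizeCount-pos : ∀ n j → j ℕ.≤ n → 0# < sizeCount n j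
  sizeCount-pos n j j≤n = <-≤-trans (layerCount-pos {n} ⊤ j (ℕ.≤-trans j≤n (ℕ.≤-reflexive (≡.sym (∣⊤∣≡n n)))))
    (≤-reflexive (≈-sym (sizeCount-layerCount n j)))

  withoutSum-count : ∀ (e : Fin (suc n)) j → withoutSum e j (λ _ → 1#) ≈ sizeCount n j
  withoutSum-count {n} e j = begin-equality
    withoutSum e j (λ _ → 1#)
      ≈⟨ ∑-cong (subsets (suc n)) (λ S → ≈-trans (*-congʳ (ind-× (¬? (e ∈? S)) (∣ S ∣ ℕ.≟ j))) (F.*-assoc _ _ _)) ⟩
    ∑ₛ (λ S → ind (¬? (e ∈? S)) * (ind (∣ S ∣ ℕ.≟ j) * 1#))
      ≈⟨ ∑ₛ-avoiding e (λ S → ind (∣ S ∣ ℕ.≟ j) * 1#) ⟩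
    ∑ₛ (λ S → ind (∣ insertAt S e outside ∣ ℕ.≟ j) * 1#)
      ≈⟨ ∑-cong (subsets n) (λ S → *-congʳ (ind-cong (∣ insertAt S e outside ∣ ℕ.≟ j) (∣ S ∣ ℕ.≟ j)
           (≡.trans (≡.sym (∣insertAt∣ S e))) (≡.trans (∣insertAt∣ S e)))) ⟩
    sizeCount n j ∎

  ∑ₑ-const : ∀ n z → ∑ₑ {n} (λ _ → z) ≈ fromℕ n * z
  ∑ₑ-const n z = begin-equality
    ∑ₑ {n} (λ _ → z)  ≈⟨ ∑-cong (allFin n) (λ _ → F.*-identityˡ z) ⟨
    ∑ₑ {n} (λ _ → 1# * z)           ≈⟨ ∑-*ʳ (allFin n) z (λ _ → 1#) ⟩
    ∑ₑ {n} (λ _ → 1#) * z           ≈⟨ *-congʳ (∑-length (allFin n)) ⟨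
    fromℕ (length (allFin n)) * z   ≡⟨ ≡.cong (λ m → fromℕ m * z) (List.length-tabulate {n = n} id) ⟩
    fromℕ n * z ∎

  -- Double counting of the pairs (S, e) with e in S and |S| = j + 1.
  size-count : ∀ {n} j {K} → (∀ (e : Fin n) → withSum e (suc j) (λ _ → 1#) ≈ K) →
    fromℕ (suc j) * sizeCount n (suc j) ≈ fromℕ n * K
  size-count {n} j {K} count = begin-equality
    fromℕ (suc j) * sizeCount n (suc j)
      ≈⟨ sizeSum-* (suc j) (fromℕ (suc j)) (λ _ → 1#) ⟨
    sizeSum {n} (suc j) (λ S → fromℕ (suc j) * 1#)
      ≈⟨ sizeSum-cong (suc j) (λ S e → ≈-trans (over-const S 1#) (*-congʳ (≈-reflexive (≡.cong fromℕ e)))) ⟨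
    sizeSum {n} (suc j) (λ S → over S (λ e → 1#))
      ≈⟨ ∑-cong (subsets n) (λ S → ∑-* (allFin n) (ind (∣ S ∣ ℕ.≟ suc j)) (λ e → ind (e ∈? S) * 1#)) ⟨
    ∑ₛ {n} (λ S → ∑ₑ (λ e → ind (∣ S ∣ ℕ.≟ suc j) * (ind (e ∈? S) * 1#)))
      ≈⟨ ∑-swap (subsets n) (allFin n) (λ S e → ind (∣ S ∣ ℕ.≟ suc j) * (ind (e ∈? S) * 1#)) ⟩
    ∑ₑ {n} (λ e → sizeSum (suc j) (λ S → ind (e ∈? S) * 1#))
      ≈⟨ ∑-cong (allFin n) (λ e → ≈-trans (≈-sym (withSum-sizeSum e (suc j) (λ _ → 1#))) (count e)) ⟩
    ∑ₑ {n} (λ _ → K)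
      ≈⟨ ∑ₑ-const n K ⟩
    fromℕ n * K ∎
    where open SizeSum n

  over-∩ : ∀ (R B : Subset n) h → over (R ∩ B) h ≈ over B (λ e → ind (e ∈? R) * h e)
  over-∩ {n} R B h = ∑-cong (allFin n) (λ e → ≈-trans
    (*-congʳ (≈-trans (ind-cong (e ∈? (R ∩ B)) ((e ∈? B) ×-dec (e ∈? R))
      (λ x → proj₂ (x∈p∩q⁻ R B x) , proj₁ (x∈p∩q⁻ R B x)) (λ (a , b) → x∈p∩q⁺ (b , a))) (ind-× (e ∈? B) (e ∈? R))))
    (F.*-assoc _ _ _))

  sizeSum-over-∩ : ∀ (B : Subset n) j (h : Subset n → Fin n → Carrier) →
    sizeSum j (λ R → over (R ∩ B) (h R)) ≈ over B (λ e → withSum e j (λ R → h R e))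
  sizeSum-over-∩ {n} B j h = begin-equality
    sizeSum j (λ R → over (R ∩ B) (h R))  ≈⟨ sizeSum-cong j (λ R _ → over-∩ R B (h R)) ⟩
    sizeSum j (λ R → over B (λ e → ind (e ∈? R) * h R e))         ≈⟨ sizeSum-over j B _ ⟩
    over B (λ e → sizeSum j (λ R → ind (e ∈? R) * h R e))
      ≈⟨ ∑-cong (allFin n) (λ e → *-congˡ (withSum-sizeSum e j _)) ⟨
    over B (λ e → withSum e j (λ R → h R e)) ∎
    where open SizeSum n

  -- K is the common number of s-sets avoiding, and of (s + 1)-sets containing, a given element.
  module Marginals {n s} {f : SetFunction n}
    (nonNeg : NonNegative f) (mono : Monotone f) (submod : Submodular f)
    (n≡s² : n ≡ s ℕ.* s) (s<n : s ℕ.< n) (e₀ : Fin n)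
    {K : Carrier} (K-pos : 0# < K) (withoutSum-K : ∀ (e : Fin n) → withoutSum e s (λ _ → 1#) ≈ K) where
    open Submod nonNeg mono submod
    open SizeSum n

    Cₛ Cₛ₊₁ : Carrier
    Cₛ = sizeCount n s
    Cₛ₊₁ = sizeCount n (suc s)

    withSum-K : ∀ e → withSum e (suc s) (λ _ → 1#) ≈ K
    withSum-K e = ≈-trans (withSum-shift e s (λ _ → 1#)) (withoutSum-K e)

    Cₛ-pos : 0# < Cₛ
    Cₛ-pos = sizeCount-pos n s (ℕ.<⇒≤ s<n)

    fromℕ-n : fromℕ (n) ≈ fromℕ s * fromℕ s
    fromℕ-n = ≈-trans (≈-reflexive (≡.cong fromℕ n≡s²)) (fromℕ-* s s)

    -- This is where s = √n enters: (s + 1) Cₛ₊₁ = n K = s² K, so a random (s + 1)-set contains a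
    -- given element with probability at least 1/s.
    Cₛ₊₁≤sK : Cₛ₊₁ ≤ fromℕ s * K
    Cₛ₊₁≤sK = *-cancelˡ-≤ (fromℕ-pos {suc s} (ℕ.s≤s ℕ.z≤n)) (begin
      fromℕ (suc s) * Cₛ₊₁           ≈⟨ size-count s withSum-K ⟩
      fromℕ (n) * K  ≈⟨ *-congʳ fromℕ-n ⟩
      fromℕ s * fromℕ s * K          ≤⟨ ≤-by (*-nonNeg (fromℕ-nonNeg s) (proj₁ K-pos))
        (solve 2 (λ s k → (:1 :+ s) :* (s :* k) :- s :* s :* k := s :* k) ≈-refl (fromℕ s) K) ⟩
      fromℕ (suc s) * (fromℕ s * K) ∎)

    K≤Cₛ : K ≤ Cₛ
    K≤Cₛ = begin
      K  ≈⟨ withoutSum-K e₀ ⟨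
      withoutSum e₀ s (λ _ → 1#)  ≈⟨ withoutSum-sizeSum e₀ s (λ _ → 1#) ⟩
      sizeSum s (λ S → ind (¬? (e₀ ∈? S)) * 1#)
        ≤⟨ sizeSum-mono s (λ S _ → ≤-trans (≤-reflexive (F.*-identityʳ _)) (ind≤1 (¬? (e₀ ∈? S)))) ⟩
      Cₛ ∎

    μ⁺ μ⁻ v : Fin (n) → Carrier
    μ⁺ e = withSum e (suc s) f * K ⁻¹
    μ⁻ e = withoutSum e s f * K ⁻¹
    v e = μ⁺ e - μ⁻ e

    -- Pairing the sets with and without e exhibits v e as the expected marginal of e with respect
    -- to a random s-set avoiding e.
    K*v : ∀ e → K * v e ≈ withoutSum e s (λ S → marginal f S e)
    K*v e = begin-equality
      K * v e
        ≈⟨ solve 3 (λ k a b → k :* (a :- b) := k :* a :- k :* b) ≈-refl K _ _ ⟩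
      K * μ⁺ e - K * μ⁻ e  ≈⟨ +-cong (/-cancel _ K-pos) (-‿cong (/-cancel _ K-pos)) ⟩
      withSum e (suc s) f - withoutSum e s f  ≈⟨ +-congʳ (withSum-shift e s f) ⟩
      withoutSum e s (λ S → f (S ∪ ⁅ e ⁆)) - withoutSum e s f   ≈⟨ ∑-- (subsets n) _ _ ⟨
      ∑ₛ (λ S → _ * f (S ∪ ⁅ e ⁆) - _ * f S)
        ≈⟨ ∑-cong (subsets n) (λ S → solve 3 (λ i a b → i :* (a :- b) := i :* a :- i :* b) ≈-refl _ _ _) ⟨
      withoutSum e s (λ S → marginal f S e) ∎

    v-nonNeg : ∀ e → 0# ≤ v e
    v-nonNeg e = *-cancelˡ-≤ K-pos (begin
      K * 0#     ≈⟨ F.zeroʳ K ⟩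
      0#         ≤⟨ ∑-nonNeg (subsets n) (λ S → ind-*-nonNeg (¬? (e ∈? S) ×-dec (∣ S ∣ ℕ.≟ s)) (λ _ → mono S e)) ⟩
      withoutSum e s (λ S → marginal f S e)    ≈⟨ K*v e ⟨
      K * v e ∎)

    v≤singleton : ∀ e → v e ≤ f ⁅ e ⁆
    v≤singleton e = *-cancelˡ-≤ K-pos (begin
      K * v e  ≈⟨ K*v e ⟩
      withoutSum e s (λ S → marginal f S e)
        ≤⟨ ∑-mono (subsets n) (λ S → ind-*-mono (¬? (e ∈? S) ×-dec (∣ S ∣ ℕ.≟ s)) (λ _ → ≤-trans (gain-≤-value S ⁅ e ⁆) (≤-reflexive (≈-sym (F.*-identityʳ _))))) ⟩
      withoutSum e s (λ _ → f ⁅ e ⁆ * 1#)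
        ≈⟨ ∑-cong (subsets n) (λ S → solve 2 (λ i z → i :* (z :* :1) := (i :* :1) :* z) ≈-refl _ (f ⁅ e ⁆)) ⟩
      ∑ₛ (λ S → ind (¬? (e ∈? S) ×-dec (∣ S ∣ ℕ.≟ s)) * 1# * f ⁅ e ⁆)
        ≈⟨ ∑-*ʳ (subsets n) _ _ ⟩
      withoutSum e s (λ _ → 1#) * f ⁅ e ⁆        ≈⟨ *-congʳ (withoutSum-K e) ⟩
      K * f ⁅ e ⁆ ∎)

    gain : Subset (n) → Carrier
    gain X = sizeSum s (λ R → f (R ∪ X) - f R) * Cₛ ⁻¹

    gain-≤ : ∀ X {y} → sizeSum s (λ R → f (R ∪ X) - f R) ≤ Cₛ * y → gain X ≤ y
    gain-≤ X p = /-≤ Cₛ-pos p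

    const-sizeSum : ∀ y → sizeSum {n} s (λ _ → y) ≈ Cₛ * y
    const-sizeSum y = ≈-trans (sizeSum-cong s (λ _ _ → ≈-sym (F.*-identityʳ y))) (≈-trans (sizeSum-* s y _) (F.*-comm _ _))

    gain-≤-f : ∀ X → gain X ≤ f X
    gain-≤-f X = gain-≤ X (≤-trans (sizeSum-mono s (λ R _ → gain-≤-value R X)) (≤-reflexive (const-sizeSum (f X))))

    gain-mono : ∀ {X Y} → X ⊆ Y → gain X ≤ gain Y
    gain-mono X⊆Y = *-monoˡ-≤ (⁻¹-nonNeg Cₛ-pos) (sizeSum-mono s (λ R _ → +-monoˡ-≤ _ (mono-⊆ (∪-⊆ (p⊆p∪q _) (q⊆p∪q R _ ∘ X⊆Y)))))

    gain-∪ : ∀ X Y → gain (X ∪ Y) ≤ gain X + gain Y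
    gain-∪ X Y = begin
      gain (X ∪ Y)
        ≤⟨ *-monoˡ-≤ (⁻¹-nonNeg Cₛ-pos) (≤-trans (sizeSum-mono s (λ R _ → pointwise R)) (≤-reflexive (sizeSum-+ s _ _))) ⟩
      (sizeSum s (λ R → f (R ∪ X) - f R) + sizeSum s (λ R → f (R ∪ Y) - f R)) * Cₛ ⁻¹
        ≈⟨ F.distribʳ _ _ _ ⟩
      gain X + gain Y ∎
      where
      pointwise : ∀ R → f (R ∪ (X ∪ Y)) - f R ≤ (f (R ∪ X) - f R) + (f (R ∪ Y) - f R)
      pointwise R = begin
        f (R ∪ (X ∪ Y)) - f R  ≡⟨ ≡.cong (λ Z → f Z - f R) (∪-assoc R X Y) ⟨
        f ((R ∪ X) ∪ Y) - f R
          ≈⟨ solve 3 (λ a b c → a :- c := (b :- c) :+ (a :- b)) ≈-refl _ (f (R ∪ X)) _ ⟩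
        (f (R ∪ X) - f R) + (f ((R ∪ X) ∪ Y) - f (R ∪ X))    ≤⟨ +-monoʳ-≤ _ (gain-antitone R (R ∪ X) Y (p⊆p∪q X)) ⟩
        (f (R ∪ X) - f R) + (f (R ∪ Y) - f R) ∎

    -- Submodularity bounds the gain by the marginals of the elements of X. In the average over all
    -- s-sets, those that contain e contribute 0 to its marginal and the others are only K ≤ Cₛ in
    -- number, so the result is at most v e.
    gain-≤-v : ∀ X → gain X ≤ over X v
    gain-≤-v X = gain-≤ X (begin
      sizeSum s (λ R → f (R ∪ X) - f R)  ≤⟨ sizeSum-mono s (λ R _ → gain-≤-over R X) ⟩
      sizeSum s (λ R → over X (marginal f R))  ≈⟨ sizeSum-over s X _ ⟩
      over X (λ e → sizeSum s (λ R → marginal f R e))        ≤⟨ over-mono X (λ {e} _ → bound e) ⟩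
      over X (λ e → Cₛ * v e)
        ≈⟨ ≈-trans (∑-cong (allFin n) (λ e → solve 3 (λ i c x → i :* (c :* x) := c :* (i :* x)) ≈-refl _ Cₛ (v e))) (∑-* (allFin n) Cₛ _) ⟩
      Cₛ * over X v ∎)
      where
      bound : ∀ e → sizeSum s (λ R → marginal f R e) ≤ Cₛ * v e
      bound e = begin
        sizeSum s (λ R → marginal f R e)  ≤⟨ sizeSum-mono s (λ R _ → new R) ⟩
        sizeSum s (λ R → ind (¬? (e ∈? R)) * marginal f R e) ≈⟨ withoutSum-sizeSum e s _ ⟨
        withoutSum e s (λ R → marginal f R e)  ≈⟨ K*v e ⟨
        K * v e  ≤⟨ *-monoˡ-≤ (v-nonNeg e) K≤Cₛ ⟩
        Cₛ * v e ∎
        where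
        new : ∀ R → marginal f R e ≤ ind (¬? (e ∈? R)) * marginal f R e
        new R with e ∈? R
        ... | yes e∈R = ≤-reflexive (begin-equality
          f (R ∪ ⁅ e ⁆) - f R   ≡⟨ ≡.cong (λ Z → f Z - f R) (S∪⁅e⁆≡S e∈R) ⟩
          f R - f R  ≈⟨ F.-‿inverseʳ _ ⟩
          0#  ≈⟨ F.zeroˡ _ ⟨
          0# * marginal f R e ∎)
        ... | no _ = ≤-reflexive (≈-sym (F.*-identityˡ _))

    -- R ∪ X is worth at least f X, so the expected gain falls short of f X by at most the expected
    -- value of R.
    gain-≥ : ∀ X → f X - sizeSum s f * Cₛ ⁻¹ ≤ gain X
    gain-≥ X = *-cancelˡ-≤ Cₛ-pos (begin
      Cₛ * (f X - sizeSum s f * Cₛ ⁻¹)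
        ≈⟨ ≈-trans (solve 3 (λ c a b → c :* (a :- b) := c :* a :- c :* b) ≈-refl Cₛ (f X) _) (+-congˡ (-‿cong (/-cancel _ Cₛ-pos))) ⟩
      Cₛ * f X - sizeSum s f
        ≈⟨ +-congʳ (const-sizeSum (f X)) ⟨
      sizeSum {n} s (λ _ → f X) - sizeSum s f
        ≈⟨ sizeSum-- s _ _ ⟨
      sizeSum s (λ R → f X - f R)
        ≤⟨ sizeSum-mono s (λ R _ → +-monoˡ-≤ _ (mono-⊆ (q⊆p∪q R X))) ⟩
      sizeSum s (λ R → f (R ∪ X) - f R)
        ≈⟨ /-cancel _ Cₛ-pos ⟨
      Cₛ * gain X ∎)

    -- A random (s + 1)-set R collects a marginal of at least w from each element of R ∩ B,
    -- and given its size R ∩ B is a uniformly random subset of B.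
    average-≥ : ∀ (B : Subset (n)) {k w} → k ℕ.≤ ∣ B ∣ → (∀ {e} → e ∈ B → w ≤ v e) →
      fromℕ (∣ B ∣) * w * fromℕ k ≤ (fromℕ k * fromℕ s + fromℕ (∣ B ∣)) * layerAverage B k f
    average-≥ B {k} {w} k≤β w≤v = *-cancelˡ-≤ K-pos (begin
      K * (β * w * fromℕ k)
        ≈⟨ solve 4 (λ K b w k → K :* (b :* w :* k) := k :* (b :* (K :* w))) ≈-refl K β w (fromℕ k) ⟩
      fromℕ k * (β * (K * w))
        ≤⟨ *-monoʳ-≤ (fromℕ-nonNeg k) (begin
           β * (K * w)  ≈⟨ over-const B _ ⟨
           over B (λ _ → K * w)
             ≤⟨ over-mono B (λ {e} e∈B → ≤-trans (*-monoʳ-≤ (proj₁ K-pos) (w≤v e∈B)) (≤-reflexive (loss e))) ⟩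
           over B (λ e → withSum e (suc s) (λ R → f R - f (R ∖ e)))          ≈⟨ sizeSum-over-∩ B (suc s) _ ⟨
           sizeSum (suc s) (λ R → over (R ∩ B) (λ e → f R - f (R ∖ e)))
             ≤⟨ sizeSum-mono (suc s) (λ R _ → losses-≤-value R (R ∩ B) (p∩q⊆p R B)) ⟩
           sizeSum (suc s) (λ R → f (R ∩ B)) ∎) ⟩
      fromℕ k * sizeSum (suc s) (λ R → f (R ∩ B))
        ≈⟨ sizeSum-* (suc s) _ _ ⟨
      sizeSum (suc s) (λ R → fromℕ k * f (R ∩ B))
        ≤⟨ fibrewise B (layerSum-compare k≤β) (suc s) ⟩
      sizeSum (suc s) (λ R → (fromℕ k + fromℕ ∣ R ∩ B ∣) * a)
        ≈⟨ sizeSum-cong (suc s) (λ R _ → solve 3 (λ k r a → (k :+ r) :* a := (a :* k) :* :1 :+ a :* (r :* :1)) ≈-refl (fromℕ k) _ a) ⟩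
      sizeSum (suc s) (λ R → (a * fromℕ k) * 1# + a * (fromℕ ∣ R ∩ B ∣ * 1#))
        ≈⟨ ≈-trans (sizeSum-+ (suc s) _ _) (+-cong (sizeSum-* (suc s) _ _) (sizeSum-* (suc s) _ _)) ⟩
      a * fromℕ k * Cₛ₊₁ + a * sizeSum (suc s) (λ R → fromℕ ∣ R ∩ B ∣ * 1#)
        ≈⟨ +-congˡ (*-congˡ hits) ⟩
      a * fromℕ k * Cₛ₊₁ + a * (β * K)
        ≤⟨ +-monoˡ-≤ _ (*-monoʳ-≤ (*-nonNeg 0≤a (fromℕ-nonNeg k)) Cₛ₊₁≤sK) ⟩
      a * fromℕ k * (fromℕ s * K) + a * (β * K)
        ≈⟨ solve 5 (λ a k s K b → a :* k :* (s :* K) :+ a :* (b :* K) := K :* ((k :* s :+ b) :* a)) ≈-refl a (fromℕ k) (fromℕ s) K β ⟩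
      K * ((fromℕ k * fromℕ s + β) * a) ∎)
      where
      open Averages nonNeg mono submod B using (β; avg; avg-nonNeg; layerSum-compare)
      a = avg k
      0≤a = avg-nonNeg k≤β
      loss : ∀ e → K * v e ≈ withSum e (suc s) (λ R → f R - f (R ∖ e))
      loss e = ≈-trans (K*v e) (≈-sym (≈-trans (withSum-shift e s _) (∑-cong (subsets n) (λ S →
        ind-*-cong (¬? (e ∈? S) ×-dec (∣ S ∣ ℕ.≟ s)) (λ (e∉S , _) → +-congˡ (-‿cong (≈-reflexive (≡.cong f (S∪⁅e⁆∖e e∉S)))))))))
      hits : sizeSum (suc s) (λ R → fromℕ ∣ R ∩ B ∣ * 1#) ≈ β * K
      hits = begin-equality
        sizeSum (suc s) (λ R → fromℕ ∣ R ∩ B ∣ * 1#)           ≈⟨ sizeSum-cong (suc s) (λ R _ → over-const (R ∩ B) 1#) ⟨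
        sizeSum (suc s) (λ R → over (R ∩ B) (λ _ → 1#))        ≈⟨ sizeSum-over-∩ B (suc s) _ ⟩
        over B (λ e → withSum e (suc s) (λ _ → 1#))  ≈⟨ ∑-cong (allFin n) (λ e → *-congˡ (withSum-K e)) ⟩
        over B (λ _ → K)  ≈⟨ over-const B K ⟩
        β * K ∎

  -- The bins

  layerAverage-≥ : ∀ {n} (B : Subset n) j {f : SetFunction n} {z} → j ℕ.≤ ∣ B ∣ →
    (∀ S → S ⊆ B → ∣ S ∣ ≡ j → z ≤ f S) → z ≤ layerAverage B j f
  layerAverage-≥ B j {f} {z} j≤β p = ≤-/ (layerCount-pos B j j≤β) (begin
    layerCount B j * z  ≈⟨ F.*-comm _ _ ⟩
    z * layerCount B j  ≈⟨ layerSum-* B j z (λ _ → 1#) ⟨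
    layerSum B j (λ _ → z * 1#)     ≤⟨ layerSum-mono B j (λ S a b → ≤-trans (≤-reflexive (F.*-identityʳ z)) (p S a b)) ⟩
    layerSum B j f ∎)

  module Bins {n s} {f : SetFunction n}
    (nonNeg : NonNegative f) (mono : Monotone f) (submod : Submodular f)
    (n≡s² : n ≡ s ℕ.* s) (s<n : s ℕ.< n) (e₀ : Fin n)
    {K : Carrier} (K-pos : 0# < K) (withoutSum-K : ∀ (e : Fin n) → withoutSum e s (λ _ → 1#) ≈ K)
    {k : ℕ} {opt η : Carrier} (opt-pos : 0# < opt) (≤-opt : ∀ T → ∣ T ∣ ℕ.≤ k → f T ≤ opt)
    (S⋆ : Subset n) (∣S⋆∣≤k : ∣ S⋆ ∣ ℕ.≤ k) (opt≤ : opt ≤ f S⋆)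
    (v̂ : Fin n → Carrier) (v̂max : Carrier) (v̂≤v̂max : ∀ e → v̂ e ≤ v̂max) (v̂max≤ : ∃[ e ] v̂max ≤ v̂ e)
    where
    open Submod nonNeg mono submod
    open Marginals nonNeg mono submod n≡s² s<n e₀ K-pos withoutSum-K

    threshold : ℕ → Carrier
    threshold j = v̂max * fromℕ (2 ℕ.^ j) ⁻¹

    in-bin? : ∀ j i → Dec (threshold (suc j) < v̂ i × v̂ i ≤ threshold j)
    in-bin? j i = (threshold (suc j) <? v̂ i) ×-dec (v̂ i ≤? threshold j)

    -- Definitionally the `bin` of the algorithm once v̂ is computed from samples. Here v̂ is an
    -- arbitrary function, later with bounded error, which keeps the samples out of the argument.
    binOf : ℕ → Subset n
    binOf j = tabulate (λ i → does (in-bin? j i))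

    -- The optimal elements of all bins from the j-th on, and of no bin at all.
    low : ℕ → Subset n
    low j = S⋆ ∩ tabulate (λ i → does (v̂ i ≤? threshold j))

    2^-pos : ∀ j → 0# < fromℕ (2 ℕ.^ j)
    2^-pos j = fromℕ-pos (ℕ.m^n>0 2 j)

    S⋆⊆low₀ : S⋆ ⊆ low 0
    S⋆⊆low₀ {e} e∈ = x∈p∩q⁺ (e∈ , ∈-tabulate⁺ (λ i → v̂ i ≤? threshold 0) (≤-/ (2^-pos 0)
      (≤-trans (≤-reflexive (≈-trans (*-congʳ (≈-sym 1≈)) (F.*-identityˡ _))) (v̂≤v̂max e))))

    low⊆ : ∀ j → low j ⊆ (S⋆ ∩ binOf j) ∪ low (suc j)
    low⊆ j {e} e∈ with x∈p∩q⁻ S⋆ _ e∈ | v̂ e ≤? threshold (suc j)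
    ... | e∈S⋆ , _ | yes p = q⊆p∪q (S⋆ ∩ binOf j) _ (x∈p∩q⁺ (e∈S⋆ , ∈-tabulate⁺ (λ i → v̂ i ≤? threshold (suc j)) p))
    ... | e∈S⋆ , q | no p = p⊆p∪q _ (x∈p∩q⁺ (e∈S⋆ , ∈-tabulate⁺ (in-bin? j) (≰⇒> p , ∈-tabulate⁻ (λ i → v̂ i ≤? threshold j) q)))

    -- The bins are peeled off one at a time. By subadditivity of the gain, a bin with gain below W
    -- costs at most W, and after L bins only `low L` remains.
    pigeonhole : ∀ W L → (∃[ j ] j ℕ.< L × W ≤ gain (S⋆ ∩ binOf j)) ⊎ gain (low 0) ≤ fromℕ L * W + gain (low L)
    pigeonhole W zero = inj₂ (≤-reflexive (≈-sym (≈-trans (+-congʳ (F.zeroˡ W)) (F.+-identityˡ _))))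
    pigeonhole W (suc L) with pigeonhole W L | W ≤? gain (S⋆ ∩ binOf L)
    ... | inj₁ (j , j<L , p) | _ = inj₁ (j , ℕ.m≤n⇒m≤1+n j<L , p)
    ... | inj₂ _ | yes p = inj₁ (L , ℕ.≤-refl , p)
    ... | inj₂ q | no p = inj₂ (begin
      gain (low 0)  ≤⟨ q ⟩
      fromℕ L * W + gain (low L)  ≤⟨ +-monoʳ-≤ _ (gain-mono (low⊆ L)) ⟩
      fromℕ L * W + gain ((S⋆ ∩ binOf L) ∪ low (suc L))  ≤⟨ +-monoʳ-≤ _ (gain-∪ _ _) ⟩
      fromℕ L * W + (gain (S⋆ ∩ binOf L) + gain (low (suc L)))        ≤⟨ +-monoʳ-≤ _ (+-monoˡ-≤ _ (proj₁ (≰⇒> p))) ⟩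
      fromℕ L * W + (W + gain (low (suc L)))
        ≈⟨ solve 3 (λ l w g → l :* w :+ (w :+ g) := (:1 :+ l) :* w :+ g) ≈-refl (fromℕ L) W _ ⟩
      fromℕ (suc L) * W + gain (low (suc L)) ∎)

    threshold-double : ∀ j → threshold j ≈ fromℕ 2 * threshold (suc j)
    threshold-double j = *-cancelˡ-≈ (2^-pos j) (begin-equality
      fromℕ (2 ℕ.^ j) * threshold j  ≈⟨ /-cancel v̂max (2^-pos j) ⟩
      v̂max  ≈⟨ /-cancel v̂max (2^-pos (suc j)) ⟨
      fromℕ (2 ℕ.^ suc j) * threshold (suc j)           ≈⟨ *-congʳ (fromℕ-* 2 (2 ℕ.^ j)) ⟩
      fromℕ 2 * fromℕ (2 ℕ.^ j) * threshold (suc j)     ≈⟨ solve 2 (λ a t → :2 :* a :* t := a :* (:2 :* t)) ≈-refl _ _ ⟩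
      fromℕ (2 ℕ.^ j) * (fromℕ 2 * threshold (suc j)) ∎)

    module _ (v̂-lower : ∀ e → v e ≤ v̂ e + η) (v̂-upper : ∀ e → v̂ e ≤ v e + η)
      (0≤η : 0# ≤ η) (1≤k : 1 ℕ.≤ k) where

      v̂max≤opt+η : v̂max ≤ opt + η
      v̂max≤opt+η = let e , p = v̂max≤ in ≤-trans p (≤-trans (v̂-upper e) (+-monoˡ-≤ η (≤-trans (v≤singleton e)
              (≤-opt ⁅ e ⁆ (ℕ.≤-trans (ℕ.≤-reflexive (∣⁅x⁆∣≡1 e)) 1≤k)))))

      -- After the last bin, v̂ is at most (opt + η)/2^L, where 2^L ≥ n³/2 ≥ 8n. Hence n such
      -- elements contribute at most opt/8 up to the errors, and 3 log n bins are enough. The factor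
      -- 2 in n³ ≤ 2 * 2^L pays for rounding the logarithm down.
      gain-low-≤ : ∀ {L} → 4 ℕ.≤ n → n ℕ.^ 3 ℕ.≤ 2 ℕ.* 2 ℕ.^ L → fromℕ 16 * (fromℕ n * η) ≤ opt →
        fromℕ 4 * gain (low L) ≤ opt
      gain-low-≤ {L} 4≤n n³≤ 16nη≤ = *-cancelˡ-≤ (fromℕ-pos {4} (ℕ.s≤s ℕ.z≤n)) (begin
        fromℕ 4 * (fromℕ 4 * gain (low L))
          ≤⟨ *-monoʳ-≤ (fromℕ-nonNeg 4) (*-monoʳ-≤ (fromℕ-nonNeg 4) gain≤nq) ⟩
        fromℕ 4 * (fromℕ 4 * (N * (t + η)))
          ≈⟨ solve 3 (λ N t η → :4 :* (:4 :* (N :* (t :+ η))) := con₁₆ :* (N :* t) :+ con₁₆ :* (N :* η)) ≈-refl N t η ⟩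
        fromℕ 16 * (N * t) + fromℕ 16 * (N * η)
          ≤⟨ +-mono-≤ 16Nt≤ 16nη≤ ⟩
        fromℕ 2 * (opt + η) + opt
          ≤⟨ ≤-by (≤⇒0≤ (≤-trans 2η≤16nη 16nη≤)) (solve 2 (λ o η → :4 :* o :- (:2 :* (o :+ η) :+ o) := o :- :2 :* η) ≈-refl opt η) ⟩
        fromℕ 4 * opt ∎)
        where
        N = fromℕ n
        t = (opt + η) * fromℕ (2 ℕ.^ L) ⁻¹
        con₁₆ : ∀ {m} → Polynomial m
        con₁₆ = con (ℤ.+ 16)
        0≤opt+η = +-nonNeg (proj₁ opt-pos) 0≤η
        0≤t : 0# ≤ t
        0≤t = *-nonNeg 0≤opt+η (⁻¹-nonNeg (2^-pos L))
        gain≤nq : gain (low L) ≤ N * (t + η)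
        gain≤nq = begin
          gain (low L)  ≤⟨ gain-≤-v (low L) ⟩
          over (low L) v  ≤⟨ over-mono (low L) (λ {e} e∈ → ≤-trans (v̂-lower e) (+-monoˡ-≤ η
                                          (≤-trans (∈-tabulate⁻ (λ i → v̂ i ≤? threshold L) (proj₂ (x∈p∩q⁻ S⋆ _ e∈)))
                                            (*-monoˡ-≤ (⁻¹-nonNeg (2^-pos L)) v̂max≤opt+η)))) ⟩
          over (low L) (λ _ → t + η) ≈⟨ over-const (low L) _ ⟩
          fromℕ ∣ low L ∣ * (t + η)  ≤⟨ *-monoˡ-≤ (+-nonNeg 0≤t 0≤η) (fromℕ-mono (∣p∣≤n (low L))) ⟩
          N * (t + η) ∎
        16N≤ : fromℕ 16 * N ≤ fromℕ 2 * fromℕ (2 ℕ.^ L)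
        16N≤ = begin
          fromℕ 16 * N  ≈⟨ fromℕ-* 16 n ⟨
          fromℕ (16 ℕ.* n)  ≤⟨ fromℕ-mono (ℕ.≤-trans 16n≤n³ n³≤) ⟩
          fromℕ (2 ℕ.* 2 ℕ.^ L)          ≈⟨ fromℕ-* 2 (2 ℕ.^ L) ⟩
          fromℕ 2 * fromℕ (2 ℕ.^ L) ∎
          where
          16n≤n³ : 16 ℕ.* n ℕ.≤ n ℕ.^ 3
          16n≤n³ = ℕ.≤-trans (ℕ.*-monoˡ-≤ n (ℕ.*-mono-≤ 4≤n 4≤n))
            (ℕ.≤-reflexive (≡.trans (ℕ.*-assoc n n n) (≡.cong (λ x → n ℕ.* (n ℕ.* x)) (≡.sym (ℕ.*-identityʳ n)))))
        16Nt≤ : fromℕ 16 * (N * t) ≤ fromℕ 2 * (opt + η)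
        16Nt≤ = begin
          fromℕ 16 * (N * t)  ≈⟨ F.*-assoc _ _ _ ⟨
          fromℕ 16 * N * t  ≤⟨ *-monoˡ-≤ 0≤t 16N≤ ⟩
          fromℕ 2 * fromℕ (2 ℕ.^ L) * t      ≈⟨ F.*-assoc _ _ _ ⟩
          fromℕ 2 * (fromℕ (2 ℕ.^ L) * t)    ≈⟨ *-congˡ (/-cancel _ (2^-pos L)) ⟩
          fromℕ 2 * (opt + η) ∎
        2η≤16nη : fromℕ 2 * η ≤ fromℕ 16 * (N * η)
        2η≤16nη = ≤-trans (≤-reflexive (*-congˡ (≈-sym (F.*-identityˡ η))))
          (*-mono-≤ (fromℕ-nonNeg 2) (*-nonNeg (fromℕ-nonNeg n) 0≤η) (fromℕ-mono {2} {16} (ℕ.s≤s (ℕ.s≤s ℕ.z≤n)))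
            (*-monoˡ-≤ 0≤η (1≤fromℕ (ℕ.≤-trans (ℕ.s≤s ℕ.z≤n) 4≤n))))

      module _ {W h} {L : ℕ} (W-pos : 0# < W) (8LW≈opt : fromℕ 8 * (fromℕ L * W) ≈ opt)
        (4≤n : 4 ℕ.≤ n) (n³≤ : n ℕ.^ 3 ℕ.≤ 2 ℕ.* 2 ℕ.^ L)
        (16nη≤ : fromℕ 16 * (fromℕ n * η) ≤ opt) (6kη≤ : fromℕ 6 * (fromℕ k * η) ≤ W)
        (small : fromℕ 2 * (sizeSum s f * Cₛ ⁻¹) < opt)
        (0≤h : 0# ≤ h) (h≤1 : h ≤ 1#) (h²s≈1 : h * h * fromℕ s ≈ 1#) where

        good-bin : ∃[ j ] j ℕ.< L × W ≤ gain (S⋆ ∩ binOf j)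
        good-bin with pigeonhole W L
        ... | inj₁ p = p
        -- Otherwise opt/2 < opt - aₛ ≤ L W + gain (low L) ≤ opt/8 + opt/4. The weights 4, 8, 2 and
        -- 1 combine these inequalities into opt ≤ 0.
        ... | inj₂ q = contradiction (≤-by {a = opt} {0#} (+-nonNeg (+-nonNeg (+-nonNeg
              (*-nonNeg (fromℕ-nonNeg 4) (≤⇒0≤ (proj₁ small))) (*-nonNeg (fromℕ-nonNeg 8) (≤⇒0≤ gain-chain)))
              (*-nonNeg (fromℕ-nonNeg 2) (≤⇒0≤ (gain-low-≤ {L} 4≤n n³≤ 16nη≤)))) (≤⇒0≤ (≤-reflexive 8LW≈opt)))
              (solve 4 (λ o a lw g → :0 :- o :=
                :4 :* (o :- :2 :* a) :+ con (ℤ.+ 8) :* ((lw :+ g) :- (o :- a)) :+ :2 :* (o :- :4 :* g) :+ (o :- con (ℤ.+ 8) :* lw))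
                ≈-refl opt aₛ (fromℕ L * W) (gain (low L))))
              (<⇒≱ opt-pos)
          where
          aₛ = sizeSum s f * Cₛ ⁻¹
          gain-chain : opt - aₛ ≤ fromℕ L * W + gain (low L)
          gain-chain = ≤-trans (+-monoˡ-≤ _ opt≤) (≤-trans (gain-≥ S⋆) (≤-trans (gain-mono S⋆⊆low₀) q))

        j⋆ : ℕ
        j⋆ = proj₁ good-bin

        B X : Subset n
        B = binOf j⋆
        X = S⋆ ∩ B

        u : Carrier
        u = threshold (suc j⋆)

        W≤gain : W ≤ gain X
        W≤gain = proj₂ (proj₂ good-bin)

        W≤k[2u+η] : W ≤ fromℕ k * (fromℕ 2 * u + η)
        W≤k[2u+η] = ≤-trans W≤∣X∣y (*-monoˡ-≤ 0≤y (fromℕ-mono (ℕ.≤-trans (∣p∩q∣≤∣p∣ S⋆ B) ∣S⋆∣≤k)))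
          where
          y = fromℕ 2 * u + η
          W≤∣X∣y : W ≤ fromℕ ∣ X ∣ * y
          W≤∣X∣y = begin
            W  ≤⟨ W≤gain ⟩
            gain X  ≤⟨ gain-≤-v X ⟩
            over X v  ≤⟨ over-mono X (λ {e} e∈ → ≤-trans (v̂-lower e) (+-monoˡ-≤ η (≤-trans
                                      (proj₂ (∈-tabulate⁻ (in-bin? j⋆) (proj₂ (x∈p∩q⁻ S⋆ B e∈)))) (≤-reflexive (threshold-double j⋆))))) ⟩
            over X (λ _ → y)     ≈⟨ over-const X y ⟩
            fromℕ ∣ X ∣ * y ∎
          -- The threshold u is a fraction of `v̂max`, whose sign is unknown; that 2u + η is
          -- non-negative follows from W being positive.
          0≤y = proj₁ (*-pos⁻ (fromℕ-nonNeg ∣ X ∣) (<-≤-trans W-pos W≤∣X∣y))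

        -- Doubling the previous bound gives 2W ≤ 4ku + 2kη = 4k(u - η) + 6kη, and 6kη ≤ W: this is
        -- the origin of the 6 in the accuracy.
        W≤4k[u-η] : W ≤ fromℕ 4 * (fromℕ k * (u - η))
        W≤4k[u-η] = ≤-by (+-nonNeg (*-nonNeg (fromℕ-nonNeg 2) (≤⇒0≤ W≤k[2u+η])) (≤⇒0≤ 6kη≤))
          (solve 4 (λ w k u η → :4 :* (k :* (u :- η)) :- w := :2 :* (k :* (:2 :* u :+ η) :- w) :+ (w :- con (ℤ.+ 6) :* (k :* η)))
            ≈-refl W (fromℕ k) u η)

        u-η≤v : ∀ {e} → e ∈ B → u - η ≤ v e
        u-η≤v {e} e∈ = ≤-by (+-nonNeg (≤⇒0≤ (proj₁ (proj₁ (∈-tabulate⁻ (in-bin? j⋆) e∈)))) (≤⇒0≤ (v̂-upper e)))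
          (solve 4 (λ u η v w → v :- (u :- η) := (w :- u) :+ (v :+ η :- w)) ≈-refl u η (v e) (v̂ e))

        W≤f[⊇X] : ∀ T → X ⊆ T → W ≤ f T
        W≤f[⊇X] T X⊆T = ≤-trans W≤gain (≤-trans (gain-≤-f X) (mono-⊆ X⊆T))

        full-average : W ≤ layerAverage B ∣ B ∣ f
        full-average = layerAverage-≥ B ∣ B ∣ ℕ.≤-refl (λ T T⊆B eq → W≤f[⊇X] T (⊆-∣∣-≡ T⊆B eq ∘ p∩q⊆q S⋆ B))

        h*W≤W : h * W ≤ fromℕ 8 * W
        h*W≤W = *-monoˡ-≤ (proj₁ W-pos) (≤-trans h≤1 (1≤fromℕ {8} (ℕ.s≤s ℕ.z≤n)))

        -- Two lower bounds on the average b over k-subsets of B, whose product is W² / √n up to constants: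
        -- b ≥ (k / |B|) W as B contains X, and b ≳ (|B| / (k √n)) W from average-≥.
        large-bin : k ℕ.< ∣ B ∣ → h * W ≤ fromℕ 8 * layerAverage B k f
        large-bin k<β with h * W ≤? fromℕ 8 * layerAverage B k f
        ... | yes p = p
        ... | no ¬p = contradiction 7β≤0 (<⇒≱ (*-pos (fromℕ-pos {7} (ℕ.s≤s ℕ.z≤n)) β-pos))
          where
          open Averages nonNeg mono submod B using (β; avg; avg-nonNeg; avg-concave)
          κ = fromℕ k
          σ = fromℕ s
          b = avg k
          8b≤hW : fromℕ 8 * b ≤ h * W
          8b≤hW = proj₁ (≰⇒> ¬p)
          β-pos : 0# < β
          β-pos = fromℕ-pos (ℕ.≤-trans (ℕ.s≤s ℕ.z≤n) k<β)
          0≤β = proj₁ β-pos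
          κW≤βb : κ * W ≤ β * b
          κW≤βb = ≤-trans (*-monoʳ-≤ (fromℕ-nonNeg k) full-average) (avg-concave (ℕ.≤⇒≤′ (ℕ.<⇒≤ k<β)) ℕ.≤-refl)
          βW≤ : β * W ≤ fromℕ 4 * ((κ * σ + β) * b)
          βW≤ = begin
            β * W  ≤⟨ *-monoʳ-≤ 0≤β W≤4k[u-η] ⟩
            β * (fromℕ 4 * (κ * (u - η)))
              ≈⟨ solve 3 (λ b k x → b :* (:4 :* (k :* x)) := :4 :* (b :* x :* k)) ≈-refl β κ (u - η) ⟩
            fromℕ 4 * (β * (u - η) * κ)  ≤⟨ *-monoʳ-≤ (fromℕ-nonNeg 4) (average-≥ B (ℕ.<⇒≤ k<β) u-η≤v) ⟩
            fromℕ 4 * ((κ * σ + β) * b) ∎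
          8κ≤βh : fromℕ 8 * κ ≤ β * h
          8κ≤βh = *-cancelˡ-≤ W-pos (begin
            W * (fromℕ 8 * κ)      ≈⟨ solve 3 (λ w e k → w :* (e :* k) := e :* (k :* w)) ≈-refl W (fromℕ 8) κ ⟩
            fromℕ 8 * (κ * W)      ≤⟨ *-monoʳ-≤ (fromℕ-nonNeg 8) κW≤βb ⟩
            fromℕ 8 * (β * b)      ≈⟨ solve 3 (λ e b a → e :* (b :* a) := b :* (e :* a)) ≈-refl (fromℕ 8) β b ⟩
            β * (fromℕ 8 * b)      ≤⟨ *-monoʳ-≤ 0≤β 8b≤hW ⟩
            β * (h * W)  ≈⟨ solve 3 (λ b h w → b :* (h :* w) := w :* (b :* h)) ≈-refl β h W ⟩
            W * (β * h) ∎)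
          0≤κσ+β : 0# ≤ κ * σ + β
          0≤κσ+β = +-nonNeg (*-nonNeg (fromℕ-nonNeg k) (fromℕ-nonNeg s)) 0≤β
          2β≤ : fromℕ 2 * β ≤ (κ * σ + β) * h
          2β≤ = *-cancelˡ-≤ (*-pos (fromℕ-pos {4} (ℕ.s≤s ℕ.z≤n)) W-pos) (begin
            fromℕ 4 * W * (fromℕ 2 * β)
              ≈⟨ solve 2 (λ w b → :4 :* w :* (:2 :* b) := con (ℤ.+ 8) :* (b :* w)) ≈-refl W β ⟩
            fromℕ 8 * (β * W)  ≤⟨ *-monoʳ-≤ (fromℕ-nonNeg 8) βW≤ ⟩
            fromℕ 8 * (fromℕ 4 * ((κ * σ + β) * b))
              ≈⟨ solve 3 (λ e y b → e :* (:4 :* (y :* b)) := :4 :* (y :* (e :* b))) ≈-refl (fromℕ 8) _ b ⟩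
            fromℕ 4 * ((κ * σ + β) * (fromℕ 8 * b))    ≤⟨ *-monoʳ-≤ (fromℕ-nonNeg 4) (*-monoʳ-≤ 0≤κσ+β 8b≤hW) ⟩
            fromℕ 4 * ((κ * σ + β) * (h * W))
              ≈⟨ solve 3 (λ y h w → :4 :* (y :* (h :* w)) := :4 :* w :* (y :* h)) ≈-refl _ h W ⟩
            fromℕ 4 * W * ((κ * σ + β) * h) ∎)
          -- The chain is 16β ≤ 8κσh + 8βh ≤ βh²σ + 8β = 9β, by `2β≤`, then `8κ≤βh` and h ≤ 1, and
          -- finally h²σ = 1.
          7β≤0 : fromℕ 7 * β ≤ 0#
          7β≤0 = ≤-by (+-nonNeg (+-nonNeg (*-nonNeg (fromℕ-nonNeg 8) (≤⇒0≤ 2β≤))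
            (*-nonNeg (*-nonNeg (fromℕ-nonNeg s) 0≤h) (≤⇒0≤ 8κ≤βh)))
            (+-nonNeg (*-nonNeg (*-nonNeg (fromℕ-nonNeg 8) 0≤β) (≤⇒0≤ h≤1)) (*-nonNeg 0≤β (≤⇒0≤ (≤-reflexive h²s≈1)))))
            (solve 4 (λ b k s h → :0 :- con (ℤ.+ 7) :* b :=
              con (ℤ.+ 8) :* ((k :* s :+ b) :* h :- :2 :* b) :+ s :* h :* (b :* h :- con (ℤ.+ 8) :* k)
              :+ (con (ℤ.+ 8) :* b :* (:1 :- h) :+ b :* (:1 :- h :* h :* s))) ≈-refl β κ σ h)

        good-bin-value : ∃[ j ] j ℕ.< L × h * W ≤ fromℕ 8 * layerAverage (binOf j) (∣ binOf j ∣ ℕ.⊓ k) f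
        good-bin-value = j⋆ , proj₁ (proj₂ good-bin) , value
          where
          value : h * W ≤ fromℕ 8 * layerAverage B (∣ B ∣ ℕ.⊓ k) f
          value with ℕ.≤-<-connex ∣ B ∣ k
          ... | inj₁ β≤k = ≡.subst (λ m → h * W ≤ fromℕ 8 * layerAverage B m f) (≡.sym (ℕ.m≤n⇒m⊓n≡m β≤k))
                (≤-trans h*W≤W (*-monoʳ-≤ (fromℕ-nonNeg 8) full-average))
          ... | inj₂ k<β = ≡.subst (λ m → h * W ≤ fromℕ 8 * layerAverage B m f) (≡.sym (ℕ.m≥n⇒m⊓n≡n (ℕ.<⇒≤ k<β)))
                (large-bin k<β)

  -- Samples

  open IsDist

  <-resp-≈ʳ : ∀ {x y z} → x < y → y ≈ z → x < z
  <-resp-≈ʳ p e = <-≤-trans p (≤-reflexive e)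

  module _ {a} {A : Set a} where

    mixture-nonNeg : ∀ {ds : List (Dist A)} → All (All (λ (w , _) → 0# ≤ w)) ds → All (λ (w , _) → 0# ≤ w) (mixture ds)
    mixture-nonNeg [] = []
    mixture-nonNeg {d ∷ ds} ps = go (⁻¹-nonNeg (fromℕ-pos {suc (length ds)} (ℕ.s≤s ℕ.z≤n))) ps
      where
      -- The weight is generalised for the induction, since `uniform` fixes it by the length of the
      -- whole list.
      go : ∀ {w} {ds : List (Dist A)} → 0# ≤ w → All (All (λ (w , _) → 0# ≤ w)) ds →
        All (λ (w , _) → 0# ≤ w) (map (w ,_) ds >>= id)
      go 0≤w [] = []
      go 0≤w (p ∷ ps) = All.++⁺ (All.map⁺ (All.map (*-nonNeg 0≤w) p)) (go 0≤w ps)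

    *-𝔼-mixture : ∀ (ds : List (Dist A)) g → 0# < fromℕ (length ds) →
      fromℕ (length ds) * 𝔼 (mixture ds) g ≈ ∑ ds (λ d → 𝔼 d g)
    *-𝔼-mixture ds g p = ≈-trans (*-congˡ (𝔼->>= (uniform ds) id g)) (*-𝔼-uniform ds (λ d → 𝔼 d g) p)

    mixture-isDist : ∀ {ds : List (Dist A)} → 0# < fromℕ (length ds) → All IsDist ds → IsDist (mixture ds)
    mixture-isDist {ds} p dists = record
      { weights-nonNeg = mixture-nonNeg (All.map weights-nonNeg dists)
      ; total = *-cancelˡ-≈ p (≈-trans (*-𝔼-mixture ds _ p) (≈-trans (totals dists) (≈-sym (F.*-identityʳ _)))) }
      where
      totals : ∀ {ds} → All IsDist ds → ∑ ds (λ d → 𝔼 d (λ _ → 1#)) ≈ fromℕ (length ds)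
      totals [] = ≈-refl
      totals (d ∷ ds) = +-cong (total d) (totals ds)

  layer-length : ∀ {n} (B : Subset n) j →
    fromℕ (length (filter (λ S → (S ⊆? B) ×-dec (∣ S ∣ ℕ.≟ j)) (subsets n))) ≈ layerCount B j
  layer-length {n} B j = ≈-trans (length-filter (λ S → (S ⊆? B) ×-dec (∣ S ∣ ℕ.≟ j)) (subsets n))
    (∑-cong (subsets n) (λ S → ≈-sym (F.*-identityʳ _)))

  𝔼-uniformSubsetOf : ∀ {n} (B : Subset n) j g → j ℕ.≤ ∣ B ∣ → 𝔼 (uniformSubsetOf B j) g ≈ layerAverage B j g
  𝔼-uniformSubsetOf {n} B j g j≤β = *-cancelˡ-≈ (layerCount-pos B j j≤β) (begin-equality
    layerCount B j * 𝔼 (uniformSubsetOf B j) g     ≈⟨ *-congʳ (layer-length B j) ⟨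
    fromℕ (length sets) * 𝔼 (uniform sets) g
      ≈⟨ *-𝔼-uniform sets g (<-resp-≈ʳ (layerCount-pos B j j≤β) (≈-sym (layer-length B j))) ⟩
    ∑ sets g  ≈⟨ ∑-filter (λ S → (S ⊆? B) ×-dec (∣ S ∣ ℕ.≟ j)) (subsets n) g ⟩
    layerSum B j g  ≈⟨ layerSum-average B j g j≤β ⟨
    layerCount B j * layerAverage B j g ∎)
    where sets = filter (λ S → (S ⊆? B) ×-dec (∣ S ∣ ℕ.≟ j)) (subsets n)

  size-length : ∀ n j → fromℕ (length (filter (λ S → ∣ S ∣ ℕ.≟ j) (subsets n))) ≈ sizeCount n j
  size-length n j = ≈-trans (length-filter (λ S → ∣ S ∣ ℕ.≟ j) (subsets n))
    (∑-cong (subsets n) (λ S → ≈-sym (F.*-identityʳ _)))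

  uniformOfSize-isDist : ∀ n j → j ℕ.≤ n → IsDist (uniformOfSize {n} j)
  uniformOfSize-isDist n j j≤n = uniform-isDist _ (<-resp-≈ʳ (sizeCount-pos n j j≤n) (≈-sym (size-length n j)))

  *-𝔼-uniformOfSize : ∀ n j g → j ℕ.≤ n → sizeCount n j * 𝔼 (uniformOfSize {n} j) g ≈ sizeSum j g
  *-𝔼-uniformOfSize n j g j≤n = ≈-trans (*-congʳ (≈-sym (size-length n j)))
    (≈-trans (*-𝔼-uniform (filter (λ S → ∣ S ∣ ℕ.≟ j) (subsets n)) g (<-resp-≈ʳ (sizeCount-pos n j j≤n) (≈-sym (size-length n j))))
      (∑-filter (λ S → ∣ S ∣ ℕ.≟ j) (subsets n) g))

  module Sampling {n s k : ℕ} (s<n : s ℕ.< n) (k≤n : k ℕ.≤ n) where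

    𝒟 : Dist (Subset n)
    𝒟 = 𝒟ˢᵘᵇ s k

    sizes : List ℕ
    sizes = k ∷ s ∷ suc s ∷ []

    sizes-≤ : All (ℕ._≤ n) sizes
    sizes-≤ = k≤n ∷ ℕ.<⇒≤ s<n ∷ s<n ∷ []

    𝒟-isDist : IsDist 𝒟
    𝒟-isDist = mixture-isDist (fromℕ-pos {3} (ℕ.s≤s ℕ.z≤n)) (All.map⁺ (All.map (uniformOfSize-isDist n _) sizes-≤))

    -- The sizes other than j contribute 0 and j contributes at least x. This is an inequality
    -- because k may coincide with s or s + 1, and then a size is listed twice.
    𝔼-𝒟-≥ : ∀ {j x} g → j List.∈ sizes → 0# ≤ x → (∀ S → ∣ S ∣ ≢ j → g S ≈ 0#) →
      sizeCount n j * x ≤ sizeSum j g → x ≤ fromℕ 3 * 𝔼 𝒟 g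
    𝔼-𝒟-≥ {j} {x} g j∈ 0≤x vanish p = begin
      x  ≤⟨ x≤ ⟩
      𝔼 (uniformOfSize j) g  ≤⟨ ∈⇒≤∑ (λ i → 𝔼 (uniformOfSize i) g) nonNeg j∈ ⟩
      ∑ sizes (λ i → 𝔼 (uniformOfSize i) g)
        ≈⟨ *-𝔼-mixture (map uniformOfSize sizes) g (fromℕ-pos {3} (ℕ.s≤s ℕ.z≤n)) ⟨
      fromℕ 3 * 𝔼 𝒟 g ∎
      where
      x≤ : x ≤ 𝔼 (uniformOfSize j) g
      x≤ = *-cancelˡ-≤ (sizeCount-pos n j (All.lookup sizes-≤ j∈))
        (≤-trans p (≤-reflexive (≈-sym (*-𝔼-uniformOfSize n j g (All.lookup sizes-≤ j∈)))))
      nonNeg : ∀ i → 0# ≤ 𝔼 (uniformOfSize i) g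
      nonNeg i with i ℕ.≟ j
      ... | yes ≡.refl = ≤-trans 0≤x x≤
      ... | no i≢j = ≤-reflexive (≈-sym (≈-trans (𝔼-uniform (filter (λ S → ∣ S ∣ ℕ.≟ i) (subsets n)) g) (≈-trans (*-congˡ
              (≈-trans (∑-filter (λ S → ∣ S ∣ ℕ.≟ i) (subsets n) g)
                (∑-zero (subsets n) (λ S → ≈-trans (ind-*-cong (∣ S ∣ ℕ.≟ i) (λ e → vanish S (λ e′ → i≢j (≡.trans (≡.sym e) e′)))) (F.zeroʳ _)))))
              (F.zeroʳ _))))

    -- Chebyshev's inequality for a mean of at least y/E and values of modulus at most Dy: the scale
    -- y cancels, and only the integer ED is left to compare with the number of samples.
    deviation-bound : ∀ {g : Subset n → Carrier} {y E D} → 0# < y → y ≤ fromℕ E * 𝔼 𝒟 g →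
      (∀ S → g S * g S ≤ (fromℕ D * y) * (fromℕ D * y)) → ∀ m → 1 ℕ.≤ m →
      fromℕ m * ℙ (iid m 𝒟) (λ Ss → ∑ Ss g ≤? 0#) ≤ fromℕ ((E ℕ.* D) ℕ.* (E ℕ.* D))
    deviation-bound {g} {y} {E} {D} 0<y y≤ bound m 1≤m = *-cancelˡ-≤ (*-pos 0<y 0<y) (begin
      y * y * (M * P)
        ≤⟨ *-monoˡ-≤ 0≤MP (*-mono-≤ (proj₁ 0<y) (≤-trans (proj₁ 0<y) y≤) y≤ y≤) ⟩
      e * u * (e * u) * (M * P)
        ≈⟨ solve 4 (λ e u m p → e :* u :* (e :* u) :* (m :* p) := e :* e :* (m :* (u :* u) :* p)) ≈-refl e u M P ⟩
      e * e * (M * (u * u) * P)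
        ≤⟨ *-monoʳ-≤ (square-nonNeg e) (chebyshev 𝒟-isDist g bound 0≤u ≤-refl m 1≤m) ⟩
      e * e * ((d * y) * (d * y))
        ≈⟨ solve 3 (λ e d y → e :* e :* ((d :* y) :* (d :* y)) := y :* y :* ((e :* d) :* (e :* d))) ≈-refl e d y ⟩
      y * y * ((e * d) * (e * d))
        ≈⟨ *-congˡ (≈-trans (fromℕ-* (E ℕ.* D) (E ℕ.* D)) (*-cong (fromℕ-* E D) (fromℕ-* E D))) ⟨
      y * y * fromℕ ((E ℕ.* D) ℕ.* (E ℕ.* D)) ∎)
      where
      e = fromℕ E
      d = fromℕ D
      u = 𝔼 𝒟 g
      M = fromℕ m
      P = ℙ (iid m 𝒟) (λ Ss → ∑ Ss g ≤? 0#)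
      0≤MP : 0# ≤ M * P
      0≤MP = *-nonNeg (fromℕ-nonNeg m) (𝔼-nonNeg (weights-nonNeg (iid-isDist 𝒟-isDist m)) (λ Ss → ind-nonNeg (∑ Ss g ≤? 0#)))
      0≤u : 0# ≤ u
      0≤u = proj₁ (*-pos⁻ (fromℕ-nonNeg E) (<-≤-trans 0<y y≤))

    -- At most 4n tests, each failing with probability at most 1/(8n), fail with total probability
    -- at most 1/2. Every case of the proof ends here, with its own tests, E and D.
    success : ∀ {i} {I : Set i} (is : List I) (g : I → Subset n → Carrier) {p} {P : U.Pred (List (Subset n)) p}
      (P? : U.Decidable P) {y : I → Carrier} {E D : ℕ} → 1 ℕ.≤ n → length is ℕ.≤ 4 ℕ.* n →
      (∀ i → i List.∈ is → 0# < y i × y i ≤ fromℕ E * 𝔼 𝒟 (g i) ×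
        (∀ S → g i S * g i S ≤ (fromℕ D * y i) * (fromℕ D * y i))) →
      (∀ Ss → (∀ {i} → i List.∈ is → 0# < ∑ Ss (g i)) → P Ss) →
      ∀ m → 1 ℕ.≤ m → (8 ℕ.* n) ℕ.* ((E ℕ.* D) ℕ.* (E ℕ.* D)) ℕ.≤ m → 1 ℕ.≤ E ℕ.* D →
      1# - fromℕ 2 ⁻¹ ≤ ℙ (iid m 𝒟) P?
    success is g P? {y} {E} {D} 1≤n len≤ hyp good m 1≤m m≥ 1≤ED = ≤-trans (+-monoʳ-≤ 1# (neg-mono len*β≤½))
      (union-bound (iid-isDist 𝒟-isDist m) (λ i Ss → ∑ Ss (g i)) P? is small good)
      where
      N8-pos : 0# < fromℕ (8 ℕ.* n)
      N8-pos = fromℕ-pos (ℕ.*-mono-≤ {1} {8} {1} (ℕ.s≤s ℕ.z≤n) 1≤n)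
      β = 1# * fromℕ (8 ℕ.* n) ⁻¹
      Q = (E ℕ.* D) ℕ.* (E ℕ.* D)
      small : ∀ i → i List.∈ is → ℙ (iid m 𝒟) (λ Ss → ∑ Ss (g i) ≤? 0#) ≤ β
      small i i∈ = ≤-/ N8-pos (*-cancelˡ-≤ (fromℕ-pos {Q} (ℕ.*-mono-≤ 1≤ED 1≤ED)) (begin
        fromℕ Q * (fromℕ (8 ℕ.* n) * P)     ≈⟨ solve 3 (λ q a p → q :* (a :* p) := a :* q :* p) ≈-refl (fromℕ Q) _ P ⟩
        fromℕ (8 ℕ.* n) * fromℕ Q * P       ≈⟨ *-congʳ (fromℕ-* (8 ℕ.* n) Q) ⟨
        fromℕ ((8 ℕ.* n) ℕ.* Q) * P
          ≤⟨ *-monoˡ-≤ (𝔼-nonNeg (weights-nonNeg (iid-isDist 𝒟-isDist m)) (λ Ss → ind-nonNeg (∑ Ss (g i) ≤? 0#))) (fromℕ-mono m≥) ⟩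
        fromℕ m * P
          ≤⟨ deviation-bound {E = E} {D} (proj₁ (hyp i i∈)) (proj₁ (proj₂ (hyp i i∈))) (proj₂ (proj₂ (hyp i i∈))) m 1≤m ⟩
        fromℕ Q  ≈⟨ F.*-identityʳ _ ⟨
        fromℕ Q * 1# ∎))
        where P = ℙ (iid m 𝒟) (λ Ss → ∑ Ss (g i) ≤? 0#)
      len*β≤½ : fromℕ (length is) * β ≤ fromℕ 2 ⁻¹
      len*β≤½ = *-cancelˡ-≤ (fromℕ-pos {2} (ℕ.s≤s ℕ.z≤n)) (begin
        fromℕ 2 * (fromℕ (length is) * β)
          ≤⟨ *-monoʳ-≤ (fromℕ-nonNeg 2) (*-monoˡ-≤ (*-nonNeg 0≤1 (⁻¹-nonNeg N8-pos)) (fromℕ-mono len≤)) ⟩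
        fromℕ 2 * (fromℕ (4 ℕ.* n) * β)
          ≈⟨ ≈-trans (≈-sym (F.*-assoc _ _ _)) (*-congʳ (≈-sym (fromℕ-* 2 (4 ℕ.* n)))) ⟩
        fromℕ (2 ℕ.* (4 ℕ.* n)) * β  ≡⟨ ≡.cong (λ z → fromℕ z * β) (≡.sym (ℕ.*-assoc 2 4 n)) ⟩
        fromℕ (8 ℕ.* n) * β  ≈⟨ /-cancel 1# N8-pos ⟩
        1#  ≈⟨ ⁻¹-inverseʳ (fromℕ-pos {2} (ℕ.s≤s ℕ.z≤n)) ⟨
        fromℕ 2 * fromℕ 2 ⁻¹ ∎)

    -- Q is meant to be one of the two classes of samples that v̂ averages over. It makes up at
    -- least a fraction 1/n of the sets of size j, so it is sampled often enough.
    module Estimate {f : SetFunction n} {q} {Q : U.Pred (Subset n) q} (Q? : U.Decidable Q) {j}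
      (j∈ : j List.∈ sizes) (Q⇒size : ∀ {S} → Q S → ∣ S ∣ ≡ j) {κ : Carrier} (κ-pos : 0# < κ)
      (κ≈ : ∑ₛ (λ S → ind (Q? S) * 1#) ≈ κ) (Cj≤nκ : sizeCount n j ≤ fromℕ n * κ)
      {η : Carrier} (0<η : 0# < η) (1≤n : 1 ℕ.≤ n) where

      μ : Carrier
      μ = ∑ₛ (λ S → ind (Q? S) * f S) * κ ⁻¹

      deviation : Bool → Subset n → Carrier
      deviation true S = f S - μ
      deviation false S = μ - f S

      -- Clears the denominator of the sampled average: the sum over the samples is their number in
      -- Q times η plus or minus the error of the average. Over all sets the errors cancel and κ η
      -- remains for either sign, hence the positive mean.
      test : Bool → Subset n → Carrier
      test b S = ind (Q? S) * (η + deviation b S)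

      ∑-test-true : ∀ (xs : List (Subset n)) →
        ∑ xs (test true) ≈ (η - μ) * ∑ xs (λ S → ind (Q? S)) + ∑ xs (λ S → ind (Q? S) * f S)
      ∑-test-true xs = ≈-trans (∑-cong xs (λ S → solve 4 (λ i e m x → i :* (e :+ (x :- m)) := (e :- m) :* i :+ i :* x) ≈-refl _ η μ (f S)))
        (≈-trans (∑-+ xs _ _) (+-congʳ (∑-* xs _ _)))

      ∑-test-false : ∀ (xs : List (Subset n)) →
        ∑ xs (test false) ≈ (η + μ) * ∑ xs (λ S → ind (Q? S)) - ∑ xs (λ S → ind (Q? S) * f S)
      ∑-test-false xs = ≈-trans (∑-cong xs (λ S → solve 4 (λ i e m x → i :* (e :+ (m :- x)) := (e :+ m) :* i :- i :* x) ≈-refl _ η μ (f S)))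
        (≈-trans (∑-- xs _ _) (+-congʳ (∑-* xs _ _)))

      κ≈′ : ∑ₛ (λ S → ind (Q? S)) ≈ κ
      κ≈′ = ≈-trans (∑-cong (subsets n) (λ S → ≈-sym (F.*-identityʳ _))) κ≈

      ∑ₛ-test : ∀ b → ∑ₛ (test b) ≈ κ * η
      ∑ₛ-test true = ≈-trans (∑-test-true (subsets n)) (≈-trans (+-cong (*-congˡ κ≈′) (≈-sym (/-cancel _ κ-pos)))
        (solve 3 (λ k e m → (e :- m) :* k :+ k :* m := k :* e) ≈-refl κ η μ))
      ∑ₛ-test false = ≈-trans (∑-test-false (subsets n)) (≈-trans (+-cong (*-congˡ κ≈′) (-‿cong (≈-sym (/-cancel _ κ-pos))))
        (solve 3 (λ k e m → (e :+ m) :* k :- k :* m := k :* e) ≈-refl κ η μ))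

      N-pos : 0# < fromℕ n
      N-pos = fromℕ-pos 1≤n

      -- The factor 3 is for drawing the size j, the factor n for the share of Q among the sets of
      -- this size.
      test-mean : ∀ b → η ≤ fromℕ (3 ℕ.* n) * 𝔼 𝒟 (test b)
      test-mean b = begin
        η  ≈⟨ /-cancel η N-pos ⟨
        fromℕ n * (η * fromℕ n ⁻¹)
          ≤⟨ *-monoʳ-≤ (fromℕ-nonNeg n) (𝔼-𝒟-≥ (test b) j∈ (*-nonNeg (proj₁ 0<η) (⁻¹-nonNeg N-pos)) vanish enough) ⟩
        fromℕ n * (fromℕ 3 * 𝔼 𝒟 (test b))
          ≈⟨ solve 3 (λ n t e → n :* (t :* e) := t :* n :* e) ≈-refl (fromℕ n) (fromℕ 3) _ ⟩
        fromℕ 3 * fromℕ n * 𝔼 𝒟 (test b)        ≈⟨ *-congʳ (fromℕ-* 3 n) ⟨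
        fromℕ (3 ℕ.* n) * 𝔼 𝒟 (test b) ∎
        where
        vanish : ∀ S → ∣ S ∣ ≢ j → test b S ≈ 0#
        vanish S ne = ≈-trans (*-congʳ (ind-no (Q? S) (ne ∘ Q⇒size))) (F.zeroˡ _)
        enough : sizeCount n j * (η * fromℕ n ⁻¹) ≤ sizeSum j (test b)
        enough = begin
          sizeCount n j * (η * fromℕ n ⁻¹)      ≤⟨ *-monoˡ-≤ (*-nonNeg (proj₁ 0<η) (⁻¹-nonNeg N-pos)) Cj≤nκ ⟩
          fromℕ n * κ * (η * fromℕ n ⁻¹)
            ≈⟨ solve 4 (λ n k e i → n :* k :* (e :* i) := k :* (n :* (e :* i))) ≈-refl (fromℕ n) κ η _ ⟩
          κ * (fromℕ n * (η * fromℕ n ⁻¹))      ≈⟨ *-congˡ (/-cancel η N-pos) ⟩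
          κ * η  ≈⟨ ∑ₛ-test b ⟨
          ∑ₛ (test b)
            ≈⟨ ∑-cong (subsets n) (λ S → ≈-trans (≈-sym (F.*-identityˡ _)) (restrict S (Q? S))) ⟩
          sizeSum j (test b) ∎
          where
          restrict : ∀ S → Dec (Q S) → 1# * test b S ≈ ind (∣ S ∣ ℕ.≟ j) * test b S
          restrict S (yes q) = *-congʳ (≈-sym (ind-yes (∣ S ∣ ℕ.≟ j) (Q⇒size q)))
          restrict S (no ¬q) = ≈-trans (≈-trans (*-congˡ zero-test) (F.zeroʳ _)) (≈-sym (≈-trans (*-congˡ zero-test) (F.zeroʳ _)))
            where
            zero-test : test b S ≈ 0#
            zero-test = ≈-trans (*-congʳ (ind-no (Q? S) ¬q)) (F.zeroˡ _)

      -- Both f S and μ lie between 0 and M, so the deviation has modulus at most M.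
      test-square : (∀ S → 0# ≤ f S) → ∀ {M} → (∀ S → f S ≤ M) → ∀ b S → test b S * test b S ≤ (η + M) * (η + M)
      test-square 0≤f {M} f≤M b S = begin
        test b S * test b S
          ≈⟨ solve 2 (λ i x → i :* x :* (i :* x) := i :* i :* (x :* x)) ≈-refl (ind (Q? S)) (η + deviation b S) ⟩
        ind (Q? S) * ind (Q? S) * (x * x)
          ≤⟨ *-monoˡ-≤ (square-nonNeg x) (*-mono-≤ (ind-nonNeg (Q? S)) 0≤1 (ind≤1 (Q? S)) (ind≤1 (Q? S))) ⟩
        1# * 1# * (x * x)  ≈⟨ solve 1 (λ x → :1 :* :1 :* x := x) ≈-refl (x * x) ⟩
        x * x  ≤⟨ ≤-by (*-nonNeg (proj₁ (bounds b)) (proj₂ (bounds b)))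
             (solve 2 (λ a x → a :* a :- x :* x := (a :- x) :* (a :+ x)) ≈-refl (η + M) x) ⟩
        (η + M) * (η + M) ∎
        where
        x = η + deviation b S
        0≤M = ≤-trans (0≤f S) (f≤M S)
        0≤μ : 0# ≤ μ
        0≤μ = *-nonNeg (∑-nonNeg (subsets n) (λ S → ind-*-nonNeg (Q? S) (λ _ → 0≤f S))) (⁻¹-nonNeg κ-pos)
        μ≤M : μ ≤ M
        μ≤M = /-≤ κ-pos (begin
          ∑ₛ (λ S → ind (Q? S) * f S)     ≤⟨ ∑-mono (subsets n) (λ S → ind-*-mono (Q? S) (λ _ → f≤M S)) ⟩
          ∑ₛ (λ S → ind (Q? S) * M)       ≈⟨ ∑-*ʳ (subsets n) M _ ⟩
          ∑ₛ (λ S → ind (Q? S)) * M       ≈⟨ *-congʳ κ≈′ ⟩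
          κ * M ∎)
        bounds : ∀ b → 0# ≤ (η + M) - (η + deviation b S) × 0# ≤ (η + M) + (η + deviation b S)
        bounds true =
          ≤-trans (+-nonNeg (≤⇒0≤ (f≤M S)) 0≤μ) (≤-reflexive (solve 4 (λ e M f m → (M :- f) :+ m := (e :+ M) :- (e :+ (f :- m))) ≈-refl η M (f S) μ)) ,
          ≤-trans (+-nonNeg (+-nonNeg (+-nonNeg (proj₁ 0<η) (proj₁ 0<η)) (≤⇒0≤ μ≤M)) (0≤f S))
            (≤-reflexive (solve 4 (λ e M f m → e :+ e :+ (M :- m) :+ f := (e :+ M) :+ (e :+ (f :- m))) ≈-refl η M (f S) μ))
        bounds false =
          ≤-trans (+-nonNeg (≤⇒0≤ μ≤M) (0≤f S)) (≤-reflexive (solve 4 (λ e M f m → (M :- m) :+ f := (e :+ M) :- (e :+ (m :- f))) ≈-refl η M (f S) μ)) ,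
          ≤-trans (+-nonNeg (+-nonNeg (+-nonNeg (proj₁ 0<η) (proj₁ 0<η)) (≤⇒0≤ (f≤M S))) 0≤μ)
            (≤-reflexive (solve 4 (λ e M f m → e :+ e :+ (M :- f) :+ m := (e :+ M) :+ (e :+ (m :- f))) ≈-refl η M (f S) μ))

      sampled : List (Subset n) → Carrier
      sampled Ss = average (map proj₂ (filter (λ (S , _) → Q? S) (map (λ S → S , f S) Ss)))

      values : ∀ Ss → map proj₂ (filter (λ (S , _) → Q? S) (map (λ S → S , f S) Ss)) ≡ map f (filter Q? Ss)
      values [] = ≡.refl
      values (S ∷ Ss) with Q? S
      ... | yes _ = ≡.cong (f S ∷_) (values Ss)
      ... | no _ = values Ss

      module _ {Ss : List (Subset n)} (pos : ∀ b → 0# < ∑ Ss (test b)) where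

        private
          κ′ = ∑ Ss (λ S → ind (Q? S))
          N′ = ∑ Ss (λ S → ind (Q? S) * f S)

        -- The two tests add up to 2η times the number of samples in Q. Their positivity thus
        -- excludes the empty average, for which `average` returns 0.
        κ′-pos : 0# < κ′
        κ′-pos = *-pos⁻ (+-nonNeg (proj₁ 0<η) (proj₁ 0<η)) (<-resp-≈ʳ (+-pos (pos true) (proj₁ (pos false)))
          (≈-trans (+-cong (∑-test-true Ss) (∑-test-false Ss))
            (solve 4 (λ e m k x → (e :- m) :* k :+ x :+ ((e :+ m) :* k :- x) := (e :+ e) :* k) ≈-refl η μ κ′ N′)))

        κ′*sampled : κ′ * sampled Ss ≈ N′
        κ′*sampled = begin-equality
          κ′ * sampled Ss  ≡⟨ ≡.cong (λ l → κ′ * average l) (values Ss) ⟩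
          κ′ * (∑ xs f * fromℕ (length (map f xs)) ⁻¹)
            ≡⟨ ≡.cong (λ m → κ′ * (∑ xs f * fromℕ m ⁻¹)) (List.length-map f xs) ⟩
          κ′ * (∑ xs f * fromℕ (length xs) ⁻¹)        ≈⟨ *-congʳ (length-filter Q? Ss) ⟨
          fromℕ (length xs) * (∑ xs f * fromℕ (length xs) ⁻¹)
            ≈⟨ /-cancel _ (<-resp-≈ʳ κ′-pos (≈-sym (length-filter Q? Ss))) ⟩
          ∑ xs f  ≈⟨ ∑-filter Q? Ss f ⟩
          N′ ∎
          where xs = filter Q? Ss

        sampled-upper : sampled Ss ≤ μ + η
        sampled-upper = *-cancelˡ-≤ κ′-pos (≤-by (proj₁ (pos false)) (≈-trans (+-congˡ (-‿cong κ′*sampled))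
          (≈-trans (solve 4 (λ e m k x → k :* (m :+ e) :- x := (e :+ m) :* k :- x) ≈-refl η μ κ′ N′) (≈-sym (∑-test-false Ss)))))

        sampled-lower : μ - η ≤ sampled Ss
        sampled-lower = *-cancelˡ-≤ κ′-pos (≤-by (proj₁ (pos true)) (≈-trans (+-congʳ κ′*sampled)
          (≈-trans (solve 4 (λ e m k x → x :- k :* (m :- e) := (e :- m) :* k :+ x) ≈-refl η μ κ′ N′) (≈-sym (∑-test-true Ss)))))

  -- The algorithm

  n³≤2·2^numBins : ∀ n → n ℕ.^ 3 ℕ.≤ 2 ℕ.* 2 ℕ.^ numBins n
  n³≤2·2^numBins n = ℕ.<⇒≤ (n<2^[1+log₂n] (n ℕ.^ 3))

  numBins≤n³ : ∀ n → numBins n ℕ.≤ n ℕ.^ 3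
  numBins≤n³ n = log₂-≤ (n≤2^n (n ℕ.^ 3))

  numBins≥1 : ∀ {n} → 4 ℕ.≤ n → 1 ℕ.≤ numBins n
  numBins≥1 {n} 4≤n = ≤-log₂ (ℕ.≤-trans (ℕ.s≤s (ℕ.s≤s ℕ.z≤n)) (ℕ.^-monoˡ-≤ 3 4≤n))

  -- With l = ⌊log₂ n⌋, n < 2^(l + 1) bounds the logarithm of n³ by 3(l + 1), and l ≥ 1.
  numBins≤6log : ∀ {n} → 4 ℕ.≤ n → numBins n ℕ.≤ 6 ℕ.* ⌊log₂ n ⌋
  numBins≤6log {n} 4≤n = ℕ.≤-trans
    (log₂-≤ {m = suc l ℕ.* 3} (ℕ.≤-trans (ℕ.^-monoˡ-≤ 3 (ℕ.<⇒≤ (n<2^[1+log₂n] n))) (ℕ.≤-reflexive (ℕ.^-*-assoc 2 (suc l) 3))))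
    (ℕ.≤-trans (ℕ.≤-reflexive (ℕ.*-comm (suc l) 3)) (ℕ.≤-trans (ℕ.*-monoʳ-≤ 3 (ℕ.+-monoˡ-≤ l 1≤l))
      (ℕ.≤-reflexive (≡.trans (≡.cong (λ x → 3 ℕ.* (l ℕ.+ x)) (≡.sym (ℕ.+-identityʳ l))) (≡.sym (ℕ.*-assoc 3 2 l))))))
    where
    l = ⌊log₂ n ⌋
    1≤l : 1 ℕ.≤ l
    1≤l = ≤-log₂ (ℕ.≤-trans (ℕ.s≤s (ℕ.s≤s ℕ.z≤n)) 4≤n)

  √-pos : ∀ {x} → 0# < x → 0# < √ x
  √-pos {x} p = √-nonNeg (proj₁ p) , λ e → proj₂ p (≈-trans (≈-sym (F.zeroˡ _)) (≈-trans (*-congʳ e) (√-square (proj₁ p))))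

  n^-¼-nonNeg : ∀ {n} → 1 ℕ.≤ n → 0# ≤ n^-¼ n
  n^-¼-nonNeg 1≤n = ⁻¹-nonNeg (√-pos (√-pos (fromℕ-pos 1≤n)))

  module _ {n s : ℕ} (n≡s² : n ≡ s ℕ.* s) (1≤s : 1 ℕ.≤ s) where

    private
      r = √ (fromℕ n)
      t = √ r
      1≤n : 1 ℕ.≤ n
      1≤n = ≡.subst (1 ℕ.≤_) (≡.sym n≡s²) (ℕ.*-mono-≤ 1≤s 1≤s)
      r-pos : 0# < r
      r-pos = √-pos (fromℕ-pos 1≤n)
      t-pos : 0# < t
      t-pos = √-pos r-pos
      rr≈ss : r * r ≈ fromℕ s * fromℕ s
      rr≈ss = ≈-trans (√-square (fromℕ-nonNeg n)) (≈-trans (≈-reflexive (≡.cong fromℕ n≡s²)) (fromℕ-* s s))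
      -- Non-negative square roots are unique, so the root of n in the field is the integer s.
      r≈s : r ≈ fromℕ s
      r≈s = ≤-antisym (square-cancel-≤ (proj₁ r-pos) (fromℕ-nonNeg s) (≤-reflexive rr≈ss))
        (square-cancel-≤ (fromℕ-nonNeg s) (proj₁ r-pos) (≤-reflexive (≈-sym rr≈ss)))
      tt≈s : t * t ≈ fromℕ s
      tt≈s = ≈-trans (√-square (proj₁ r-pos)) r≈s

    n^-¼-square : n^-¼ n * n^-¼ n * fromℕ s ≈ 1#
    n^-¼-square = begin-equality
      t ⁻¹ * t ⁻¹ * fromℕ s       ≈⟨ *-congˡ tt≈s ⟨
      t ⁻¹ * t ⁻¹ * (t * t)       ≈⟨ solve 2 (λ i t → i :* i :* (t :* t) := t :* i :* (t :* i)) ≈-refl (t ⁻¹) t ⟩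
      t * t ⁻¹ * (t * t ⁻¹)       ≈⟨ *-cong (⁻¹-inverseʳ t-pos) (⁻¹-inverseʳ t-pos) ⟩
      1# * 1#  ≈⟨ F.*-identityʳ 1# ⟩
      1# ∎

    n^-¼≤1 : n^-¼ n ≤ 1#
    n^-¼≤1 = *-cancelˡ-≤ t-pos (begin
      t * t ⁻¹   ≈⟨ ⁻¹-inverseʳ t-pos ⟩
      1#         ≤⟨ square-cancel-≤ 0≤1 (proj₁ t-pos) (≤-trans (≤-reflexive (F.*-identityʳ 1#))
                      (≤-trans (1≤fromℕ 1≤s) (≤-reflexive (≈-sym tt≈s)))) ⟩
      t          ≈⟨ F.*-identityʳ t ⟨
      t * 1# ∎)

  ∈⇒≤maximum : ∀ {x xs} → x List.∈ xs → x ≤ maximum xs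
  ∈⇒≤maximum {xs = y ∷ xs} (here ≡.refl) = Extrema.⊥≤max totalOrder y xs
  ∈⇒≤maximum {xs = y ∷ xs} (there x∈) = All.lookup (Extrema.xs≤max totalOrder y xs) x∈

  maximum-∈ : ∀ {x xs} → x List.∈ xs → maximum xs List.∈ xs
  maximum-∈ {xs = y ∷ xs} _ with Extrema.argmax-sel totalOrder id y xs
  ... | inj₁ e = here e
  ... | inj₂ m∈ = there m∈

  module _ {n} (k : ℕ) (f : SetFunction n) where

    private
      feasible = filter (λ T → ∣ T ∣ ℕ.≤? k) (subsets n)

    f≤opt : ∀ T → ∣ T ∣ ℕ.≤ k → f T ≤ opt k f
    f≤opt T p = ∈⇒≤maximum (List.∈-map⁺ f (List.∈-filter⁺ (λ T → ∣ T ∣ ℕ.≤? k) (∈-subsets T) p))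

    opt-attained : ∃[ S ] ∣ S ∣ ℕ.≤ k × opt k f ≤ f S
    -- The empty set is feasible, so `maximum` does not return its default 0.
    opt-attained with List.∈-map⁻ f (maximum-∈ (List.∈-map⁺ f (List.∈-filter⁺ (λ T → ∣ T ∣ ℕ.≤? k) (∈-subsets {n} ⊥)
                        (ℕ.≤-trans (ℕ.≤-reflexive (∣⊥∣≡0 n)) ℕ.z≤n))))
    ... | S , S∈ , e = S , proj₂ (List.∈-filter⁻ (λ T → ∣ T ∣ ℕ.≤? k) {xs = subsets n} S∈) , ≤-reflexive (≈-reflexive e)

    sampleSizeIsK? : (x : Subset n × Carrier) → Dec (∣ proj₁ x ∣ ≡ k)
    sampleSizeIsK? = λ (S , _) → ∣ S ∣ ℕ.≟ k

    bestSample-≤ : ∀ 𝒮 → ∣ bestSample k 𝒮 ∣ ℕ.≤ k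
    bestSample-≤ 𝒮 with filter (λ (S , _) → ∣ S ∣ ℕ.≟ k) 𝒮 | All.all-filter sampleSizeIsK? 𝒮
    ... | [] | _ = ℕ.≤-trans (ℕ.≤-reflexive (∣⊥∣≡0 n)) ℕ.z≤n
    ... | x ∷ xs | p ∷ ps = ℕ.≤-reflexive (Extrema.argmax-all totalOrder proj₂ {P = λ x → ∣ proj₁ x ∣ ≡ k} p ps)

    consistent : ∀ Ss → All (λ x → proj₂ x ≡ f (proj₁ x)) (map (λ S → S , f S) Ss)
    consistent Ss = All.map⁺ (All.universal (λ S → ≡.refl) Ss)

    -- The best sample maximises the recorded second components; `consistent` identifies that of the
    -- maximiser with its value under f.
    f≤bestSample : ∀ {S} Ss → S List.∈ Ss → ∣ S ∣ ≡ k → f S ≤ f (bestSample k (map (λ S → S , f S) Ss))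
    f≤bestSample {S} Ss S∈ e
      with filter (λ (S , _) → ∣ S ∣ ℕ.≟ k) (map (λ S → S , f S) Ss)
         | List.∈-filter⁺ sampleSizeIsK? (List.∈-map⁺ (λ S → S , f S) S∈) e
         | All.filter⁺ sampleSizeIsK? {Q = λ x → proj₂ x ≡ f (proj₁ x)} (consistent Ss)
    ... | x ∷ xs | here ≡.refl | q ∷ qs = ≤-trans (Extrema.f[⊥]≤f[argmax] totalOrder {f = proj₂} x xs)
          (≤-reflexive (≈-reflexive (Extrema.argmax-all totalOrder proj₂ {P = λ x → proj₂ x ≡ f (proj₁ x)} q qs)))
    ... | x ∷ xs | there y∈ | q ∷ qs = ≤-trans (All.lookup (Extrema.f[xs]≤f[argmax] totalOrder {f = proj₂} x xs) y∈)
          (≤-reflexive (≈-reflexive (Extrema.argmax-all totalOrder proj₂ {P = λ x → proj₂ x ≡ f (proj₁ x)} q qs)))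

  uniform-surely : ∀ {a p} {A : Set a} {P : U.Pred A p} (xs : List A) → All P xs → Surely (uniform xs) P
  uniform-surely xs ps = All.map⁺ ps

  uniformSubsetOf-nonNeg : ∀ {n} (B : Subset n) j → All (λ (w , _) → 0# ≤ w) (uniformSubsetOf B j)
  uniformSubsetOf-nonNeg {n} B j = uniform-nonNeg (filter (λ S → (S ⊆? B) ×-dec (∣ S ∣ ℕ.≟ j)) (subsets n))

  module _ {n} (s k : ℕ) (𝒮 : List (Sample n)) where

    draw : ℕ → Dist (Subset n)
    draw j = uniformSubsetOf (bin s 𝒮 j) (∣ bin s 𝒮 j ∣ ℕ.⊓ k)

    draw-nonNeg : ∀ j → All (λ (w , _) → 0# ≤ w) (draw j)
    draw-nonNeg j = uniformSubsetOf-nonNeg (bin s 𝒮 j) (∣ bin s 𝒮 j ∣ ℕ.⊓ k)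

    algorithm-surely : Surely (algorithm s k 𝒮) (λ S → ∣ S ∣ ℕ.≤ k)
    algorithm-surely = Surely->>= {d = uniform (return (bestSample k 𝒮) ∷ binAlgorithm s k 𝒮 ∷ [])} {k = λ d → d}
      {P = λ d → Surely d (λ S → ∣ S ∣ ℕ.≤ k)}
      (uniform-surely (return (bestSample k 𝒮) ∷ binAlgorithm s k 𝒮 ∷ []) ((bestSample-≤ k (λ _ → 0#) 𝒮 ∷ []) ∷ bins-surely ∷ [])) (λ d p → p)
      where
      sets : ℕ → List (Subset n)
      sets j = filter (λ S → (S ⊆? bin s 𝒮 j) ×-dec (∣ S ∣ ℕ.≟ ∣ bin s 𝒮 j ∣ ℕ.⊓ k)) (subsets n)
      bins-surely : Surely (binAlgorithm s k 𝒮) (λ S → ∣ S ∣ ℕ.≤ k)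
      bins-surely = Surely->>= {d = uniform (upTo (numBins n))} {k = draw} {P = λ _ → ℕ} (uniform-surely (upTo (numBins n)) (All.universal (λ _ → 0) (upTo (numBins n)))) (λ j _ →
        uniform-surely (sets j) (All.map (λ (_ , e) → ℕ.≤-trans (ℕ.≤-reflexive e) (ℕ.m⊓n≤n (∣ bin s 𝒮 j ∣) k))
          (All.all-filter (λ S → (S ⊆? bin s 𝒮 j) ×-dec (∣ S ∣ ℕ.≟ ∣ bin s 𝒮 j ∣ ℕ.⊓ k)) (subsets n))))

    binAlgorithm-nonNeg : ∀ {g : SetFunction n} → NonNegative g → 0# ≤ 𝔼 (binAlgorithm s k 𝒮) g
    binAlgorithm-nonNeg nonNeg = 𝔼-nonNeg (>>=-nonNeg (uniform-nonNeg (upTo (numBins n))) draw-nonNeg) nonNeg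

    *-𝔼-algorithm : ∀ g → fromℕ 2 * 𝔼 (algorithm s k 𝒮) g ≈ g (bestSample k 𝒮) + 𝔼 (binAlgorithm s k 𝒮) g
    *-𝔼-algorithm g = ≈-trans (*-𝔼-mixture (return (bestSample k 𝒮) ∷ binAlgorithm s k 𝒮 ∷ []) g (fromℕ-pos {2} (ℕ.s≤s ℕ.z≤n)))
      (+-cong (𝔼-return (bestSample k 𝒮) g) (F.+-identityʳ _))

    -- Bin j is drawn with probability 1/L, and the other bins contribute non-negative amounts.
    𝔼-binAlgorithm-≥ : ∀ {g : SetFunction n} → NonNegative g → ∀ {j} → j ℕ.< numBins n →
      layerAverage (bin s 𝒮 j) (∣ bin s 𝒮 j ∣ ℕ.⊓ k) g ≤ fromℕ (numBins n) * 𝔼 (binAlgorithm s k 𝒮) g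
    𝔼-binAlgorithm-≥ {g} nonNeg {j} j<L = begin
      layerAverage (bin s 𝒮 j) (∣ bin s 𝒮 j ∣ ℕ.⊓ k) g
        ≈⟨ 𝔼-uniformSubsetOf (bin s 𝒮 j) _ g (ℕ.m⊓n≤m (∣ bin s 𝒮 j ∣) k) ⟨
      𝔼 (draw j) g
        ≤⟨ ∈⇒≤∑ (λ j → 𝔼 (draw j) g) (λ j → 𝔼-nonNeg (draw-nonNeg j) nonNeg) (List.∈-upTo⁺ j<L) ⟩
      ∑ (upTo L) (λ j → 𝔼 (draw j) g)
        ≈⟨ *-𝔼-uniform (upTo L) _ L-pos ⟨
      fromℕ (length (upTo L)) * 𝔼 (uniform (upTo L)) (λ j → 𝔼 (draw j) g)
        ≈⟨ *-cong (≈-reflexive (≡.cong fromℕ (List.length-upTo L))) (≈-sym (𝔼->>= (uniform (upTo L)) draw g)) ⟩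
      fromℕ L * 𝔼 (binAlgorithm s k 𝒮) g ∎
      where
      L = numBins n
      L-pos : 0# < fromℕ (length (upTo L))
      L-pos = fromℕ-pos (ℕ.≤-trans (ℕ.≤-trans (ℕ.s≤s ℕ.z≤n) j<L) (ℕ.≤-reflexive (≡.sym (List.length-upTo L))))

  -- The two cases

  avoiding-count : ∀ {n j} → j ℕ.< n → ∃[ K ] 0# < K × (∀ (e : Fin n) → withoutSum e j (λ _ → 1#) ≈ K)
  avoiding-count {suc n} {j} (ℕ.s≤s j≤n) = sizeCount n j , sizeCount-pos n j j≤n , λ e → withoutSum-count e j

  ∑-ind-pos⇒∃ : ∀ {a p} {A : Set a} {P : U.Pred A p} (P? : U.Decidable P) xs → 0# < ∑ xs (ind ∘ P?) → ∃[ x ] x List.∈ xs × P x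
  ∑-ind-pos⇒∃ P? [] p = contradiction ≤-refl (<⇒≱ p)
  ∑-ind-pos⇒∃ P? (x ∷ xs) p with P? x
  ... | yes px = x , here ≡.refl , px
  ... | no _ with ∑-ind-pos⇒∃ P? xs (<-resp-≈ʳ p (F.+-identityˡ _))
  ...   | y , y∈ , py = y , there y∈ , py

  -- The loss in the case of the bins: 8L from W = O/(8L), 8 from the value of the good bin, L from
  -- drawing its index, and 2 from the coin of the algorithm. The case of the best sample loses only
  -- 8.
  scale : ℕ → Carrier
  scale n = fromℕ 128 * (fromℕ (numBins n) * fromℕ (numBins n))

  scale-pos : ∀ {n} → 4 ℕ.≤ n → 0# < scale n
  scale-pos 4≤n = *-pos (fromℕ-pos {128} (ℕ.s≤s ℕ.z≤n)) (*-pos L-pos L-pos)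
    where L-pos = fromℕ-pos (numBins≥1 4≤n)

  ratio : ℕ → Carrier
  ratio n = n^-¼ n * scale n ⁻¹

  -- The exponent 2 of the logarithm comes from the two factors `numBins n` of `scale`, each at most
  -- 6 ⌊log₂ n⌋.
  ratio-Ω̃ : Ω̃ n^-¼ ratio
  ratio-Ω̃ = C , ⁻¹-pos C⁻¹-pos , 2 , 4 , bound
    where
    C⁻¹ = fromℕ 128 * (fromℕ 6 * fromℕ 6)
    C = C⁻¹ ⁻¹
    C⁻¹-pos : 0# < C⁻¹
    C⁻¹-pos = *-pos (fromℕ-pos {128} (ℕ.s≤s ℕ.z≤n)) (*-pos (fromℕ-pos {6} (ℕ.s≤s ℕ.z≤n)) (fromℕ-pos {6} (ℕ.s≤s ℕ.z≤n)))
    bound : ∀ n → 4 ℕ.≤ n → C * n^-¼ n ≤ ratio n * fromℕ ⌊log₂ n ⌋ ^ 2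
    bound n 4≤n = begin
      C * h  ≤⟨ *-monoˡ-≤ (n^-¼-nonNeg (ℕ.≤-trans (ℕ.s≤s ℕ.z≤n) 4≤n)) (≤-/ (scale-pos 4≤n) (begin
        a * (L * L) * C
          ≤⟨ *-monoˡ-≤ (⁻¹-nonNeg C⁻¹-pos) (*-monoʳ-≤ (fromℕ-nonNeg 128) (*-mono-≤ 0≤L (≤-trans 0≤L L≤) L≤ L≤)) ⟩
        a * ((b * l) * (b * l)) * C
          ≈⟨ solve 4 (λ a b l i → a :* ((b :* l) :* (b :* l)) :* i := a :* (b :* b) :* (l :* l :* i)) ≈-refl a b l C ⟩
        C⁻¹ * (l * l * C)  ≈⟨ /-cancel _ C⁻¹-pos ⟩
        l * l ∎)) ⟩
      l * l * scale n ⁻¹ * h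
        ≈⟨ solve 3 (λ l z h → l :* l :* z :* h := h :* z :* (l :* (l :* :1))) ≈-refl l (scale n ⁻¹) h ⟩
      ratio n * l ^ 2 ∎
      where
      a = fromℕ 128
      b = fromℕ 6
      l = fromℕ ⌊log₂ n ⌋
      L = fromℕ (numBins n)
      h = n^-¼ n
      0≤L = fromℕ-nonNeg (numBins n)
      L≤ : L ≤ b * l
      L≤ = ≤-trans (fromℕ-mono (numBins≤6log 4≤n)) (≤-reflexive (fromℕ-* 6 ⌊log₂ n ⌋))

  module Guarantee {n s k} (n≡s² : n ≡ s ℕ.* s) (2≤s : 2 ℕ.≤ s) (1≤k : 1 ℕ.≤ k) (k≤n : k ℕ.≤ n)
    {f : SetFunction n} (nonNeg : NonNegative f) (mono : Monotone f) (submod : Submodular f)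
    {m} (n²⁶≤m : n ℕ.^ 26 ℕ.≤ m)
    {α Z : Carrier} (Z-pos : 0# < Z) (Zα≤ : Z * α ≤ n^-¼ n)
    (≤Z : fromℕ 128 * (fromℕ (numBins n) * fromℕ (numBins n)) ≤ Z) where

    4≤n : 4 ℕ.≤ n
    4≤n = ℕ.≤-trans (ℕ.*-mono-≤ 2≤s 2≤s) (ℕ.≤-reflexive (≡.sym n≡s²))

    1≤n : 1 ℕ.≤ n
    1≤n = ℕ.≤-trans (ℕ.s≤s ℕ.z≤n) 4≤n

    1≤s : 1 ℕ.≤ s
    1≤s = ℕ.≤-trans (ℕ.s≤s ℕ.z≤n) 2≤s

    s<n : s ℕ.< n
    s<n = ℕ.≤-trans (ℕ.+-monoˡ-≤ s 1≤s) (ℕ.≤-trans (ℕ.≤-reflexive (≡.cong (s ℕ.+_) (≡.sym (ℕ.+-identityʳ s))))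
      (ℕ.≤-trans (ℕ.*-monoˡ-≤ s 2≤s) (ℕ.≤-reflexive (≡.sym n≡s²))))

    1≤m : 1 ℕ.≤ m
    1≤m = ℕ.≤-trans (ℕ.^-monoˡ-≤ 26 1≤n) n²⁶≤m

    e₀ : Fin n
    e₀ = fromℕ< 1≤n

    h O : Carrier
    h = n^-¼ n
    O = opt k f

    L : ℕ
    L = numBins n

    1≤L : 1 ℕ.≤ L
    1≤L = numBins≥1 4≤n

    0≤h : 0# ≤ h
    0≤h = n^-¼-nonNeg 1≤n

    h≤1 : h ≤ 1#
    h≤1 = n^-¼≤1 n≡s² 1≤s

    h²s≈1 : h * h * fromℕ s ≈ 1#
    h²s≈1 = n^-¼-square n≡s² 1≤s

    samples : List (Subset n) → List (Sample n)
    samples = map (λ S → S , f S)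

    out : List (Subset n) → Dist (Subset n)
    out Ss = algorithm s k (samples Ss)

    Good : List (Subset n) → Set _
    Good Ss = Approximates α k f (out Ss)

    good? : U.Decidable Good
    good? Ss = approximates? α k f (out Ss)

    conclude : ∀ Ss → h * O ≤ Z * 𝔼 (out Ss) f → Good Ss
    conclude Ss p = algorithm-surely s k (samples Ss) , *-cancelˡ-≤ Z-pos (begin
      Z * (α * O)          ≈⟨ F.*-assoc _ _ _ ⟨
      Z * α * O  ≤⟨ *-monoˡ-≤ 0≤O Zα≤ ⟩
      h * O  ≤⟨ p ⟩
      Z * 𝔼 (out Ss) f ∎)
      where
      0≤O : 0# ≤ O
      0≤O = ≤-trans (nonNeg ⊥) (f≤opt k f ⊥ (ℕ.≤-trans (ℕ.≤-reflexive (∣⊥∣≡0 n)) ℕ.z≤n))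

    𝔼-out : ∀ Ss → fromℕ 2 * 𝔼 (out Ss) f ≈ f (bestSample k (samples Ss)) + 𝔼 (binAlgorithm s k (samples Ss)) f
    𝔼-out Ss = *-𝔼-algorithm s k (samples Ss) f

    𝔼-out-nonNeg : ∀ Ss → 0# ≤ 𝔼 (out Ss) f
    𝔼-out-nonNeg Ss = *-cancelˡ-≤ (fromℕ-pos {2} (ℕ.s≤s ℕ.z≤n)) (≤-trans (≤-reflexive (F.zeroʳ _))
      (≤-trans (+-nonNeg (nonNeg (bestSample k (samples Ss))) (binAlgorithm-nonNeg s k (samples Ss) nonNeg)) (≤-reflexive (≈-sym (𝔼-out Ss)))))

    open Submod nonNeg mono submod
    open Sampling {n} {s} {k} s<n k≤n

    -- Every output is good as its expected value is non-negative, so no test has to pass. The case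
    -- is split off because the other two divide by O or measure the accuracy in multiples of O.
    trivial : O ≤ 0# → 1# - fromℕ 2 ⁻¹ ≤ ℙ (iid m 𝒟) good?
    trivial O≤0 = success {I = Unit} [] (λ _ _ → 0#) good? {y = λ _ → 0#} {E = 1} {D = 1} 1≤n ℕ.z≤n (λ _ ()) (λ Ss _ → conclude Ss (begin
        h * O  ≤⟨ *-monoʳ-≤ 0≤h O≤0 ⟩
        h * 0#  ≈⟨ F.zeroʳ h ⟩
        0#  ≤⟨ *-nonNeg (proj₁ Z-pos) (𝔼-out-nonNeg Ss) ⟩
        Z * 𝔼 (out Ss) f ∎)) m 1≤m
      (sample-bound 4≤n (ℕ.*-mono-≤ {1} {9} {1} (ℕ.s≤s ℕ.z≤n) (ℕ.^-monoˡ-≤ 10 1≤n)) n²⁶≤m) ℕ.≤-refl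

    module _ (0<O : 0# < O) where

      private
        attained = opt-attained k f
        S⋆ = proj₁ attained

      sizeCount-average : ∀ j → j ℕ.≤ n → sizeSum j f * sizeCount n j ⁻¹ ≈ layerAverage ⊤ j f
      sizeCount-average j j≤n = *-cancelˡ-≈ (sizeCount-pos n j j≤n) (begin-equality
        sizeCount n j * (sizeSum j f * sizeCount n j ⁻¹)   ≈⟨ /-cancel _ (sizeCount-pos n j j≤n) ⟩
        sizeSum j f  ≈⟨ sizeSum-layerSum j f ⟩
        layerSum ⊤ j f  ≈⟨ layerSum-average ⊤ j f j≤∣⊤∣ ⟨
        layerCount (⊤ {n}) j * layerAverage ⊤ j f          ≈⟨ *-congʳ (sizeCount-layerCount n j) ⟨
        sizeCount n j * layerAverage ⊤ j f ∎)
        where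
        j≤∣⊤∣ : j ℕ.≤ ∣ ⊤ {n} ∣
        j≤∣⊤∣ = ℕ.≤-trans j≤n (ℕ.≤-reflexive (≡.sym (∣⊤∣≡n n)))

      module LargeAverage (large : O ≤ fromℕ 2 * layerAverage ⊤ s f) where
        open Averages nonNeg mono submod (⊤ {n}) using (avg; avg-mono; avg-concave)

        -- The threshold hO/4 suits an average of at least hO/2: the sets below it account for at
        -- most half of that average.
        valuable? : ∀ S → Dec (∣ S ∣ ≡ k × h * O ≤ fromℕ 4 * f S)
        valuable? S = (∣ S ∣ ℕ.≟ k) ×-dec (h * O ≤? fromℕ 4 * f S)

        N : Carrier
        N = fromℕ n

        count : Carrier
        count = sizeSum k (λ S → ind (valuable? S))

        ≤∣⊤∣ : ∀ {j} → j ℕ.≤ n → j ℕ.≤ ∣ ⊤ {n} ∣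
        ≤∣⊤∣ j≤n = ℕ.≤-trans j≤n (ℕ.≤-reflexive (≡.sym (∣⊤∣≡n n)))

        count-nonNeg : 0# ≤ count
        count-nonNeg = SizeSum.sizeSum-nonNeg n k (λ S → ind-nonNeg (valuable? S))

        Ck : Carrier
        Ck = sizeCount n k

        Ck-pos : 0# < Ck
        Ck-pos = sizeCount-pos n k k≤n

        -- N h = s² h ≥ s² h² = s. It turns a fraction of order h of the k-sets into one of order
        -- 1/n.
        1≤Nh : 1# ≤ N * h
        1≤Nh = begin
          1#  ≤⟨ 1≤fromℕ 1≤s ⟩
          fromℕ s  ≈⟨ F.*-identityˡ _ ⟨
          1# * fromℕ s  ≈⟨ *-congʳ h²s≈1 ⟨
          h * h * fromℕ s * fromℕ s   ≈⟨ solve 2 (λ h s → h :* h :* s :* s := s :* s :* h :* h) ≈-refl h (fromℕ s) ⟩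
          fromℕ s * fromℕ s * h * h   ≤⟨ *-monoʳ-≤ (*-nonNeg (*-nonNeg (fromℕ-nonNeg s) (fromℕ-nonNeg s)) 0≤h) h≤1 ⟩
          fromℕ s * fromℕ s * h * 1#  ≈⟨ F.*-identityʳ _ ⟩
          fromℕ s * fromℕ s * h       ≈⟨ *-congʳ (≈-trans (≈-reflexive (≡.cong fromℕ n≡s²)) (fromℕ-* s s)) ⟨
          N * h ∎

        -- If the average is large, so is a large proportion of all values, as none exceeds O.
        many-by-average : h * O ≤ fromℕ 2 * avg k → Ck ≤ fromℕ 4 * N * count
        many-by-average hO≤ = begin
          Ck  ≈⟨ F.*-identityˡ Ck ⟨
          1# * Ck  ≤⟨ *-monoˡ-≤ (proj₁ Ck-pos) 1≤Nh ⟩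
          N * h * Ck  ≈⟨ F.*-assoc _ _ _ ⟩
          N * (h * Ck)  ≤⟨ *-monoʳ-≤ (fromℕ-nonNeg n) (*-cancelˡ-≤ 0<O hOCk≤) ⟩
          N * (fromℕ 4 * count)      ≈⟨ solve 2 (λ n c → n :* (:4 :* c) := :4 :* n :* c) ≈-refl N count ⟩
          fromℕ 4 * N * count ∎
          where
          open SizeSum n
          sizeSum≈ : sizeSum k f ≈ Ck * avg k
          sizeSum≈ = ≈-trans (≈-sym (/-cancel _ Ck-pos)) (*-congˡ (sizeCount-average k k≤n))
          pointwise : ∀ S → ∣ S ∣ ≡ k → fromℕ 4 * f S ≤ fromℕ 4 * O * ind (valuable? S) + h * O * 1#
          pointwise S e = cases (valuable? S)
            where
            cases : (d : Dec (∣ S ∣ ≡ k × h * O ≤ fromℕ 4 * f S)) → fromℕ 4 * f S ≤ fromℕ 4 * O * ind d + h * O * 1#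
            cases (yes _) = ≤-by (+-nonNeg (*-nonNeg (fromℕ-nonNeg 4) (≤⇒0≤ (f≤opt k f S (ℕ.≤-reflexive e)))) (*-nonNeg 0≤h (proj₁ 0<O)))
                (solve 3 (λ x o h → :4 :* o :* :1 :+ h :* o :* :1 :- :4 :* x := :4 :* (o :- x) :+ h :* o) ≈-refl (f S) O h)
            cases (no ¬p) = ≤-trans (proj₁ (≰⇒> (λ q → ¬p (e , q))))
                (≤-reflexive (solve 2 (λ x y → y := x :* :0 :+ y :* :1) ≈-refl (fromℕ 4 * O) (h * O)))
          -- Twice the hypothesis gives 2hO Ck ≤ 4 Ck avg k ≤ 4O count + hO Ck, and one term hO Ck
          -- is moved to the left.
          hOCk≤ : O * (h * Ck) ≤ O * (fromℕ 4 * count)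
          hOCk≤ = ≤-by (+-nonNeg (*-nonNeg (*-nonNeg (fromℕ-nonNeg 2) (proj₁ Ck-pos)) (≤⇒0≤ hO≤)) (≤⇒0≤ (begin
            fromℕ 4 * (Ck * avg k)  ≈⟨ *-congˡ sizeSum≈ ⟨
            fromℕ 4 * sizeSum k f  ≈⟨ sizeSum-* k (fromℕ 4) f ⟨
            sizeSum k (λ S → fromℕ 4 * f S)  ≤⟨ sizeSum-mono k pointwise ⟩
            sizeSum k (λ S → fromℕ 4 * O * ind (valuable? S) + h * O * 1#)
              ≈⟨ ≈-trans (sizeSum-+ k _ _) (+-cong (sizeSum-* k _ _) (sizeSum-* k _ _)) ⟩
            fromℕ 4 * O * count + h * O * Ck ∎)))
            (solve 5 (λ o h C a g → o :* (:4 :* g) :- o :* (h :* C) :=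
              :2 :* C :* (:2 :* a :- h :* o) :+ (:4 :* o :* g :+ h :* o :* C :- :4 :* (C :* a))) ≈-refl O h Ck (avg k) count)

        -- Otherwise k < n^¼, and the best single element is worth O / k already.
        valuable-element : ¬ (h * O ≤ fromℕ 2 * avg k) → ∃[ e ] h * O ≤ f ⁅ e ⁆
        valuable-element hO≰ = search (allFin n) (λ e → List.∈-allFin e)
          where
          κ = fromℕ k
          σ = fromℕ s
          k<s : k ℕ.< s
          k<s = ℕ.≰⇒> λ s≤k → hO≰ (begin
            h * O  ≤⟨ *-monoˡ-≤ (proj₁ 0<O) h≤1 ⟩
            1# * O  ≈⟨ F.*-identityˡ O ⟩
            O  ≤⟨ large ⟩
            fromℕ 2 * avg s      ≤⟨ *-monoʳ-≤ (fromℕ-nonNeg 2) (avg-mono (ℕ.≤⇒≤′ s≤k) (≤∣⊤∣ k≤n)) ⟩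
            fromℕ 2 * avg k ∎)
          κO<σhO : κ * O < σ * (h * O)
          κO<σhO = begin-strict
            κ * O  ≤⟨ *-monoʳ-≤ (fromℕ-nonNeg k) large ⟩
            κ * (fromℕ 2 * avg s)    ≈⟨ solve 3 (λ a b c → a :* (b :* c) := b :* (a :* c)) ≈-refl κ (fromℕ 2) (avg s) ⟩
            fromℕ 2 * (κ * avg s)
              ≤⟨ *-monoʳ-≤ (fromℕ-nonNeg 2) (avg-concave (ℕ.≤⇒≤′ (ℕ.<⇒≤ k<s)) (≤∣⊤∣ (ℕ.<⇒≤ s<n))) ⟩
            fromℕ 2 * (σ * avg k)    ≈⟨ solve 3 (λ a b c → a :* (b :* c) := b :* (a :* c)) ≈-refl (fromℕ 2) σ (avg k) ⟩
            σ * (fromℕ 2 * avg k)    <⟨ *-monoʳ-< (fromℕ-pos 1≤s) (≰⇒> hO≰) ⟩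
            σ * (h * O) ∎
            where
            *-monoʳ-< : ∀ {z x y} → 0# < z → x < y → z * x < z * y
            *-monoʳ-< p (q , ne) = *-monoʳ-≤ (proj₁ p) q , λ e → ne (*-cancelˡ-≈ p e)
          -- Multiplied by σh, the inequality O ≤ κhO becomes σhO ≤ κO because h²σ = 1, against
          -- `κO<σhO`.
          κhO<O : ¬ (O ≤ κ * (h * O))
          κhO<O O≤ = <⇒≱ κO<σhO (begin
            σ * (h * O)  ≤⟨ *-monoʳ-≤ (fromℕ-nonNeg s) (*-monoʳ-≤ 0≤h O≤) ⟩
            σ * (h * (κ * (h * O)))
              ≈⟨ solve 4 (λ s h k o → s :* (h :* (k :* (h :* o))) := h :* h :* s :* (k :* o)) ≈-refl σ h κ O ⟩
            h * h * σ * (κ * O)         ≈⟨ *-congʳ h²s≈1 ⟩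
            1# * (κ * O)  ≈⟨ F.*-identityˡ _ ⟩
            κ * O ∎)
          -- Marginals over the empty set are f ⁅ e ⁆ - f ⊥, and the remaining f ⊥ is absorbed by
          -- the k ≥ 1 copies of f ⊥ that are subtracted.
          none : (∀ e → f ⁅ e ⁆ ≤ h * O) → O ≤ κ * (h * O)
          none p = begin
            O  ≤⟨ proj₂ (proj₂ attained) ⟩
            f S⋆  ≡⟨ ≡.cong f (∪-identityˡ S⋆) ⟨
            f (⊥ ∪ S⋆)  ≈⟨ solve 2 (λ x y → x := x :- y :+ y) ≈-refl _ (f ⊥) ⟩
            f (⊥ ∪ S⋆) - f ⊥ + f ⊥  ≤⟨ +-monoˡ-≤ (f ⊥) (gain-≤-over ⊥ S⋆) ⟩
            over S⋆ (marginal f ⊥) + f ⊥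
              ≤⟨ +-monoˡ-≤ (f ⊥) (over-mono S⋆ (λ {e} _ → +-monoˡ-≤ _ (≤-trans (≤-reflexive (≈-reflexive (≡.cong f (∪-identityˡ ⁅ e ⁆)))) (p e)))) ⟩
            over S⋆ (λ _ → h * O - f ⊥) + f ⊥  ≈⟨ +-congʳ (over-const S⋆ _) ⟩
            fromℕ ∣ S⋆ ∣ * (h * O - f ⊥) + f ⊥
              ≤⟨ +-monoˡ-≤ (f ⊥) (*-monoˡ-≤ (≤⇒0≤ (≤-trans (mono-⊆ ⊥⊆) (p e₀))) (fromℕ-mono (proj₁ (proj₂ attained)))) ⟩
            κ * (h * O - f ⊥) + f ⊥
              ≤⟨ ≤-by (*-nonNeg (≤⇒0≤ (1≤fromℕ 1≤k)) (nonNeg ⊥))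
                   (solve 3 (λ k x b → k :* x :- (k :* (x :- b) :+ b) := (k :- :1) :* b) ≈-refl κ (h * O) (f ⊥)) ⟩
            κ * (h * O) ∎
          search : ∀ es → (∀ e → e List.∈ es) → ∃[ e ] h * O ≤ f ⁅ e ⁆
          search es complete with All.all? (λ e → f ⁅ e ⁆ ≤? h * O) es | ¬All⇒∃ es
            where
            ¬All⇒∃ : ∀ es → ¬ All (λ e → f ⁅ e ⁆ ≤ h * O) es → ∃[ e ] h * O ≤ f ⁅ e ⁆
            ¬All⇒∃ [] q = contradiction [] q
            ¬All⇒∃ (e ∷ es) q with f ⁅ e ⁆ ≤? h * O
            ... | yes r = ¬All⇒∃ es (λ rs → q (r ∷ rs))
            ... | no r = e , proj₁ (≰⇒> r)
          ... | yes all | _ = contradiction (none (λ e → All.lookup all (complete e))) κhO<O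
          ... | no ¬all | find = find ¬all

        -- By monotonicity all k-sets containing e are valuable, and by `size-count` they are a
        -- fraction k/n of the k-sets.
        many-by-element : ∃[ e ] h * O ≤ f ⁅ e ⁆ → Ck ≤ fromℕ 4 * N * count
        many-by-element (e , hO≤) = go 1≤k k≤n ≡.refl
          where
          -- Exposes k as a successor, the form in which `size-count` counts sets.
          go : ∀ {j} → 1 ℕ.≤ j → j ℕ.≤ n → j ≡ k → Ck ≤ fromℕ 4 * N * count
          go {suc j} _ j<n ≡.refl with avoiding-count j<n
          ... | K , K-pos , K≈ = begin
            Ck  ≈⟨ F.*-identityˡ Ck ⟨
            1# * Ck  ≤⟨ *-monoˡ-≤ (proj₁ Ck-pos) (1≤fromℕ 1≤k) ⟩
            fromℕ k * Ck  ≈⟨ size-count j (λ e → ≈-trans (withSum-shift e j _) (K≈ e)) ⟩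
            N * K  ≤⟨ *-monoʳ-≤ (fromℕ-nonNeg n) K≤count ⟩
            N * count
              ≤⟨ *-monoˡ-≤ count-nonNeg (≤-trans (≤-reflexive (≈-sym (F.*-identityˡ N))) (*-monoˡ-≤ (fromℕ-nonNeg n) (1≤fromℕ {4} (ℕ.s≤s ℕ.z≤n)))) ⟩
            fromℕ 4 * N * count ∎
            where
            K≤count : K ≤ count
            K≤count = begin
              K  ≈⟨ ≈-trans (withSum-shift e j _) (K≈ e) ⟨
              withSum e (suc j) (λ _ → 1#)  ≈⟨ withSum-sizeSum e (suc j) _ ⟩
              sizeSum (suc j) (λ S → ind (e ∈? S) * 1#)  ≤⟨ SizeSum.sizeSum-mono n (suc j) (λ S ∣S∣≡ →
                ≤-trans (≤-reflexive (F.*-identityʳ _)) (ind-mono (e ∈? S) (valuable? S) (λ e∈S → ∣S∣≡ , (begin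
                  h * O          ≤⟨ hO≤ ⟩
                  f ⁅ e ⁆        ≤⟨ mono-⊆ (⁅⁆-⊆ e∈S) ⟩
                  f S  ≈⟨ F.*-identityˡ _ ⟨
                  1# * f S       ≤⟨ *-monoˡ-≤ (nonNeg S) (1≤fromℕ {4} (ℕ.s≤s ℕ.z≤n)) ⟩
                  fromℕ 4 * f S ∎)))) ⟩
              count ∎

        many : Ck ≤ fromℕ 4 * N * count
        many with h * O ≤? fromℕ 2 * avg k
        ... | yes p = many-by-average p
        ... | no p = many-by-element (valuable-element p)

        guarantee : 1# - fromℕ 2 ⁻¹ ≤ ℙ (iid m 𝒟) good?
        -- A sample is valuable with probability at least 1/(12n), where 3 is for its size and 4n
        -- for the share of valuable k-sets. The single test asks for one such sample.
        guarantee = success {I = Unit} (tt ∷ []) (λ _ S → ind (valuable? S)) good? {y = λ _ → 1#} {E = 12 ℕ.* n} {D = 1} 1≤n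
          (ℕ.*-mono-≤ {1} {4} {1} (ℕ.s≤s ℕ.z≤n) 1≤n)
          (λ _ _ → 0<1 , mean , λ S → *-mono-≤ (ind-nonNeg (valuable? S)) (*-nonNeg (fromℕ-nonNeg 1) 0≤1) (ind≤ S) (ind≤ S))
          (λ Ss pos → conclude Ss (enough Ss (∑-ind-pos⇒∃ valuable? Ss (pos (here ≡.refl))))) m 1≤m
          (sample-bound 4≤n 12n≤ n²⁶≤m) (ℕ.*-mono-≤ (ℕ.*-mono-≤ {1} {12} {1} (ℕ.s≤s ℕ.z≤n) 1≤n) ℕ.≤-refl)
          where
          4N-pos : 0# < fromℕ 4 * N
          4N-pos = *-pos (fromℕ-pos {4} (ℕ.s≤s ℕ.z≤n)) (fromℕ-pos 1≤n)
          ind≤ : ∀ S → ind (valuable? S) ≤ fromℕ 1 * 1#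
          ind≤ S = ≤-trans (ind≤1 (valuable? S)) (≤-reflexive (≈-trans 1≈ (≈-sym (F.*-identityʳ _))))
          12n≤ : 12 ℕ.* n ℕ.* 1 ℕ.≤ 9 ℕ.* n ℕ.^ 10
          12n≤ = ℕ.≤-trans (ℕ.≤-reflexive (ℕ.*-identityʳ (12 ℕ.* n))) (ℕ.≤-trans
            (ℕ.*-monoˡ-≤ n (ℕ.m≤m+n 12 24)) (ℕ.≤-trans (ℕ.≤-reflexive (ℕ.*-assoc 9 4 n)) (ℕ.*-monoʳ-≤ 9
              (ℕ.≤-trans (ℕ.*-monoˡ-≤ n (ℕ.≤-trans (ℕ.≤-trans 4≤n (ℕ.≤-reflexive (≡.sym (ℕ.^-identityʳ n)))) (ℕ.^-monoʳ-≤ n {{ℕ.>-nonZero 1≤n}} {1} {9} (ℕ.s≤s ℕ.z≤n)))) (ℕ.≤-reflexive (ℕ.*-comm (n ℕ.^ 9) n))))))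
          x = 1# * (fromℕ 4 * N) ⁻¹
          x≤ : x ≤ fromℕ 3 * 𝔼 𝒟 (λ S → ind (valuable? S))
          x≤ = 𝔼-𝒟-≥ _ (here ≡.refl) (*-nonNeg 0≤1 (⁻¹-nonNeg 4N-pos)) (λ S ne → ind-no (valuable? S) (ne ∘ proj₁)) (begin
            Ck * (1# * (fromℕ 4 * N) ⁻¹)     ≈⟨ *-congˡ (F.*-identityˡ _) ⟩
            Ck * (fromℕ 4 * N) ⁻¹  ≤⟨ /-≤ 4N-pos many ⟩
            count ∎)
          mean : 1# ≤ fromℕ (12 ℕ.* n) * 𝔼 𝒟 (λ S → ind (valuable? S))
          mean = begin
            1#  ≈⟨ /-cancel 1# 4N-pos ⟨
            fromℕ 4 * N * x  ≤⟨ *-monoʳ-≤ (proj₁ 4N-pos) x≤ ⟩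
            fromℕ 4 * N * (fromℕ 3 * u)
              ≈⟨ solve 2 (λ n u → :4 :* n :* (:3 :* u) := con (ℤ.+ 12) :* n :* u) ≈-refl N u ⟩
            fromℕ 12 * N * u  ≈⟨ *-congʳ (fromℕ-* 12 n) ⟨
            fromℕ (12 ℕ.* n) * u ∎
            where u = 𝔼 𝒟 (λ S → ind (valuable? S))
          8≤Z : fromℕ 8 ≤ Z
          8≤Z = begin
            fromℕ 8  ≈⟨ solve 1 (λ x → x := x :* (:1 :* :1)) ≈-refl (fromℕ 8) ⟩
            fromℕ 8 * (1# * 1#)
              ≤⟨ *-mono-≤ (fromℕ-nonNeg 8) (*-nonNeg 0≤L 0≤L) (fromℕ-mono (ℕ.m≤m+n 8 120))
                                                       (*-mono-≤ 0≤1 0≤L (1≤fromℕ 1≤L) (1≤fromℕ 1≤L)) ⟩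
            fromℕ 128 * (fromℕ L * fromℕ L)       ≤⟨ ≤Z ⟩
            Z ∎
            where 0≤L = fromℕ-nonNeg L
          enough : ∀ Ss → ∃[ S ] S List.∈ Ss × (∣ S ∣ ≡ k × h * O ≤ fromℕ 4 * f S) → h * O ≤ Z * 𝔼 (out Ss) f
          enough Ss (S , S∈ , ∣S∣≡k , hO≤) = begin
            h * O  ≤⟨ hO≤ ⟩
            fromℕ 4 * f S  ≤⟨ *-monoʳ-≤ (fromℕ-nonNeg 4) (f≤bestSample k f Ss S∈ ∣S∣≡k) ⟩
            fromℕ 4 * best
              ≤⟨ *-monoʳ-≤ (fromℕ-nonNeg 4) (≤-by (binAlgorithm-nonNeg s k (samples Ss) nonNeg) (≈-trans (+-congʳ (𝔼-out Ss)) (solve 2 (λ a b → a :+ b :- a := b) ≈-refl best _))) ⟩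
            fromℕ 4 * (fromℕ 2 * 𝔼 (out Ss) f)        ≈⟨ solve 1 (λ u → :4 :* (:2 :* u) := con (ℤ.+ 8) :* u) ≈-refl _ ⟩
            fromℕ 8 * 𝔼 (out Ss) f  ≤⟨ *-monoˡ-≤ (𝔼-out-nonNeg Ss) 8≤Z ⟩
            Z * 𝔼 (out Ss) f ∎
            where best = f (bestSample k (samples Ss))

      module SmallAverage (small : fromℕ 2 * (sizeSum s f * sizeCount n s ⁻¹) < O) where

        n⁸-pos : 0# < fromℕ (n ℕ.^ 8)
        n⁸-pos = fromℕ-pos (ℕ.^-monoˡ-≤ 8 1≤n)

        L-pos : 0# < fromℕ L
        L-pos = fromℕ-pos 1≤L

        8L-pos : 0# < fromℕ 8 * fromℕ L
        8L-pos = *-pos (fromℕ-pos {8} (ℕ.s≤s ℕ.z≤n)) L-pos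

        η W : Carrier
        η = O * fromℕ (n ℕ.^ 8) ⁻¹
        W = O * (fromℕ 8 * fromℕ L) ⁻¹

        η-pos : 0# < η
        η-pos = *-pos 0<O (⁻¹-pos n⁸-pos)

        0≤η : 0# ≤ η
        0≤η = proj₁ η-pos

        W-pos : 0# < W
        W-pos = *-pos 0<O (⁻¹-pos 8L-pos)

        8LW≈O : fromℕ 8 * (fromℕ L * W) ≈ O
        8LW≈O = ≈-trans (≈-sym (F.*-assoc _ _ _)) (/-cancel O 8L-pos)

        n⁸η≈O : fromℕ (n ℕ.^ 8) * η ≈ O
        n⁸η≈O = /-cancel O n⁸-pos

        96kLη≤O : ∀ {j l} → j ℕ.≤ n → l ℕ.≤ n ℕ.^ 3 → fromℕ 96 * (fromℕ j * fromℕ l) * η ≤ O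
        96kLη≤O {j} {l} j≤n l≤ = begin
          fromℕ 96 * (fromℕ j * fromℕ l) * η      ≈⟨ *-congʳ (≈-trans (fromℕ-* 96 (j ℕ.* l)) (*-congˡ (fromℕ-* j l))) ⟨
          fromℕ (96 ℕ.* (j ℕ.* l)) * η  ≤⟨ *-monoˡ-≤ 0≤η (fromℕ-mono (accuracy-bound 4≤n j≤n l≤)) ⟩
          fromℕ (n ℕ.^ 8) * η  ≈⟨ n⁸η≈O ⟩
          O ∎

        -- The difference v̂ of two estimates is accurate up to twice the accuracy η of each.
        16n[2η]≤O : fromℕ 16 * (fromℕ n * (fromℕ 2 * η)) ≤ O
        16n[2η]≤O = begin
          fromℕ 16 * (fromℕ n * (fromℕ 2 * η))
            ≈⟨ solve 2 (λ n e → con (ℤ.+ 16) :* (n :* (:2 :* e)) := con (ℤ.+ 32) :* (n :* :1) :* e) ≈-refl (fromℕ n) η ⟩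
          fromℕ 32 * (fromℕ n * 1#) * η
            ≤⟨ *-monoˡ-≤ 0≤η (*-mono-≤ (fromℕ-nonNeg 32) (*-nonNeg (fromℕ-nonNeg n) (fromℕ-nonNeg 1)) (fromℕ-mono (ℕ.m≤m+n 32 64)) (*-monoʳ-≤ (fromℕ-nonNeg n) (≤-reflexive 1≈))) ⟩
          fromℕ 96 * (fromℕ n * fromℕ 1) * η      ≤⟨ 96kLη≤O ℕ.≤-refl (ℕ.^-monoˡ-≤ 3 1≤n) ⟩
          O ∎

        6k[2η]≤W : fromℕ 6 * (fromℕ k * (fromℕ 2 * η)) ≤ W
        6k[2η]≤W = *-cancelˡ-≤ 8L-pos (begin
          fromℕ 8 * fromℕ L * (fromℕ 6 * (fromℕ k * (fromℕ 2 * η)))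
            ≈⟨ solve 3 (λ k l e → con (ℤ.+ 8) :* l :* (con (ℤ.+ 6) :* (k :* (:2 :* e))) := con (ℤ.+ 96) :* (k :* l) :* e) ≈-refl (fromℕ k) (fromℕ L) η ⟩
          fromℕ 96 * (fromℕ k * fromℕ L) * η      ≤⟨ 96kLη≤O k≤n (numBins≤n³ n) ⟩
          O  ≈⟨ /-cancel O 8L-pos ⟨
          fromℕ 8 * fromℕ L * W ∎)

        -- Sets larger than k may be worth more than O, but by submodularity at most f ⊥ plus the
        -- values of their singletons, each of which is at most O.
        bound-f : ∀ S → f S ≤ fromℕ n * O + fromℕ n * O
        bound-f S = begin
          f S  ≡⟨ ≡.cong f (∪-identityˡ S) ⟨
          f (⊥ ∪ S)  ≈⟨ solve 2 (λ x y → x := x :- y :+ y) ≈-refl _ (f ⊥) ⟩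
          f (⊥ ∪ S) - f ⊥ + f ⊥
            ≤⟨ +-mono-≤ (≤-trans (gain-≤-over ⊥ S) (over-mono S (λ {e} _ → ≤-trans (gain-≤-value ⊥ ⁅ e ⁆) (f≤opt k f ⁅ e ⁆ (ℕ.≤-trans (ℕ.≤-reflexive (∣⁅x⁆∣≡1 e)) 1≤k)))))
                 (f≤opt k f ⊥ (ℕ.≤-trans (ℕ.≤-reflexive (∣⊥∣≡0 n)) ℕ.z≤n)) ⟩
          over S (λ _ → O) + O  ≈⟨ +-cong (over-const S O) (≈-sym (F.*-identityˡ O)) ⟩
          fromℕ ∣ S ∣ * O + 1# * O
            ≤⟨ +-mono-≤ (*-monoˡ-≤ (proj₁ 0<O) (fromℕ-mono (∣p∣≤n S))) (*-monoˡ-≤ (proj₁ 0<O) (1≤fromℕ 1≤n)) ⟩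
          fromℕ n * O + fromℕ n * O ∎

        private
          counts = avoiding-count s<n
          K = proj₁ counts
          K-pos = proj₁ (proj₂ counts)
          withoutSum-K = proj₂ (proj₂ counts)

        open Marginals nonNeg mono submod n≡s² s<n e₀ K-pos withoutSum-K
          using (withSum-K; v)

        nK≈ : fromℕ (suc s) * sizeCount n (suc s) ≈ fromℕ n * K
        nK≈ = size-count s withSum-K

        Cₛ₊₁≤nK : sizeCount n (suc s) ≤ fromℕ n * K
        Cₛ₊₁≤nK = begin
          sizeCount n (suc s)  ≈⟨ F.*-identityˡ _ ⟨
          1# * sizeCount n (suc s)
            ≤⟨ *-monoˡ-≤ (proj₁ (sizeCount-pos n (suc s) s<n)) (1≤fromℕ {suc s} (ℕ.s≤s ℕ.z≤n)) ⟩
          fromℕ (suc s) * sizeCount n (suc s)     ≈⟨ nK≈ ⟩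
          fromℕ n * K ∎

        Cₛ≤nK : sizeCount n s ≤ fromℕ n * K
        Cₛ≤nK = begin
          sizeCount n s  ≈⟨ F.*-identityˡ _ ⟨
          1# * sizeCount n s
            ≤⟨ *-monoˡ-≤ (proj₁ (sizeCount-pos n s (ℕ.<⇒≤ s<n))) (≤-trans (1≤fromℕ (ℕ.m<n⇒0<n∸m s<n)) (≤-reflexive (fromℕ-∸ (ℕ.<⇒≤ s<n)))) ⟩
          (fromℕ n - fromℕ s) * sizeCount n s     ≈⟨ sizeCount-suc n s ⟨
          fromℕ (suc s) * sizeCount n (suc s)     ≈⟨ nK≈ ⟩
          fromℕ n * K ∎

        module With e = Estimate {f} (λ S → (e ∈? S) ×-dec (∣ S ∣ ℕ.≟ suc s)) (there (there (here ≡.refl))) proj₂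
          K-pos (withSum-K e) Cₛ₊₁≤nK η-pos 1≤n
        module Without e = Estimate {f} (λ S → ¬? (e ∈? S) ×-dec (∣ S ∣ ℕ.≟ s)) (there (here ≡.refl)) proj₂
          K-pos (withoutSum-K e) Cₛ≤nK η-pos 1≤n

        -- The first Boolean selects the samples with or without the element, the second the sign of
        -- the deviation.
        Test : Set
        Test = Fin n × Bool × Bool

        test : Test → Subset n → Carrier
        test (e , true , b) = With.test e b
        test (e , false , b) = Without.test e b

        tests : List Test
        tests = cartesianProduct (allFin n) ((true , true) ∷ (true , false) ∷ (false , true) ∷ (false , false) ∷ [])

        ∈-tests : ∀ e w b → (e , w , b) List.∈ tests
        ∈-tests e w b = List.∈-cartesianProduct⁺ (List.∈-allFin e) (all-pairs w b)
          where
          all-pairs : ∀ w b → (w , b) List.∈ ((true , true) ∷ (true , false) ∷ (false , true) ∷ (false , false) ∷ [])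
          all-pairs true true = here ≡.refl
          all-pairs true false = there (here ≡.refl)
          all-pairs false true = there (there (here ≡.refl))
          all-pairs false false = there (there (there (here ≡.refl)))

        length-tests : length tests ℕ.≤ 4 ℕ.* n
        length-tests = ℕ.≤-reflexive (≡.trans (length-product (allFin n)) (≡.trans (≡.cong (ℕ._* 4) (List.length-tabulate {n = n} id)) (ℕ.*-comm n 4)))
          where
          length-product : ∀ (es : List (Fin n)) →
            length (cartesianProduct es ((true , true) ∷ (true , false) ∷ (false , true) ∷ (false , false) ∷ [])) ≡ length es ℕ.* 4
          length-product [] = ≡.refl
          length-product (e ∷ es) = ≡.cong (4 ℕ.+_) (length-product es)

        test-mean : ∀ i → η ≤ fromℕ (3 ℕ.* n) * 𝔼 𝒟 (test i)
        test-mean (e , true , b) = With.test-mean e b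
        test-mean (e , false , b) = Without.test-mean e b

        -- A test takes values of modulus up to η + 2nO, where nO = n^9 η and η ≤ n^9 η.
        D : ℕ
        D = 3 ℕ.* n ℕ.^ 9

        η+M≤Dη : η + (fromℕ n * O + fromℕ n * O) ≤ fromℕ D * η
        η+M≤Dη = begin
          η + (fromℕ n * O + fromℕ n * O)
            ≈⟨ +-cong (F.*-identityˡ η) (+-cong nO≈ nO≈) ⟨
          1# * η + (fromℕ (n ℕ.^ 9) * η + fromℕ (n ℕ.^ 9) * η)
            ≤⟨ +-monoˡ-≤ _ (*-monoˡ-≤ 0≤η (1≤fromℕ (ℕ.^-monoˡ-≤ 9 1≤n))) ⟩
          fromℕ (n ℕ.^ 9) * η + (fromℕ (n ℕ.^ 9) * η + fromℕ (n ℕ.^ 9) * η)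
            ≈⟨ solve 2 (λ p e → p :* e :+ (p :* e :+ p :* e) := :3 :* p :* e) ≈-refl _ η ⟩
          fromℕ 3 * fromℕ (n ℕ.^ 9) * η
            ≈⟨ *-congʳ (fromℕ-* 3 (n ℕ.^ 9)) ⟨
          fromℕ D * η ∎
          where
          nO≈ : fromℕ (n ℕ.^ 9) * η ≈ fromℕ n * O
          nO≈ = ≈-trans (*-congʳ (fromℕ-* n (n ℕ.^ 8))) (≈-trans (F.*-assoc _ _ _) (*-congˡ n⁸η≈O))

        test-square : ∀ i S → test i S * test i S ≤ (fromℕ D * η) * (fromℕ D * η)
        test-square i S = ≤-trans (square i) (*-mono-≤ 0≤ (≤-trans 0≤ η+M≤Dη) η+M≤Dη η+M≤Dη)
          where
          0≤ : 0# ≤ η + (fromℕ n * O + fromℕ n * O)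
          0≤ = +-nonNeg 0≤η (≤-trans (nonNeg S) (bound-f S))
          square : ∀ i → test i S * test i S ≤ (η + (fromℕ n * O + fromℕ n * O)) * (η + (fromℕ n * O + fromℕ n * O))
          square (e , true , b) = With.test-square e nonNeg bound-f b S
          square (e , false , b) = Without.test-square e nonNeg bound-f b S

        module _ {Ss : List (Subset n)} (pass : ∀ {i} → i List.∈ tests → 0# < ∑ Ss (test i)) where

          𝒮 : List (Sample n)
          𝒮 = samples Ss

          with-pass : ∀ e b → 0# < ∑ Ss (With.test e b)
          with-pass e b = pass (∈-tests e true b)

          without-pass : ∀ e b → 0# < ∑ Ss (Without.test e b)
          without-pass e b = pass (∈-tests e false b)

          v̂-lower : ∀ e → v e ≤ v̂ s 𝒮 e + fromℕ 2 * η
          v̂-lower e = ≤-by (+-nonNeg (≤⇒0≤ (With.sampled-lower e {Ss} (with-pass e))) (≤⇒0≤ (Without.sampled-upper e {Ss} (without-pass e))))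
            (solve 5 (λ a b x y e → x :- y :+ :2 :* e :- (a :- b) := (x :- (a :- e)) :+ (b :+ e :- y)) ≈-refl
              (With.μ e) (Without.μ e) (With.sampled e Ss) (Without.sampled e Ss) η)

          v̂-upper : ∀ e → v̂ s 𝒮 e ≤ v e + fromℕ 2 * η
          v̂-upper e = ≤-by (+-nonNeg (≤⇒0≤ (With.sampled-upper e {Ss} (with-pass e))) (≤⇒0≤ (Without.sampled-lower e {Ss} (without-pass e))))
            (solve 5 (λ a b x y e → a :- b :+ :2 :* e :- (x :- y) := (a :+ e :- x) :+ (y :- (b :- e))) ≈-refl
              (With.μ e) (Without.μ e) (With.sampled e Ss) (Without.sampled e Ss) η)

          v̂≤v̂max : ∀ e → v̂ s 𝒮 e ≤ v̂max s 𝒮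
          v̂≤v̂max e = ∈⇒≤maximum (List.∈-map⁺ (v̂ s 𝒮) (List.∈-allFin e))

          v̂max-attained : ∃[ e ] v̂max s 𝒮 ≤ v̂ s 𝒮 e
          v̂max-attained with List.∈-map⁻ (v̂ s 𝒮) (maximum-∈ (List.∈-map⁺ (v̂ s 𝒮) (List.∈-allFin e₀)))
          ... | e , _ , eq = e , ≤-reflexive (≈-reflexive eq)

          bin-value : ∃[ j ] j ℕ.< L × h * W ≤ fromℕ 8 * layerAverage (bin s 𝒮 j) (∣ bin s 𝒮 j ∣ ℕ.⊓ k) f
          bin-value = Bins.good-bin-value nonNeg mono submod n≡s² s<n e₀ K-pos withoutSum-K 0<O (f≤opt k f)
            S⋆ (proj₁ (proj₂ attained)) (proj₂ (proj₂ attained)) (v̂ s 𝒮) (v̂max s 𝒮) v̂≤v̂max v̂max-attained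
            v̂-lower v̂-upper (*-nonNeg (fromℕ-nonNeg 2) 0≤η) 1≤k W-pos 8LW≈O 4≤n (n³≤2·2^numBins n)
            16n[2η]≤O 6k[2η]≤W small 0≤h h≤1 h²s≈1

          enough : h * O ≤ Z * 𝔼 (out Ss) f
          enough = begin
            h * O  ≈⟨ *-congˡ 8LW≈O ⟨
            h * (fromℕ 8 * (fromℕ L * W))
              ≈⟨ solve 4 (λ h e l w → h :* (e :* (l :* w)) := e :* l :* (h :* w)) ≈-refl h (fromℕ 8) (fromℕ L) W ⟩
            fromℕ 8 * fromℕ L * (h * W)  ≤⟨ *-monoʳ-≤ (proj₁ 8L-pos) (proj₂ (proj₂ bin-value)) ⟩
            fromℕ 8 * fromℕ L * (fromℕ 8 * average⋆)
              ≤⟨ *-monoʳ-≤ (proj₁ 8L-pos) (*-monoʳ-≤ (fromℕ-nonNeg 8) (𝔼-binAlgorithm-≥ s k 𝒮 nonNeg (proj₁ (proj₂ bin-value)))) ⟩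
            fromℕ 8 * fromℕ L * (fromℕ 8 * (fromℕ L * 𝔼 (binAlgorithm s k 𝒮) f))
              ≤⟨ *-monoʳ-≤ (proj₁ 8L-pos) (*-monoʳ-≤ (fromℕ-nonNeg 8) (*-monoʳ-≤ (fromℕ-nonNeg L) bin≤)) ⟩
            fromℕ 8 * fromℕ L * (fromℕ 8 * (fromℕ L * (fromℕ 2 * 𝔼 (out Ss) f)))
              ≈⟨ solve 2 (λ l u → con (ℤ.+ 8) :* l :* (con (ℤ.+ 8) :* (l :* (:2 :* u))) := con (ℤ.+ 128) :* (l :* l) :* u) ≈-refl (fromℕ L) (𝔼 (out Ss) f) ⟩
            fromℕ 128 * (fromℕ L * fromℕ L) * 𝔼 (out Ss) f
              ≤⟨ *-monoˡ-≤ (𝔼-out-nonNeg Ss) ≤Z ⟩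
            Z * 𝔼 (out Ss) f ∎
            where
            average⋆ = layerAverage (bin s 𝒮 (proj₁ bin-value)) (∣ bin s 𝒮 (proj₁ bin-value) ∣ ℕ.⊓ k) f
            bin≤ : 𝔼 (binAlgorithm s k 𝒮) f ≤ fromℕ 2 * 𝔼 (out Ss) f
            bin≤ = ≤-by (nonNeg (bestSample k 𝒮)) (≈-trans (+-congʳ (𝔼-out Ss))
              (solve 2 (λ a b → a :+ b :- b := a) ≈-refl (f (bestSample k 𝒮)) (𝔼 (binAlgorithm s k 𝒮) f)))

        guarantee : 1# - fromℕ 2 ⁻¹ ≤ ℙ (iid m 𝒟) good?
        guarantee = success tests test good? {y = λ _ → η} {E = 3 ℕ.* n} {D = D} 1≤n length-tests
          (λ i _ → η-pos , test-mean i , test-square i)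
          (λ Ss pass → conclude Ss (enough {Ss} pass)) m 1≤m
          (sample-bound 4≤n (ℕ.≤-reflexive 3n*D≡) n²⁶≤m)
          (ℕ.*-mono-≤ (ℕ.*-mono-≤ {1} {3} {1} (ℕ.s≤s ℕ.z≤n) 1≤n) (ℕ.*-mono-≤ {1} {3} {1} (ℕ.s≤s ℕ.z≤n) (ℕ.^-monoˡ-≤ 9 1≤n)))
          where
          3n*D≡ : 3 ℕ.* n ℕ.* (3 ℕ.* n ℕ.^ 9) ≡ 9 ℕ.* n ℕ.^ 10
          3n*D≡ = ℕ.[m*n]*[o*p]≡[m*o]*[n*p] 3 n 3 (n ℕ.^ 9)

    guarantee : 1# - fromℕ 2 ⁻¹ ≤ ℙ (iid m 𝒟) good?
    guarantee = cases (O ≤? 0#) (O ≤? fromℕ 2 * layerAverage ⊤ s f)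
      where
      cases : Dec (O ≤ 0#) → Dec (O ≤ fromℕ 2 * layerAverage ⊤ s f) → 1# - fromℕ 2 ⁻¹ ≤ ℙ (iid m 𝒟) good?
      cases (yes O≤0) _ = trivial O≤0
      cases (no O≰0) (yes large) = LargeAverage.guarantee (≰⇒> O≰0) large
      cases (no O≰0) (no ¬large) = SmallAverage.guarantee (≰⇒> O≰0) (≤-<-trans (*-monoʳ-≤ (fromℕ-nonNeg 2)
        (≤-reflexive (sizeCount-average (≰⇒> O≰0) s (ℕ.<⇒≤ s<n)))) (≰⇒> ¬large))

  theorem : ∃[ α ] Ω̃ n^-¼ α × IsOPS α algorithm 𝒟ˢᵘᵇ NonNegativeMonotoneSubmodular
  theorem = ratio , ratio-Ω̃ , fromℕ 2 ⁻¹ , ⁻¹-nonNeg 2-pos , ½<1 , 26 ,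
    λ n s k n≡s² 2≤s 1≤k k≤n f (nonNeg , mono , submod) m n²⁶≤m →
      let 4≤n = ℕ.≤-trans (ℕ.*-mono-≤ 2≤s 2≤s) (ℕ.≤-reflexive (≡.sym n≡s²)) in
      Guarantee.guarantee n≡s² 2≤s 1≤k k≤n nonNeg mono submod n²⁶≤m (scale-pos 4≤n)
        (≤-reflexive (/-cancel (n^-¼ n) (scale-pos 4≤n))) ≤-refl
    where
    2-pos : 0# < fromℕ 2
    2-pos = fromℕ-pos {2} (ℕ.s≤s ℕ.z≤n)
    ½<1 : fromℕ 2 ⁻¹ < 1#
    ½<1 = <-resp-≈ʳ (<-double (⁻¹-pos 2-pos)) (≈-trans
      (solve 1 (λ x → x :+ x := :2 :* x) ≈-refl (fromℕ 2 ⁻¹)) (⁻¹-inverseʳ 2-pos))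
      where
      <-double : ∀ {x} → 0# < x → x < x + x
      <-double {x} (p , ne) = ≤-by p (solve 1 (λ x → x :+ x :- x := x) ≈-refl x) ,
        λ e → ne (≈-trans (≈-sym (F.-‿inverseʳ x)) (≈-trans (+-congʳ e) (solve 1 (λ x → x :+ x :- x := x) ≈-refl x)))

theorem3 : ∀ {c ℓ₁ ℓ₂} (ℝ : EuclideanField c ℓ₁ ℓ₂) → let open OPS ℝ in
    ∃[ α ] Ω̃ n^-¼ α × IsOPS α algorithm 𝒟ˢᵘᵇ NonNegativeMonotoneSubmodular
theorem3 ℝ = Analysis.theorem ℝ
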